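{- Let $p,q\ge 3$ and $n\ge p+q-1$ be integers. Let $G\in \mathscr{B}_n^{p,q}$ with $G\neq S_n^{p,q}$ (up to isomorphism). Then $D_R(G)>D_R(S_n^{p,q})$.
   Context: All graphs are finite, simple and connected. For vertices $u,v$ of a graph $G$, the resistance distance $r(u,v)$ is the effective resistance between $u$ and $v$ in the electrical network obtained from $G$ by replacing every edge by a unit resistor. The degree resistance distance of $G$ is $D_R(G)=\sum_{\{u,v\}\subseteq V(G)}[d(u)+d(v)]\,r(u,v)$, where $d(u)$ is the degree of $u$ and the sum runs over unordered pairs of distinct vertices. A bicyclic graph is a connected graph with $|E(G)|=|V(G)|+1$. $\mathscr{B}_n^{p,q}$ denotes the set of $n$-vertex bicyclic graphs having exactly two cycles, of lengths $p$ and $q$; equivalently, graphs consisting of two cycles $C_p=v_1v_2\cdots v_pv_1$ and $C_q=u_1u_2\cdots u_qu_1$ joined by a path $v_1w_1\cdots w_{m-1}u_1$ of length $m\ge 0$ (when $m=0$, $v_1=u_1$ and the cycles share exactly this vertex), together with trees rooted at each vertex of the cycles and of the path. $S_n^{p,q}$ is the graph obtained from cycles $C_p$ and $C_q$ sharing exactly one common vertex by attaching $n+1-p-q$ pendent edges to that common vertex. -}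

module Defs where

open import Data.Bool.Base using (Bool; true; false; if_then_else_; _∧_; _∨_)
open import Data.Nat.Base using (ℕ; zero; suc; _+_; _∸_; _≤_; _<ᵇ_; _≤ᵇ_; _≡ᵇ_)
open import Data.Nat.DivMod using (_mod_)
open import Data.Fin.Base using (Fin; toℕ)
open import Data.Fin.Properties using (_≟_)
open import Data.List.Base using (List; map; foldr; allFin)
open import Data.Integer.Base using (+_)
open import Data.Rational.Base using (ℚ; 0ℚ; 1ℚ; _/_) renaming (_+_ to _+ℚ_; _*_ to _*ℚ_; _-_ to _-ℚ_)
open import Data.Product.Base using (Σ; ∃; _×_)
open import Data.Sum.Base using (_⊎_)
open import Function.Base using (_∘_)
open import Function.Bundles using (_↔_; Inverse)
open import Function.Definitions using (Injective)
open import Relation.Binary.PropositionalEquality using (_≡_; refl; cong₂)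
open import Data.Bool.Properties using (∨-comm)
open import Relation.Nullary.Decidable using (does)
open import Relation.Nullary.Negation using (¬_)

record Graph (n : ℕ) : Set where
  field
    adj     : Fin n → Fin n → Bool
    sym     : ∀ i j → adj i j ≡ adj j i
    irrefl  : ∀ i → adj i i ≡ false
open Graph public

sumℕ : ∀ {n} → (Fin n → ℕ) → ℕ
sumℕ {n} f = foldr _+_ 0 (map f (allFin n))

sumℚ : ∀ {n} → (Fin n → ℚ) → ℚ
sumℚ {n} f = foldr _+ℚ_ 0ℚ (map f (allFin n))

b2ℕ : Bool → ℕ
b2ℕ true  = 1
b2ℕ false = 0

deg : ∀ {n} → Graph n → Fin n → ℕ
deg G u = sumℕ (λ v → b2ℕ (adj G u v))

numEdges : ∀ {n} → Graph n → ℕ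
numEdges G = sumℕ (λ i → sumℕ (λ j → b2ℕ ((toℕ i <ᵇ toℕ j) ∧ adj G i j)))

data Reach {n} (G : Graph n) : Fin n → Fin n → Set where
  here : ∀ {u} → Reach G u u
  step : ∀ {u v w} → adj G u v ≡ true → Reach G v w → Reach G u w

Connected : ∀ {n} → Graph n → Set
Connected G = ∀ u v → Reach G u v

next : ∀ {k} → Fin k → Fin k
next {suc m} i = suc (toℕ i) mod suc m

Cycle : ∀ {n} → Graph n → ℕ → Set
Cycle {n} G k = Σ (Fin k → Fin n) λ c →
  (3 ≤ k) × Injective _≡_ _≡_ c × (∀ i → adj G (c i) (c (next i)) ≡ true)

CEdge : ∀ {n} (G : Graph n) {k} → Cycle G k → Fin n → Fin n → Set
CEdge G {k} C a b = ∃ λ (i : Fin k) →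
  (c i ≡ a × c (next i) ≡ b) ⊎ (c i ≡ b × c (next i) ≡ a)
  where c = Σ.proj₁ C

SameCycle : ∀ {n} (G : Graph n) {k l} → Cycle G k → Cycle G l → Set
SameCycle {n} G C D = ∀ (a b : Fin n) → (CEdge G C a b → CEdge G D a b) × (CEdge G D a b → CEdge G C a b)

InB : ∀ {n} → Graph n → ℕ → ℕ → Set
InB {n} G p q =
  Connected G × numEdges G ≡ suc n ×
  Σ (Cycle G p) λ C₁ → Σ (Cycle G q) λ C₂ →
    ¬ SameCycle G C₁ C₂ ×
    (∀ k (C : Cycle G k) → SameCycle G C C₁ ⊎ SameCycle G C C₂)

_≅_ : ∀ {n} → Graph n → Graph n → Set
_≅_ {n} G H = Σ (Fin n ↔ Fin n) λ f →
  ∀ i j → adj H (Inverse.to f i) (Inverse.to f j) ≡ adj G i j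

-- The graph S_n^{p,q}: vertex 0 common; C_p = 0,1,…,p-1;
-- C_q = 0,p,p+1,…,p+q-2; pendent vertices p+q-1,…,n-1 attached to 0.

-- edge relation for a < b (on indices)
SEdgeℕ : ℕ → ℕ → ℕ → ℕ → Bool
SEdgeℕ p q a b =
     ((suc a ≡ᵇ b) ∧ (b ≤ᵇ p ∸ 1))
  ∨ ((a ≡ᵇ 0) ∧ (b ≡ᵇ p ∸ 1))                           -- closing edge of C_p
  ∨ ((a ≡ᵇ 0) ∧ (b ≡ᵇ p))
  ∨ ((p ≤ᵇ a) ∧ (suc a ≡ᵇ b) ∧ (b ≤ᵇ p + q ∸ 2))
  ∨ ((a ≡ᵇ 0) ∧ (b ≡ᵇ p + q ∸ 2))                       -- closing edge of C_q
  ∨ ((a ≡ᵇ 0) ∧ (p + q ∸ 1 ≤ᵇ b))                       -- pendent edges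

Sadj : ∀ n → ℕ → ℕ → Fin n → Fin n → Bool
Sadj n p q i j =
  ((toℕ i <ᵇ toℕ j) ∧ SEdgeℕ p q (toℕ i) (toℕ j)) ∨
  ((toℕ j <ᵇ toℕ i) ∧ SEdgeℕ p q (toℕ j) (toℕ i))

private
  <ᵇ-irrefl : ∀ x → (x <ᵇ x) ≡ false
  <ᵇ-irrefl zero    = refl
  <ᵇ-irrefl (suc x) = <ᵇ-irrefl x

S : ∀ n → ℕ → ℕ → Graph n
S n p q = record
  { adj    = Sadj n p q
  ; sym    = λ i j → ∨-comm
                 ((toℕ i <ᵇ toℕ j) ∧ SEdgeℕ p q (toℕ i) (toℕ j))
                 ((toℕ j <ᵇ toℕ i) ∧ SEdgeℕ p q (toℕ j) (toℕ i))
  ; irrefl = λ i → cong₂ (λ x y → (x ∧ SEdgeℕ p q (toℕ i) (toℕ i)) ∨ (y ∧ SEdgeℕ p q (toℕ i) (toℕ i)))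
                        (<ᵇ-irrefl (toℕ i)) (<ᵇ-irrefl (toℕ i))
  }

-- Resistance distance (over ℚ, as potential difference).
-- Unit current enters at u and leaves at v; a potential x : Fin n → ℚ
-- solves Kirchhoff's equations  (L x)_w = [w = u] - [w = v],
-- where L is the Laplacian of G (unit resistors). Then r(u,v) = x u - x v.

ℕ→ℚ : ℕ → ℚ
ℕ→ℚ k = + k / 1

laplacianApply : ∀ {n} → Graph n → (Fin n → ℚ) → Fin n → ℚ
laplacianApply G x w =
  ℕ→ℚ (deg G w) *ℚ x w -ℚ sumℚ (λ v → if adj G w v then x v else 0ℚ)

indicator : ∀ {n} → Fin n → Fin n → ℚ
indicator a w = if does (w ≟ a) then 1ℚ else 0ℚ

IsPotential : ∀ {n} → Graph n → Fin n → Fin n → (Fin n → ℚ) → Set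
IsPotential G u v x = ∀ w → laplacianApply G x w ≡ indicator u w -ℚ indicator v w

Potentials : ∀ {n} → Graph n → (Fin n → Fin n → Fin n → ℚ) → Set
Potentials G φ = ∀ u v → IsPotential G u v (φ u v)

resistance : ∀ {n} → (Fin n → Fin n → Fin n → ℚ) → Fin n → Fin n → ℚ
resistance φ u v = φ u v u -ℚ φ u v v

DR : ∀ {n} → Graph n → (Fin n → Fin n → Fin n → ℚ) → ℚ
DR G φ = sumℚ (λ u → sumℚ (λ v →
  if toℕ u <ᵇ toℕ v then ℕ→ℚ (deg G u + deg G v) *ℚ resistance φ u v else 0ℚ))

module Submission where

-- Two edge-disjoint cycles and the bridges are the blocks of a bicyclic graph with exactly two
-- cycles. Deleting the edges of a block B leaves one component per vertex of B; let π v be the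
-- vertex of B whose component contains v. Summing Kirchhoff's equations over the components
-- shows that the potentials of G restrict to potentials of B, whence r(u,v) = Σ_B r_B(π u, π v),
-- and D_R(G) = Σ_u d(u) Σ_v r(u,v) splits into contributions of the blocks. As Σ_j r_B(i,j) does
-- not depend on i, the contribution of B is a constant determined by n, by the length of B and
-- by B being a cycle or a bridge, plus an excess: a nonnegative combination of the resistances
-- r_B(π x, π v), over the vertices v off B and the x that are either off B or on a cycle other
-- than B. All excesses vanish for S_n^{p,q}. Conversely, if they all vanish, then off each block
-- everything hangs at one vertex of it, which forces G to be S_n^{p,q}.

open import Defs
open import Data.Nat.Base using (ℕ; _+_; _∸_; _≤_)
open import Data.Fin.Base using (Fin)
open import Data.Rational.Base using (ℚ; _<_)
open import Relation.Nullary.Negation using (¬_)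

import Algebra.Properties.Semiring.Sum as SemiringSum
open import Algebra.Bundles using (CommutativeRing)
open import Data.Bool.Base as Bool using (Bool; true; false; if_then_else_; not; _∧_; _∨_)
open import Data.Bool.Properties as Bool using (T-≡; T-∧; T-∨; ∧-zeroʳ; ∧-identityʳ)
open import Data.Empty using (⊥)
open import Data.Fin.Base as Fin using (zero; suc; toℕ; fromℕ; fromℕ<; inject₁; inject≤; splitAt; _↑ˡ_; _↑ʳ_)
open import Data.Fin.Induction using (<-weakInduction)
open import Data.Fin.Permutation as Perm using (Permutation; Permutation′; permutation; _⟨$⟩ʳ_; _⟨$⟩ˡ_)
import Data.Fin.Permutation.Components as PC
open import Data.Fin.Properties as Fin using (_≟_; any?; toℕ-injective; toℕ-fromℕ; toℕ-fromℕ<; toℕ-inject₁; toℕ<n; suc-injective)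
open import Data.Fin.Relation.Unary.Top using (view; ‵fromℕ; ‵inject₁)
import Data.Integer.Base as ℤ
import Data.Integer.Properties as ℤ
open import Data.List.Base as List using (List; []; _∷_; _++_; allFin; cartesianProduct; filter; foldr; length; lookup; map; tabulate)
open import Data.List.Membership.Propositional.Properties using (∈-lookup)
import Data.List.Properties as List
import Data.List.Relation.Unary.All as All
import Data.List.Relation.Unary.All.Properties as All
open import Data.Maybe.Base using (Maybe; just; nothing)
open import Data.Nat.Base as ℕ using (zero; suc; z≤n; s≤s)
import Data.Nat.DivMod as ℕ
import Data.Nat.Properties as ℕ
open import Data.Product.Base using (∃; ∃₂; _×_; _,_; proj₁; proj₂)
open import Data.Rational.Base as ℚ using (0ℚ; 1ℚ; ½) renaming (_+_ to _+ℚ_; _*_ to _*ℚ_; _-_ to _-ℚ_; -_ to ⊖_; _≤_ to _≤ℚ_)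
import Data.Rational.Properties as ℚ
import Data.Rational.Unnormalised.Base as ℚᵘ
import Data.Rational.Unnormalised.Properties as ℚᵘ
open import Data.Sum.Base using (_⊎_; inj₁; inj₂; [_,_]′)
open import Function.Base using (_∘_; id)
open import Function.Bundles using (Equivalence)
open import Function.Definitions using (Injective)
open import Relation.Binary.Definitions using (tri<; tri≈; tri>)
open import Relation.Binary.PropositionalEquality using (_≡_; _≢_; refl; trans; cong; cong₂; subst; subst₂; module ≡-Reasoning) renaming (sym to ≡-sym)
open import Relation.Nullary using (Dec; yes; no; does; ¬?; _×-dec_; _⊎-dec_; contradiction)
open import Relation.Nullary.Decidable using (dec-true; dec-false; decidable-stable; toSum)
open import Tactic.RingSolver using (solve-∀)
open import Tactic.RingSolver.Core.AlmostCommutativeRing using (AlmostCommutativeRing; fromCommutativeRing)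

-- The potentials are known only through Kirchhoff's equations, so no closed formula for a
-- resistance is derived. The row sum of the resistance matrix of a cycle of length k, classically
-- (k^2-1)/6, is never evaluated: the baselines of `G` and of $S_n^{p,q}$ only have to agree, and
-- the network determines its row sums.
--
-- Facts about edges are stated as rational sums over ordered pairs of vertices, which explains the
-- recurring factor 2. Structure is then recovered from totals: an adjacency matrix dominates
-- another matrix entrywise (the arcs of a forest, or the adjacency matrix of a second graph), the
-- totals agree, and nonnegative terms with sum zero vanish. Edge counts thus replace arguments
-- about uniqueness of paths.
--
-- Giving a bridge the shape of a cycle of length 2 lets one notion of block, with rotation
-- symmetry, cover bridges and cycles.
--
-- Both graphs enter through one interface: connected, n+1 edges, two edge-disjoint cycles. For `G`
-- edge-disjointness is deduced from having no third cycle; for $S_n^{p,q}$ it is checked directly,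
-- without classifying cycles.

ℚ-ring : AlmostCommutativeRing _ _
ℚ-ring = fromCommutativeRing ℚ.+-*-commutativeRing 0≟
  where
  0≟ : ∀ x → Maybe (0ℚ ≡ x)
  0≟ x with 0ℚ ℚ.≟ x
  ... | yes eq = just eq
  ... | no  _  = nothing

open SemiringSum (CommutativeRing.semiring ℚ.+-*-commutativeRing)
  using (sum; sum-cong-≗; ∑-distrib-+; ∑-comm; *-distribˡ-sum; ∑-permute)

2ℚ : ℚ
2ℚ = 1ℚ +ℚ 1ℚ

-- Finite sums of rationals

sum₂ : ∀ {m n} → (Fin m → Fin n → ℚ) → ℚ
sum₂ f = sum λ i → sum (f i)

sum₂-cong : ∀ {m n} {f g : Fin m → Fin n → ℚ} → (∀ i j → f i j ≡ g i j) → sum₂ f ≡ sum₂ g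
sum₂-cong f≗g = sum-cong-≗ λ i → sum-cong-≗ (f≗g i)

sum₂-+ : ∀ {m n} (f g : Fin m → Fin n → ℚ) → sum₂ (λ i j → f i j +ℚ g i j) ≡ sum₂ f +ℚ sum₂ g
sum₂-+ f g = trans (sum-cong-≗ λ i → ∑-distrib-+ (f i) (g i)) (∑-distrib-+ (sum ∘ f) (sum ∘ g))

sum₂-* : ∀ {m n} x (f : Fin m → Fin n → ℚ) → sum₂ (λ i j → x *ℚ f i j) ≡ x *ℚ sum₂ f
sum₂-* x f = ≡-sym (trans (*-distribˡ-sum x (sum ∘ f)) (sum-cong-≗ λ i → *-distribˡ-sum x (f i)))

sum-* : ∀ {n} x (f : Fin n → ℚ) → sum (λ i → x *ℚ f i) ≡ x *ℚ sum f
sum-* x f = ≡-sym (*-distribˡ-sum x f)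

sum-- : ∀ {n} (f g : Fin n → ℚ) → sum (λ i → f i -ℚ g i) ≡ sum f -ℚ sum g
sum-- f g = trans (∑-distrib-+ f (⊖_ ∘ g)) (cong (sum f +ℚ_) (trans
  (sum-cong-≗ λ i → ℚ-neg (g i)) (trans (sum-* (⊖ 1ℚ) g) (≡-sym (ℚ-neg (sum g))))))
  where
  ℚ-neg : ∀ x → ⊖ x ≡ (⊖ 1ℚ) *ℚ x
  ℚ-neg = solve-∀ ℚ-ring

sum₂-- : ∀ {m n} (f g : Fin m → Fin n → ℚ) → sum₂ (λ i j → f i j -ℚ g i j) ≡ sum₂ f -ℚ sum₂ g
sum₂-- f g = trans (sum-cong-≗ λ i → sum-- (f i) (g i)) (sum-- (sum ∘ f) (sum ∘ g))

sum-0 : ∀ {n} {f : Fin n → ℚ} → (∀ i → f i ≡ 0ℚ) → sum f ≡ 0ℚ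
sum-0 {zero}  f≗0 = refl
sum-0 {suc n} f≗0 = trans (cong₂ _+ℚ_ (f≗0 zero) (sum-0 (f≗0 ∘ suc))) (ℚ.+-identityˡ 0ℚ)

≤-respˡ : ∀ {x y z} → x ≡ y → x ≤ℚ z → y ≤ℚ z
≤-respˡ refl x≤z = x≤z

sum-≥0 : ∀ {n} {f : Fin n → ℚ} → (∀ i → 0ℚ ≤ℚ f i) → 0ℚ ≤ℚ sum f
sum-≥0 {zero}  0≤f = ℚ.≤-refl
sum-≥0 {suc n} 0≤f = ≤-respˡ (ℚ.+-identityˡ 0ℚ) (ℚ.+-mono-≤ (0≤f zero) (sum-≥0 (0≤f ∘ suc)))

0≤-+ : ∀ {x y} → 0ℚ ≤ℚ x → 0ℚ ≤ℚ y → 0ℚ ≤ℚ x +ℚ y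
0≤-+ 0≤x 0≤y = ≤-respˡ (ℚ.+-identityˡ 0ℚ) (ℚ.+-mono-≤ 0≤x 0≤y)

0≤-* : ∀ {x y} → 0ℚ ≤ℚ x → 0ℚ ≤ℚ y → 0ℚ ≤ℚ x *ℚ y
0≤-* {x} {y} 0≤x 0≤y = ≤-respˡ (ℚ.*-zeroʳ x) (ℚ.*-monoˡ-≤-nonNeg x ⦃ ℚ.nonNegative 0≤x ⦄ 0≤y)

0≤-square : ∀ x → 0ℚ ≤ℚ x *ℚ x
0≤-square x with ℚ.≤-total 0ℚ x
... | inj₁ 0≤x = 0≤-* 0≤x 0≤x
... | inj₂ x≤0 = subst (0ℚ ≤ℚ_) (neg² x) (0≤-* 0≤-x 0≤-x)
  where
  0≤-x = ℚ.neg-antimono-≤ x≤0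
  neg² : ∀ x → (⊖ x) *ℚ (⊖ x) ≡ x *ℚ x
  neg² = solve-∀ ℚ-ring

0≤⇒≤ : ∀ {x y} → 0ℚ ≤ℚ y -ℚ x → x ≤ℚ y
0≤⇒≤ {x} {y} 0≤y-x = subst₂ _≤ℚ_ (ℚ.+-identityˡ x) (cancel x y) (ℚ.+-monoˡ-≤ x 0≤y-x)
  where
  cancel : ∀ x y → (y -ℚ x) +ℚ x ≡ y
  cancel = solve-∀ ℚ-ring

≤⇒0≤ : ∀ {x y} → x ≤ℚ y → 0ℚ ≤ℚ y -ℚ x
≤⇒0≤ {x} {y} x≤y = ≤-respˡ (ℚ.+-inverseʳ x) (ℚ.+-monoˡ-≤ (⊖ x) x≤y)

+≤0⇒≡0ˡ : ∀ {x y} → 0ℚ ≤ℚ x → 0ℚ ≤ℚ y → x +ℚ y ≤ℚ 0ℚ → x ≡ 0ℚ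
+≤0⇒≡0ˡ {x} 0≤x 0≤y x+y≤0 = ℚ.≤-antisym
  (ℚ.≤-trans (≤-respˡ (ℚ.+-identityʳ x) (ℚ.+-monoʳ-≤ x 0≤y)) x+y≤0) 0≤x

+≤0⇒≡0ʳ : ∀ {x y} → 0ℚ ≤ℚ x → 0ℚ ≤ℚ y → x +ℚ y ≤ℚ 0ℚ → y ≡ 0ℚ
+≤0⇒≡0ʳ {x} {y} 0≤x 0≤y x+y≤0 = +≤0⇒≡0ˡ 0≤y 0≤x (subst (_≤ℚ 0ℚ) (ℚ.+-comm x y) x+y≤0)

sum≤0⇒≡0 : ∀ {n} {f : Fin n → ℚ} → (∀ i → 0ℚ ≤ℚ f i) → sum f ≤ℚ 0ℚ → ∀ i → f i ≡ 0ℚ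
sum≤0⇒≡0 0≤f ∑f≤0 zero    = +≤0⇒≡0ˡ (0≤f zero) (sum-≥0 (0≤f ∘ suc)) ∑f≤0
sum≤0⇒≡0 0≤f ∑f≤0 (suc i) = sum≤0⇒≡0 (0≤f ∘ suc)
  (ℚ.≤-reflexive (+≤0⇒≡0ʳ (0≤f zero) (sum-≥0 (0≤f ∘ suc)) ∑f≤0)) i

sum₂≤0⇒≡0 : ∀ {m n} {f : Fin m → Fin n → ℚ} → (∀ i j → 0ℚ ≤ℚ f i j) → sum₂ f ≤ℚ 0ℚ → ∀ i j → f i j ≡ 0ℚ
sum₂≤0⇒≡0 0≤f ∑f≤0 i = sum≤0⇒≡0 (0≤f i)
  (ℚ.≤-reflexive (sum≤0⇒≡0 (λ i → sum-≥0 (0≤f i)) ∑f≤0 i))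

*≡0 : ∀ x y → x ≢ 0ℚ → x *ℚ y ≡ 0ℚ → y ≡ 0ℚ
*≡0 x y x≢0 xy≡0 = begin
  y                     ≡⟨ ℚ.*-identityˡ y ⟨
  1ℚ *ℚ y               ≡⟨ cong (_*ℚ y) (ℚ.*-inverseˡ x) ⟨
  ((ℚ.1/ x) *ℚ x) *ℚ y  ≡⟨ ℚ.*-assoc (ℚ.1/ x) x y ⟩
  (ℚ.1/ x) *ℚ (x *ℚ y)  ≡⟨ cong ((ℚ.1/ x) *ℚ_) xy≡0 ⟩
  (ℚ.1/ x) *ℚ 0ℚ        ≡⟨ ℚ.*-zeroʳ (ℚ.1/ x) ⟩
  0ℚ                    ∎
  where
  open ≡-Reasoning
  instance _ = ℚ.≢-nonZero x≢0

≡0-*ˡ : ∀ {x} y → x ≡ 0ℚ → x *ℚ y ≡ 0ℚ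
≡0-*ˡ y refl = ℚ.*-zeroˡ y

≡0-*ʳ : ∀ x {y} → y ≡ 0ℚ → x *ℚ y ≡ 0ℚ
≡0-*ʳ x refl = ℚ.*-zeroʳ x

2x≡x+x : ∀ x → 2ℚ *ℚ x ≡ x +ℚ x
2x≡x+x = lemma
  where
  lemma : ∀ x → (1ℚ +ℚ 1ℚ) *ℚ x ≡ x +ℚ x
  lemma = solve-∀ ℚ-ring

2x≡2y⇒x≡y : ∀ {x y} → 2ℚ *ℚ x ≡ 2ℚ *ℚ y → x ≡ y
2x≡2y⇒x≡y {x} {y} eq = trans (≡-sym (half x)) (trans (cong (½ *ℚ_) eq) (half y))
  where
  half : ∀ x → ½ *ℚ ((1ℚ +ℚ 1ℚ) *ℚ x) ≡ x
  half = solve-∀ ℚ-ring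

x-y≡0⇒x≡y : ∀ {x y} → x -ℚ y ≡ 0ℚ → x ≡ y
x-y≡0⇒x≡y {x} {y} eq = trans (≡-sym (cancel x y)) (trans (cong (_+ℚ y) eq) (ℚ.+-identityˡ y))
  where
  cancel : ∀ x y → (x -ℚ y) +ℚ y ≡ x
  cancel = solve-∀ ℚ-ring

-- Kronecker deltas, Boolean weights and the embedding of the naturals

δ : ∀ {n} → Fin n → Fin n → ℚ
δ = indicator

δ-refl : ∀ {n} (i : Fin n) → δ i i ≡ 1ℚ
δ-refl i = cong (if_then 1ℚ else 0ℚ) (dec-true (i ≟ i) refl)

δ-≢ : ∀ {n} {i j : Fin n} → i ≢ j → δ i j ≡ 0ℚ
δ-≢ {i = i} {j} i≢j = cong (if_then 1ℚ else 0ℚ) (dec-false (j ≟ i) (i≢j ∘ ≡-sym))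

δ-≡ : ∀ {n} {i j : Fin n} → i ≡ j → δ i j ≡ 1ℚ
δ-≡ {i = i} refl = δ-refl i

δ≡1⇒≡ : ∀ {n} {i j : Fin n} → δ i j ≢ 0ℚ → i ≡ j
δ≡1⇒≡ {i = i} {j} δ≢0 with i ≟ j
... | yes i≡j = i≡j
... | no  i≢j = contradiction (δ-≢ i≢j) δ≢0

δ-≥0 : ∀ {n} (i j : Fin n) → 0ℚ ≤ℚ δ i j
δ-≥0 i j with does (j ≟ i)
... | true  = ℚ.nonNegative⁻¹ 1ℚ
... | false = ℚ.≤-refl

sum-δ : ∀ {n} (i : Fin n) (f : Fin n → ℚ) → sum (λ j → δ i j *ℚ f j) ≡ f i
sum-δ zero f = trans (cong₂ _+ℚ_ (ℚ.*-identityˡ (f zero)) (sum-0 λ j → ℚ.*-zeroˡ (f (suc j)))) (ℚ.+-identityʳ (f zero))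
sum-δ (suc i) f = trans (cong₂ _+ℚ_ (ℚ.*-zeroˡ (f zero)) (sum-δ i (f ∘ suc))) (ℚ.+-identityˡ (f (suc i)))

sum₂-δ : ∀ {m n} (i : Fin m) (j : Fin n) (f : Fin m → Fin n → ℚ) →
         sum₂ (λ a b → (δ i a *ℚ δ j b) *ℚ f a b) ≡ f i j
sum₂-δ i j f = trans (sum-cong-≗ λ a → begin
    sum (λ b → (δ i a *ℚ δ j b) *ℚ f a b)  ≡⟨ sum-cong-≗ (λ b → ℚ.*-assoc (δ i a) (δ j b) (f a b)) ⟩
    sum (λ b → δ i a *ℚ (δ j b *ℚ f a b))  ≡⟨ sum-* (δ i a) (λ b → δ j b *ℚ f a b) ⟩
    δ i a *ℚ sum (λ b → δ j b *ℚ f a b)    ≡⟨ cong (δ i a *ℚ_) (sum-δ j (f a)) ⟩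
    δ i a *ℚ f a j                         ∎)
  (sum-δ i (λ a → f a j))
  where open ≡-Reasoning

b2ℚ : Bool → ℚ
b2ℚ true  = 1ℚ
b2ℚ false = 0ℚ

b2ℚ-≥0 : ∀ b → 0ℚ ≤ℚ b2ℚ b
b2ℚ-≥0 true  = ℚ.nonNegative⁻¹ 1ℚ
b2ℚ-≥0 false = ℚ.≤-refl

foldr-tabulate : ∀ {A : Set} (_∙_ : A → A → A) (e : A) {n} (f : Fin n → A) →
                 foldr _∙_ e (List.map f (allFin n)) ≡ foldr _∙_ e (tabulate f)
foldr-tabulate _∙_ e f = cong (foldr _∙_ e) (List.map-tabulate id f)

sumℚ≡sum : ∀ {n} (f : Fin n → ℚ) → sumℚ f ≡ sum f
sumℚ≡sum f = trans (foldr-tabulate _+ℚ_ 0ℚ f) (go f)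
  where
  go : ∀ {n} (f : Fin n → ℚ) → foldr _+ℚ_ 0ℚ (tabulate f) ≡ sum f
  go {zero}  f = refl
  go {suc n} f = cong (f zero +ℚ_) (go (f ∘ suc))

ℕ→ℚ-+ : ∀ m n → ℕ→ℚ (m + n) ≡ ℕ→ℚ m +ℚ ℕ→ℚ n
ℕ→ℚ-+ m n = ℚ.toℚᵘ-injective (begin
  ℚ.toℚᵘ (ℕ→ℚ (m + n))                 ≈⟨ ℚ.toℚᵘ-fromℚᵘ (ι (m + n)) ⟩
  ι (m + n)                            ≈⟨ ℚᵘ.*≡* (cong (ℤ._* ℤ.1ℤ) (≡-sym
                                            (cong₂ ℤ._+_ (ℤ.*-identityʳ (ℤ.+ m)) (ℤ.*-identityʳ (ℤ.+ n))))) ⟩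
  ι m ℚᵘ.+ ι n                         ≈⟨ ℚᵘ.+-cong (ℚ.toℚᵘ-fromℚᵘ (ι m)) (ℚ.toℚᵘ-fromℚᵘ (ι n)) ⟨
  ℚ.toℚᵘ (ℕ→ℚ m) ℚᵘ.+ ℚ.toℚᵘ (ℕ→ℚ n)   ≈⟨ ℚ.toℚᵘ-homo-+ (ℕ→ℚ m) (ℕ→ℚ n) ⟨
  ℚ.toℚᵘ (ℕ→ℚ m +ℚ ℕ→ℚ n)              ∎)
  where
  open ℚᵘ.≃-Reasoning
  ι : ℕ → ℚᵘ.ℚᵘ
  ι k = ℚᵘ.mkℚᵘ (ℤ.+ k) 0

ℕ→ℚ-sumℕ : ∀ {n} (f : Fin n → ℕ) → ℕ→ℚ (sumℕ f) ≡ sum (ℕ→ℚ ∘ f)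
ℕ→ℚ-sumℕ f = trans (cong ℕ→ℚ (foldr-tabulate _+_ 0 f)) (go f)
  where
  go : ∀ {n} (f : Fin n → ℕ) → ℕ→ℚ (foldr _+_ 0 (tabulate f)) ≡ sum (ℕ→ℚ ∘ f)
  go {zero}  f = refl
  go {suc n} f = trans (ℕ→ℚ-+ (f zero) _) (cong (ℕ→ℚ (f zero) +ℚ_) (go (f ∘ suc)))

ℕ→ℚ-b2ℕ : ∀ b → ℕ→ℚ (b2ℕ b) ≡ b2ℚ b
ℕ→ℚ-b2ℕ true  = refl
ℕ→ℚ-b2ℕ false = refl

ℕ→ℚ-suc : ∀ n → ℕ→ℚ (suc n) ≡ 1ℚ +ℚ ℕ→ℚ n
ℕ→ℚ-suc n = ℕ→ℚ-+ 1 n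

sum-1 : ∀ n → sum {n} (λ _ → 1ℚ) ≡ ℕ→ℚ n
sum-1 zero    = refl
sum-1 (suc n) = trans (cong (1ℚ +ℚ_) (sum-1 n)) (≡-sym (ℕ→ℚ-suc n))

sum-const : ∀ {n} x → sum {n} (λ _ → x) ≡ x *ℚ ℕ→ℚ n
sum-const {n} x = trans (sum-cong-≗ {n} λ _ → ≡-sym (ℚ.*-identityʳ x)) (trans (sum-* {n} x (λ _ → 1ℚ)) (cong (x *ℚ_) (sum-1 n)))

sum-mono : ∀ {n} {f g : Fin n → ℚ} → (∀ i → f i ≤ℚ g i) → sum f ≤ℚ sum g
sum-mono {zero}  f≤g = ℚ.≤-refl
sum-mono {suc n} f≤g = ℚ.+-mono-≤ (f≤g zero) (sum-mono (f≤g ∘ suc))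

-- Resistances on cycles

next-inject₁ : ∀ {m} (i : Fin m) → next (inject₁ i) ≡ suc i
next-inject₁ {m} i = toℕ-injective (begin
  toℕ (next (inject₁ i))                ≡⟨ toℕ-fromℕ< _ ⟩
  suc (toℕ (inject₁ i)) ℕ.% suc m       ≡⟨ cong (λ t → suc t ℕ.% suc m) (toℕ-inject₁ i) ⟩
  suc (toℕ i) ℕ.% suc m                 ≡⟨ ℕ.m<n⇒m%n≡m (s≤s (toℕ<n i)) ⟩
  suc (toℕ i)                           ∎)
  where open ≡-Reasoning

next-fromℕ : ∀ m → next (fromℕ m) ≡ zero
next-fromℕ m = toℕ-injective (begin
  toℕ (next (fromℕ m))           ≡⟨ toℕ-fromℕ< _ ⟩
  suc (toℕ (fromℕ m)) ℕ.% suc m  ≡⟨ cong (λ t → suc t ℕ.% suc m) (toℕ-fromℕ m) ⟩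
  suc m ℕ.% suc m                ≡⟨ ℕ.n%n≡0 (suc m) ⟩
  0                              ∎)
  where open ≡-Reasoning

prev : ∀ {k} → Fin k → Fin k
prev zero    = fromℕ _
prev (suc i) = inject₁ i

next-prev : ∀ {k} (i : Fin k) → next (prev i) ≡ i
next-prev zero    = next-fromℕ _
next-prev (suc i) = next-inject₁ i

prev-next : ∀ {k} (i : Fin k) → prev (next i) ≡ i
prev-next {suc m} i with view i
... | ‵fromℕ     = cong prev (next-fromℕ m)
... | ‵inject₁ j = cong prev (next-inject₁ j)

next-injective : ∀ {k} {i j : Fin k} → next i ≡ next j → i ≡ j
next-injective {i = i} {j} eq = trans (≡-sym (prev-next i)) (trans (cong prev eq) (prev-next j))

next-permutation : ∀ {k} → Permutation′ k
next-permutation = permutation next prev next-prev prev-next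

sum-next : ∀ {k} (f : Fin k → ℚ) → sum (f ∘ next) ≡ sum f
sum-next f = ≡-sym (∑-permute f next-permutation)

-- From the starting index the property climbs to the top index, wraps around to `zero`, and from
-- there reaches every index.
next-induction : ∀ {k} (P : Fin k → Set) → (∀ i → P i → P (next i)) → ∀ {i} → P i → ∀ j → P j
next-induction {suc m} P P-next {i} Pi = <-weakInduction P P0 λ j Pj → subst P (next-inject₁ j) (P-next (inject₁ j) Pj)
  where
  climb : ∀ d {i} → toℕ i + d ≡ m → P i → P (fromℕ m)
  climb zero    {i} eq Pi = subst P (toℕ-injective (trans (trans (≡-sym (ℕ.+-identityʳ (toℕ i))) eq) (≡-sym (toℕ-fromℕ m)))) Pi
  climb (suc d) {i} eq Pi with view i
  ... | ‵fromℕ     = Pi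
  ... | ‵inject₁ j = climb d {suc j} (trans (≡-sym (ℕ.+-suc (toℕ j) d)) (trans (cong (_+ suc d) (≡-sym (toℕ-inject₁ j))) eq))
                       (subst P (next-inject₁ j) (P-next (inject₁ j) Pi))
  P0 : P zero
  P0 = subst P (next-fromℕ m) (P-next (fromℕ m) (climb (m ∸ toℕ i) (ℕ.m+[n∸m]≡n (ℕ.s≤s⁻¹ (toℕ<n i))) Pi))

rotate : ∀ {k} → ℕ → Fin k → Fin k
rotate zero    i = i
rotate (suc t) i = next (rotate t i)

rotate-next : ∀ {k} t (i : Fin k) → rotate t (next i) ≡ next (rotate t i)
rotate-next zero    i = refl
rotate-next (suc t) i = cong next (rotate-next t i)

rotate-injective : ∀ {k} t {i j : Fin k} → rotate t i ≡ rotate t j → i ≡ j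
rotate-injective zero    eq = eq
rotate-injective (suc t) eq = rotate-injective t (next-injective eq)

rotate-surjective : ∀ {k} t (j : Fin k) → ∃ λ i → rotate t i ≡ j
rotate-surjective zero    j = j , refl
rotate-surjective (suc t) j with rotate-surjective t (prev j)
... | i , eq = i , trans (cong next eq) (next-prev j)

rotate-transitive : ∀ {k} (i j : Fin k) → ∃ λ t → rotate t i ≡ j
rotate-transitive i j = next-induction (λ j → ∃ λ t → rotate t i ≡ j) (λ j (t , eq) → suc t , cong next eq) (0 , refl) j

-- All edges of the cycle have conductance w.
energy : ∀ {k} → ℚ → (Fin k → ℚ) → (Fin k → ℚ) → ℚ
energy w x f = w *ℚ sum λ i → (x i -ℚ x (next i)) *ℚ (f i -ℚ f (next i))

-- Kirchhoff's equations for a unit current from s to t, in weak form.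
UnitFlow : ∀ {k} → ℚ → Fin k → Fin k → (Fin k → ℚ) → Set
UnitFlow w s t x = ∀ f → energy w x f ≡ f s -ℚ f t

-- The potential is asked for rather than constructed: the given potentials of the whole graph,
-- restricted to a block, will supply it.
IsResistance : ∀ {k} → ℚ → (Fin k → Fin k → ℚ) → Set
IsResistance w R = ∀ i j → ∃ λ x → UnitFlow w i j x × R i j ≡ x i -ℚ x j

energy-comm : ∀ {k} w (x y : Fin k → ℚ) → energy w x y ≡ energy w y x
energy-comm w x y = cong (w *ℚ_) (sum-cong-≗ λ i → ℚ.*-comm (x i -ℚ x (next i)) _)

-- Reciprocity: each of the two flows is tested against the other potential.
unitFlow-unique : ∀ {k} w {s t : Fin k} {x y} → UnitFlow w s t x → UnitFlow w s t y → x s -ℚ x t ≡ y s -ℚ y t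
unitFlow-unique w {x = x} {y} ux uy = trans (≡-sym (uy x)) (trans (energy-comm w y x) (ux y))

module _ {k} {w : ℚ} (w>0 : 0ℚ < w) {R : Fin k → Fin k → ℚ} (isR : IsResistance w R) where

  resistance-value : ∀ {i j x} → UnitFlow w i j x → x i -ℚ x j ≡ R i j
  resistance-value {i} {j} {x} ux with isR i j
  ... | y , uy , eq = trans (unitFlow-unique w {x = x} {y} ux uy) (≡-sym eq)

  resistance-refl : ∀ i → R i i ≡ 0ℚ
  resistance-refl i with isR i i
  ... | x , _ , eq = trans eq (ℚ.+-inverseʳ (x i))

  -- The negated potential drives the unit flow in the opposite direction.
  resistance-sym : ∀ i j → R i j ≡ R j i
  resistance-sym i j with isR i j
  ... | x , ux , eq = trans eq (trans (swap (x i) (x j)) (resistance-value {x = ⊖_ ∘ x} λ f → begin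
    energy w (⊖_ ∘ x) f         ≡⟨ cong (w *ℚ_) (trans (sum-cong-≗ λ i → pull (x i) (x (next i)) (f i -ℚ f (next i)))
                                      (sum-* (⊖ 1ℚ) λ i → (x i -ℚ x (next i)) *ℚ (f i -ℚ f (next i)))) ⟩
    w *ℚ ((⊖ 1ℚ) *ℚ sum λ i → (x i -ℚ x (next i)) *ℚ (f i -ℚ f (next i)))  ≡⟨ neg w _ ⟩
    ⊖ energy w x f              ≡⟨ cong ⊖_ (ux f) ⟩
    ⊖ (f i -ℚ f j)              ≡⟨ neg-sub (f i) (f j) ⟩
    f j -ℚ f i                   ∎))
    where
    open ≡-Reasoning
    swap : ∀ a b → a -ℚ b ≡ (⊖ b) -ℚ (⊖ a)
    swap = solve-∀ ℚ-ring
    pull : ∀ a b c → ((⊖ a) -ℚ (⊖ b)) *ℚ c ≡ (⊖ 1ℚ) *ℚ ((a -ℚ b) *ℚ c)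
    pull = solve-∀ ℚ-ring
    neg : ∀ a b → a *ℚ ((⊖ 1ℚ) *ℚ b) ≡ ⊖ (a *ℚ b)
    neg = solve-∀ ℚ-ring
    neg-sub : ∀ a b → ⊖ (a -ℚ b) ≡ b -ℚ a
    neg-sub = solve-∀ ℚ-ring

  -- Testing the flow against its own potential shows that the resistance is the dissipated energy,
  -- a sum of squares.
  resistance-≥0 : ∀ i j → 0ℚ ≤ℚ R i j
  resistance-≥0 i j with isR i j
  ... | x , ux , eq = subst (0ℚ ≤ℚ_) (trans (ux x) (≡-sym eq))
    (0≤-* (ℚ.<⇒≤ w>0) (sum-≥0 λ i → 0≤-square (x i -ℚ x (next i))))

  -- Zero resistance is zero energy, so all drops of the potential vanish and so does its energy
  -- pairing with any test function. The test function `δ i` then gives `δ i i ≡ δ i j`.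
  resistance≡0⇒≡ : ∀ {i j} → R i j ≡ 0ℚ → i ≡ j
  resistance≡0⇒≡ {i} {j} R≡0 with isR i j
  ... | x , ux , eq = δ≡1⇒≡ λ δ≡0 → ℚ.1≢0 (begin
    1ℚ             ≡⟨ δ-refl i ⟨
    δ i i          ≡⟨ x-y≡0⇒x≡y (trans (≡-sym (ux (δ i))) (energy≡0 (δ i))) ⟩
    δ i j          ≡⟨ δ≡0 ⟩
    0ℚ             ∎)
    where
    open ≡-Reasoning
    w≢0 : w ≢ 0ℚ
    w≢0 w≡0 = ℚ.<-irrefl (≡-sym w≡0) w>0
    squares≡0 : sum (λ i → (x i -ℚ x (next i)) *ℚ (x i -ℚ x (next i))) ≡ 0ℚ
    squares≡0 = *≡0 w _ w≢0 (trans (ux x) (trans (≡-sym eq) R≡0))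
    step≡0 : ∀ i → x i -ℚ x (next i) ≡ 0ℚ
    step≡0 i with x i -ℚ x (next i) in eq | sum≤0⇒≡0 (λ i → 0≤-square (x i -ℚ x (next i))) (ℚ.≤-reflexive squares≡0) i
    ... | d | d²≡0 with d ℚ.≟ 0ℚ
    ...   | yes d≡0 = d≡0
    ...   | no  d≢0 = *≡0 d d d≢0 d²≡0
    energy≡0 : ∀ f → energy w x f ≡ 0ℚ
    energy≡0 f = ≡0-*ʳ w (sum-0 λ i → ≡0-*ˡ (f i -ℚ f (next i)) (step≡0 i))

  -- Rotation preserves the network: composing a potential with `next` and the test function with
  -- `prev` leaves the energy unchanged.
  resistance-next : ∀ i j → R (next i) (next j) ≡ R i j
  resistance-next i j with isR (next i) (next j)
  ... | x , ux , eq = trans eq (resistance-value {i} {j} {x ∘ next} λ f → begin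
    energy w (x ∘ next) f                     ≡⟨ cong (w *ℚ_) (sum-cong-≗ λ i → cong₂ (λ a b → (x (next i) -ℚ x (next (next i))) *ℚ (a -ℚ b))
                                                   (cong f (prev-next i)) (cong f (prev-next (next i)))) ⟨
    energy w (x ∘ next) (f ∘ prev ∘ next)     ≡⟨ cong (w *ℚ_) (sum-next λ i → (x i -ℚ x (next i)) *ℚ (f (prev i) -ℚ f (prev (next i)))) ⟩
    energy w x (f ∘ prev)                     ≡⟨ ux (f ∘ prev) ⟩
    f (prev (next i)) -ℚ f (prev (next j))    ≡⟨ cong₂ (λ a b → f a -ℚ f b) (prev-next i) (prev-next j) ⟩
    f i -ℚ f j                                ∎)
    where open ≡-Reasoning

  resistance-sum-constant : ∀ i j → sum (R i) ≡ sum (R j)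
  resistance-sum-constant i j = next-induction (λ j → sum (R i) ≡ sum (R j))
    (λ j eq → trans eq (trans (sum-cong-≗ λ l → ≡-sym (resistance-next j l)) (sum-next (R (next j))))) refl j

resistance-unique : ∀ {k w} → 0ℚ < w → {R R′ : Fin k → Fin k → ℚ} →
                    IsResistance w R → IsResistance w R′ → ∀ i j → R i j ≡ R′ i j
resistance-unique w>0 isR isR′ i j with isR i j
... | x , ux , eq = trans eq (resistance-value w>0 isR′ {x = x} ux)

-- Spanning forests

reach-trans : ∀ {n} {G : Graph n} {u v w} → Reach G u v → Reach G v w → Reach G u w
reach-trans here       s = s
reach-trans (step e r) s = step e (reach-trans r s)

reach-sym : ∀ {n} {G : Graph n} {u v} → Reach G u v → Reach G v u
reach-sym here = here
reach-sym {G = G} (step {u} {v} e r) = reach-trans (reach-sym r) (step (trans (Graph.sym G v u) e) here)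

adj⇒≢ : ∀ {n} (G : Graph n) {a b} → adj G a b ≡ true → a ≢ b
adj⇒≢ G {a} e refl with () ← trans (≡-sym e) (irrefl G a)

weight : ∀ {n} → Graph n → Fin n → Fin n → ℚ
weight G a b = b2ℚ (adj G a b)

weight-sym : ∀ {n} (G : Graph n) a b → weight G a b ≡ weight G b a
weight-sym G a b = cong b2ℚ (Graph.sym G a b)

record EdgeSet (n : ℕ) : Set₁ where
  field
    Mem     : Fin n → Fin n → Set
    mem?    : ∀ a b → Dec (Mem a b)
    mem-sym : ∀ {a b} → Mem a b → Mem b a

  char : Fin n → Fin n → ℚ
  char a b = b2ℚ (does (mem? a b))

  char-∈ : ∀ {a b} → Mem a b → char a b ≡ 1ℚ
  char-∈ {a} {b} m = cong b2ℚ (dec-true (mem? a b) m)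

  char-∉ : ∀ {a b} → ¬ Mem a b → char a b ≡ 0ℚ
  char-∉ {a} {b} m = cong b2ℚ (dec-false (mem? a b) m)

  does-sym : ∀ a b → does (mem? a b) ≡ does (mem? b a)
  does-sym a b with mem? b a
  ... | yes m = dec-true (mem? a b) (mem-sym m)
  ... | no ¬m = dec-false (mem? a b) (¬m ∘ mem-sym)

open EdgeSet

infixl 5 _∖_

_∖_ : ∀ {n} → Graph n → EdgeSet n → Graph n
G ∖ D = record
  { adj    = λ a b → adj G a b ∧ not (does (mem? D a b))
  ; sym    = λ a b → cong₂ (λ x y → x ∧ not y) (Graph.sym G a b) (does-sym D a b)
  ; irrefl = λ a → cong (_∧ _) (irrefl G a)
  }

module _ {n} (G : Graph n) (D : EdgeSet n) where

  ∖-adj⁺ : ∀ {a b} → adj G a b ≡ true → ¬ Mem D a b → adj (G ∖ D) a b ≡ true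
  ∖-adj⁺ {a} {b} e ¬m = cong₂ (λ x y → x ∧ not y) e (dec-false (mem? D a b) ¬m)

  ∖-adj⁻ : ∀ {a b} → adj (G ∖ D) a b ≡ true → adj G a b ≡ true × ¬ Mem D a b
  ∖-adj⁻ {a} {b} e with adj G a b | mem? D a b
  ∖-adj⁻ e  | true  | no ¬m = refl , ¬m
  ∖-adj⁻ () | true  | yes _
  ∖-adj⁻ () | false | _

  ∖-weight : (∀ {a b} → Mem D a b → adj G a b ≡ true) → ∀ a b → weight G a b ≡ weight (G ∖ D) a b +ℚ char D a b
  ∖-weight D⊆G a b with mem? D a b
  ... | yes m = trans (cong b2ℚ (D⊆G m)) (≡-sym (trans (cong (λ x → b2ℚ x +ℚ 1ℚ) (∧-zeroʳ (adj G a b))) (ℚ.+-identityˡ 1ℚ)))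
  ... | no  _ = ≡-sym (trans (ℚ.+-identityʳ _) (cong b2ℚ (∧-identityʳ (adj G a b))))

edge : ∀ {n} → Fin n → Fin n → EdgeSet n
edge u v = record
  { Mem     = λ a b → (u ≡ a × v ≡ b) ⊎ (u ≡ b × v ≡ a)
  ; mem?    = λ a b → (u ≟ a ×-dec v ≟ b) ⊎-dec (u ≟ b ×-dec v ≟ a)
  ; mem-sym = [ inj₂ , inj₁ ]′
  }

cycleEdges : ∀ {n k} → (Fin k → Fin n) → EdgeSet n
cycleEdges c = record
  { Mem     = λ a b → ∃ λ i → (c i ≡ a × c (next i) ≡ b) ⊎ (c i ≡ b × c (next i) ≡ a)
  ; mem?    = λ a b → any? λ i → (c i ≟ a ×-dec c (next i) ≟ b) ⊎-dec (c i ≟ b ×-dec c (next i) ≟ a)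
  ; mem-sym = λ (i , m) → i , [ inj₂ , inj₁ ]′ m
  }

-- Each use of the deleted edge is replaced by the detour, run backwards where necessary.
reach-∖-edge : ∀ {n} {G : Graph n} {a b} → Reach (G ∖ edge a b) a b → ∀ {u v} → Reach G u v → Reach (G ∖ edge a b) u v
reach-∖-edge detour here = here
reach-∖-edge {G = G} {a} {b} detour (step {u} {v} e r) with mem? (edge a b) u v
... | no  ¬m                   = step (∖-adj⁺ G (edge a b) e ¬m) (reach-∖-edge detour r)
... | yes (inj₁ (refl , refl)) = reach-trans detour (reach-∖-edge detour r)
... | yes (inj₂ (refl , refl)) = reach-trans (reach-sym detour) (reach-∖-edge detour r)

Image : ∀ {k n} → (Fin k → Fin n) → Fin n → Set
Image c w = ∃ λ i → c i ≡ w

image? : ∀ {k n} (c : Fin k → Fin n) w → Dec (Image c w)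
image? c w = any? λ i → c i ≟ w

module Retraction {n k} (c : Fin k → Fin n) (π : Fin n → Fin k) (π-c : ∀ i → π (c i) ≡ i) where

  c-injective : Injective _≡_ _≡_ c
  c-injective {i} {j} eq = trans (≡-sym (π-c i)) (trans (cong π eq) (π-c j))

  -- The indicator of the vertices off the image of `c`. The form with deltas lets `sum-ν` follow by
  -- linearity.
  ν : Fin n → ℚ
  ν w = 1ℚ -ℚ sum λ i → δ (c i) w

  ν-image : ∀ {w} → Image c w → ν w ≡ 0ℚ
  ν-image (i , refl) = trans (cong (1ℚ -ℚ_) (begin
    sum (λ j → δ (c j) (c i))    ≡⟨ sum-cong-≗ (λ j → c-δ j) ⟩
    sum (λ j → δ i j *ℚ 1ℚ)      ≡⟨ sum-δ i (λ _ → 1ℚ) ⟩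
    1ℚ                           ∎)) (ℚ.+-inverseʳ 1ℚ)
    where
    open ≡-Reasoning
    c-δ : ∀ j → δ (c j) (c i) ≡ δ i j *ℚ 1ℚ
    c-δ j with i ≟ j
    ... | yes refl = trans (δ-refl (c i)) (≡-sym (cong (_*ℚ 1ℚ) (δ-refl i)))
    ... | no  i≢j  = trans (δ-≢ (i≢j ∘ ≡-sym ∘ c-injective)) (≡-sym (cong (_*ℚ 1ℚ) (δ-≢ i≢j)))

  ν-outside : ∀ {w} → ¬ Image c w → ν w ≡ 1ℚ
  ν-outside ∉c = cong (1ℚ -ℚ_) (sum-0 λ i → δ-≢ λ eq → ∉c (i , eq))

  sum-ν : ∀ (f : Fin k → ℚ) → sum (λ w → ν w *ℚ f (π w)) ≡ sum (f ∘ π) -ℚ sum f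
  sum-ν f = begin
    sum (λ w → ν w *ℚ f (π w))                                    ≡⟨ sum-cong-≗ (λ w → trans (expand (sum λ i → δ (c i) w) (f (π w)))
                                                                       (cong (f (π w) -ℚ_) (*-distribˡ-sum (f (π w)) λ i → δ (c i) w))) ⟩
    sum (λ w → f (π w) -ℚ sum λ i → f (π w) *ℚ δ (c i) w)         ≡⟨ sum-- (f ∘ π) (λ w → sum λ i → f (π w) *ℚ δ (c i) w) ⟩
    sum (f ∘ π) -ℚ sum₂ (λ w i → f (π w) *ℚ δ (c i) w)            ≡⟨ cong (sum (f ∘ π) -ℚ_) (∑-comm (λ w i → f (π w) *ℚ δ (c i) w)) ⟩
    sum (f ∘ π) -ℚ sum₂ (λ i w → f (π w) *ℚ δ (c i) w)            ≡⟨ cong (sum (f ∘ π) -ℚ_) (sum-cong-≗ λ i → trans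
                                                                       (sum-cong-≗ λ w → ℚ.*-comm (f (π w)) (δ (c i) w))
                                                                       (trans (sum-δ (c i) (f ∘ π)) (cong f (π-c i)))) ⟩
    sum (f ∘ π) -ℚ sum f                                          ∎
    where
    open ≡-Reasoning
    expand : ∀ s x → (1ℚ -ℚ s) *ℚ x ≡ x -ℚ x *ℚ s
    expand = solve-∀ ℚ-ring

least : {P : ℕ → Set} → (∀ ℓ → Dec (P ℓ)) → ∀ {m} → P m → ∃ λ ℓ → P ℓ × (∀ {j} → P j → ℓ ≤ j)
least P? {m} Pm with P? 0
... | yes P0 = 0 , P0 , λ _ → z≤n
least P? {zero}  Pm | no ¬P0 = contradiction Pm ¬P0
least {P} P? {suc m} Pm | no ¬P0 with least (P? ∘ suc) Pm
... | ℓ , Pℓ , min = suc ℓ , Pℓ , λ { {zero} P0 → contradiction P0 ¬P0 ; {suc j} Pj → s≤s (min Pj) }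

abstract
  upper-bound : ∀ {n} (f : Fin n → ℕ) → ∃ λ N → ∀ i → f i ≤ N
  upper-bound {zero}  f = 0 , λ ()
  upper-bound {suc n} f with upper-bound (f ∘ suc)
  ... | N , f≤N = f zero + N , λ { zero → ℕ.m≤m+n (f zero) N ; (suc i) → ℕ.≤-trans (f≤N i) (ℕ.m≤n+m N (f zero)) }

-- The breadth-first forest of `H` with roots `c i`: depth is the distance to the nearest root, and
-- every other vertex chooses a neighbour one step closer as its parent.
module Forest {n} (H : Graph n) {k} (c : Fin k → Fin n) (c-injective : Injective _≡_ _≡_ c)
              (reach : ∀ w → ∃ λ i → Reach H w (c i)) where

  IsRoot : Fin n → Set
  IsRoot = Image c

  Near : ℕ → Fin n → Set
  Near zero    w = IsRoot w
  Near (suc ℓ) w = ∃ λ v → adj H w v ≡ true × Near ℓ v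

  near? : ∀ ℓ w → Dec (Near ℓ w)
  near? zero    w = image? c w
  near? (suc ℓ) w = any? λ v → (adj H w v Bool.≟ true) ×-dec near? ℓ v

  reach⇒near : ∀ {w i} → Reach H w (c i) → ∃ λ ℓ → Near ℓ w
  reach⇒near here       = 0 , _ , refl
  reach⇒near (step e r) with reach⇒near r
  ... | ℓ , near = suc ℓ , _ , e , near

  abstract
    nearest : ∀ w → ∃ λ ℓ → Near ℓ w × (∀ {j} → Near j w → ℓ ≤ j)
    nearest w = least (λ ℓ → near? ℓ w) (proj₂ (reach⇒near (proj₂ (reach w))))

  depth : Fin n → ℕ
  depth w = proj₁ (nearest w)

  abstract
    -- A root is its own parent, so iterating `parent` stabilises once a root is reached.
    parent-spec : ∀ w → ∃ λ v → (IsRoot w × depth w ≡ 0 × v ≡ w) ⊎ (¬ IsRoot w × adj H w v ≡ true × depth w ≡ suc (depth v))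
    parent-spec w with nearest w
    ... | zero  , root , _ = w , inj₁ (root , refl , refl)
    ... | suc ℓ , (v , e , near) , min = v , inj₂ ((λ root → ℕ.n≮0 (min root)) , e , cong suc (ℕ.≤-antisym
      (ℕ.s≤s⁻¹ (min (v , e , proj₁ (proj₂ (nearest v))))) (proj₂ (proj₂ (nearest v)) near)))

  parent : Fin n → Fin n
  parent w = proj₁ (parent-spec w)

  root? : ∀ w → (IsRoot w × depth w ≡ 0 × parent w ≡ w) ⊎ (¬ IsRoot w × adj H w (parent w) ≡ true × depth w ≡ suc (depth (parent w)))
  root? w = proj₂ (parent-spec w)

  depth≡0⇒root : ∀ {w} → depth w ≡ 0 → IsRoot w
  depth≡0⇒root {w} eq with root? w
  ... | inj₁ (root , _)     = root
  ... | inj₂ (_ , _ , eq′) with () ← trans (≡-sym eq) eq′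

  parent-root : ∀ {w} → IsRoot w → parent w ≡ w
  parent-root {w} root with root? w
  ... | inj₁ (_ , _ , eq) = eq
  ... | inj₂ (¬root , _)  = contradiction root ¬root

  ancestor : ℕ → Fin n → Fin n
  ancestor zero    w = w
  ancestor (suc t) w = parent (ancestor t w)

  ancestor-parent : ∀ t w → ancestor t (parent w) ≡ parent (ancestor t w)
  ancestor-parent zero    w = refl
  ancestor-parent (suc t) w = cong parent (ancestor-parent t w)

  depth-ancestor : ∀ t w → depth (ancestor t w) ≡ depth w ∸ t
  depth-ancestor zero    w = refl
  depth-ancestor (suc t) w = trans (depth-parent (ancestor t w)) (trans (cong ℕ.pred (depth-ancestor t w)) (ℕ.pred[m∸n]≡m∸[1+n] (depth w) t))
    where
    depth-parent : ∀ w → depth (parent w) ≡ ℕ.pred (depth w)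
    depth-parent w with root? w
    ... | inj₁ (_ , eq , eq′) = trans (cong depth eq′) (trans eq (≡-sym (cong ℕ.pred eq)))
    ... | inj₂ (_ , _ , eq)   = ≡-sym (cong ℕ.pred eq)

  ancestor-root : ∀ {w} t → depth w ≤ t → IsRoot (ancestor t w)
  ancestor-root {w} t d≤t = depth≡0⇒root (trans (depth-ancestor t w) (ℕ.m≤n⇒m∸n≡0 d≤t))

  ancestor-nonroot : ∀ {w t} → t ℕ.< depth w → ¬ IsRoot (ancestor t w)
  ancestor-nonroot {w} {t} t<d root with root? (ancestor t w)
  ... | inj₁ (_ , eq , _)  = ℕ.m>n⇒m∸n≢0 t<d (trans (≡-sym (depth-ancestor t w)) eq)
  ... | inj₂ (¬root , _)   = ¬root root

  ancestor-adj : ∀ {w t} → t ℕ.< depth w → adj H (ancestor t w) (ancestor (suc t) w) ≡ true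
  ancestor-adj {w} {t} t<d with root? (ancestor t w)
  ... | inj₁ (root , _)  = contradiction root (ancestor-nonroot t<d)
  ... | inj₂ (_ , e , _) = e

  ancestor-injective : ∀ {w i j} → i ≤ depth w → j ≤ depth w → ancestor i w ≡ ancestor j w → i ≡ j
  ancestor-injective {w} {i} {j} i≤d j≤d eq = ℕ.∸-cancelˡ-≡ i≤d j≤d
    (trans (≡-sym (depth-ancestor i w)) (trans (cong depth eq) (depth-ancestor j w)))

  -- A bound on all depths at once: the same iterate of `parent` sends every vertex to its root,
  -- which makes `π` invariant under `parent`.
  N : ℕ
  N = proj₁ (upper-bound depth)

  π : Fin n → Fin k
  π w = proj₁ (ancestor-root N (proj₂ (upper-bound depth) w))

  c-π : ∀ w → c (π w) ≡ ancestor N w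
  c-π w = proj₂ (ancestor-root N (proj₂ (upper-bound depth) w))

  π-parent : ∀ w → π (parent w) ≡ π w
  π-parent w = c-injective (begin
    c (π (parent w))       ≡⟨ c-π (parent w) ⟩
    ancestor N (parent w)  ≡⟨ ancestor-parent N w ⟩
    parent (ancestor N w)  ≡⟨ parent-root (π w , c-π w) ⟩
    ancestor N w           ≡⟨ c-π w ⟨
    c (π w)                ∎)
    where open ≡-Reasoning

  π-c : ∀ i → π (c i) ≡ i
  π-c i = c-injective (trans (c-π (c i)) (fixed N))
    where
    fixed : ∀ t → ancestor t (c i) ≡ c i
    fixed zero    = refl
    fixed (suc t) = trans (cong parent (fixed t)) (parent-root (i , refl))

  open Retraction c π π-c using (ν; ν-image; ν-outside; sum-ν)

  -- The 0/1 matrix of the forest edges directed from child to parent; roots are excluded because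
  -- they are their own parents.
  arc : Fin n → Fin n → ℚ
  arc a b = ν a *ℚ δ (parent a) b

  arc-value : ∀ a b → (arc a b ≡ 0ℚ × (IsRoot a ⊎ parent a ≢ b)) ⊎ (arc a b ≡ 1ℚ × ¬ IsRoot a × parent a ≡ b)
  arc-value a b with root? a | parent a ≟ b
  ... | inj₁ (root , _)  | _      = inj₁ (≡0-*ˡ (δ (parent a) b) (ν-image root) , inj₁ root)
  ... | inj₂ (¬root , _) | yes eq = inj₂ (cong₂ _*ℚ_ (ν-outside ¬root) (δ-≡ eq) , ¬root , eq)
  ... | inj₂ _           | no neq = inj₁ (≡0-*ʳ (ν a) (δ-≢ neq) , inj₂ neq)

  nonroot-adj : ∀ {a} → ¬ IsRoot a → adj H a (parent a) ≡ true × depth a ≡ suc (depth (parent a))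
  nonroot-adj {a} ¬root with root? a
  ... | inj₁ (root , _) = contradiction root ¬root
  ... | inj₂ (_ , spec) = spec

  tree-edge? : ∀ a b → weight H a b ≡ arc a b +ℚ arc b a
             ⊎ (adj H a b ≡ true × (arc a b ≡ 0ℚ × (IsRoot a ⊎ parent a ≢ b)) × (arc b a ≡ 0ℚ × (IsRoot b ⊎ parent b ≢ a)))
  tree-edge? a b with arc-value a b | arc-value b a
  ... | inj₁ ab | inj₁ ba with adj H a b
  ...   | true  = inj₂ (refl , ab , ba)
  ...   | false = inj₁ (≡-sym (cong₂ _+ℚ_ (proj₁ ab) (proj₁ ba)))
  tree-edge? a b | inj₁ (eq , _) | inj₂ (eq′ , ¬root , refl) = inj₁ (trans
    (cong b2ℚ (trans (Graph.sym H (parent b) b) (proj₁ (nonroot-adj ¬root)))) (≡-sym (cong₂ _+ℚ_ eq eq′)))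
  tree-edge? a b | inj₂ (eq , ¬root , refl) | inj₁ (eq′ , _) = inj₁ (trans
    (cong b2ℚ (proj₁ (nonroot-adj ¬root))) (≡-sym (cong₂ _+ℚ_ eq eq′)))
  -- Two vertices cannot be parents of each other: the depth of `a` would exceed itself by 2.
  tree-edge? a b | inj₂ (_ , ¬root , refl) | inj₂ (_ , ¬root′ , eq) = contradiction
    (trans (proj₂ (nonroot-adj ¬root)) (cong suc (trans (proj₂ (nonroot-adj ¬root′)) (cong (suc ∘ depth) eq))))
    (ℕ.m≢1+n+m (depth a) {1})

  arcs≤weight : ∀ a b → 0ℚ ≤ℚ weight H a b -ℚ (arc a b +ℚ arc b a)
  arcs≤weight a b with tree-edge? a b
  ... | inj₁ eq = ≤⇒0≤ (ℚ.≤-reflexive (≡-sym eq))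
  ... | inj₂ (e , (eq , _) , (eq′ , _)) = ≤⇒0≤ (ℚ.≤-trans (ℚ.≤-reflexive (cong₂ _+ℚ_ eq eq′)) (b2ℚ-≥0 (adj H a b)))

  -- Each vertex other than a root owns one arc, seen once from either end, and both ends have the
  -- same root.
  sum-arcs : ∀ (f : Fin k → ℚ) → sum₂ (λ a b → f (π a) *ℚ (arc a b +ℚ arc b a)) ≡ 2ℚ *ℚ (sum (f ∘ π) -ℚ sum f)
  sum-arcs f = begin
    sum₂ (λ a b → f (π a) *ℚ (arc a b +ℚ arc b a))            ≡⟨ sum₂-cong (λ a b → trans (ℚ.*-distribˡ-+ (f (π a)) (arc a b) (arc b a)) (cong₂ _+ℚ_ (rearr (ν a) _ (f (π a))) (rearr (ν b) _ (f (π a))))) ⟩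
    sum₂ (λ a b → ν a *ℚ (δ (parent a) b *ℚ f (π a)) +ℚ ν b *ℚ (δ (parent b) a *ℚ f (π a)))
                                                              ≡⟨ sum₂-+ (λ a b → ν a *ℚ (δ (parent a) b *ℚ f (π a))) (λ a b → ν b *ℚ (δ (parent b) a *ℚ f (π a))) ⟩
    sum₂ (λ a b → ν a *ℚ (δ (parent a) b *ℚ f (π a))) +ℚ sum₂ (λ a b → ν b *ℚ (δ (parent b) a *ℚ f (π a)))
                                                              ≡⟨ cong₂ _+ℚ_ (collapse (λ a b → f (π a)) (λ _ → refl))
                                                                  (trans (∑-comm λ a b → ν b *ℚ (δ (parent b) a *ℚ f (π a))) (collapse (λ a b → f (π b)) (λ a → cong f (π-parent a)))) ⟩
    sum (λ a → ν a *ℚ f (π a)) +ℚ sum (λ a → ν a *ℚ f (π a))  ≡⟨ cong₂ _+ℚ_ (sum-ν f) (sum-ν f) ⟩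
    (sum (f ∘ π) -ℚ sum f) +ℚ (sum (f ∘ π) -ℚ sum f)          ≡⟨ 2x≡x+x (sum (f ∘ π) -ℚ sum f) ⟨
    2ℚ *ℚ (sum (f ∘ π) -ℚ sum f)                              ∎
    where
    open ≡-Reasoning
    rearr : ∀ x y z → z *ℚ (x *ℚ y) ≡ x *ℚ (y *ℚ z)
    rearr = solve-∀ ℚ-ring
    collapse : ∀ (g : Fin n → Fin n → ℚ) → (∀ a → g a (parent a) ≡ f (π a)) →
               sum₂ (λ a b → ν a *ℚ (δ (parent a) b *ℚ g a b)) ≡ sum (λ a → ν a *ℚ f (π a))
    collapse g g-parent = sum-cong-≗ λ a → trans (sum-* (ν a) λ b → δ (parent a) b *ℚ g a b)
      (cong (ν a *ℚ_) (trans (sum-δ (parent a) (g a)) (g-parent a)))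

  sum-arcs-1 : sum₂ (λ a b → arc a b +ℚ arc b a) ≡ 2ℚ *ℚ (ℕ→ℚ n -ℚ ℕ→ℚ k)
  sum-arcs-1 = begin
    sum₂ (λ a b → arc a b +ℚ arc b a)             ≡⟨ sum₂-cong (λ a b → ≡-sym (ℚ.*-identityˡ (arc a b +ℚ arc b a))) ⟩
    sum₂ (λ a b → 1ℚ *ℚ (arc a b +ℚ arc b a))     ≡⟨ sum-arcs (λ _ → 1ℚ) ⟩
    2ℚ *ℚ (sum {n} (λ _ → 1ℚ) -ℚ sum {k} (λ _ → 1ℚ))  ≡⟨ cong (2ℚ *ℚ_) (cong₂ _-ℚ_ (sum-1 n) (sum-1 k)) ⟩
    2ℚ *ℚ (ℕ→ℚ n -ℚ ℕ→ℚ k)                        ∎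
    where open ≡-Reasoning

  forest-bound : 2ℚ *ℚ (ℕ→ℚ n -ℚ ℕ→ℚ k) ≤ℚ sum₂ (weight H)
  forest-bound = 0≤⇒≤ (subst (0ℚ ≤ℚ_) (trans (sum₂-- (weight H) λ a b → arc a b +ℚ arc b a) (cong (sum₂ (weight H) -ℚ_) sum-arcs-1))
    (sum-≥0 λ a → sum-≥0 (arcs≤weight a)))

  -- With no more edges than the `n - k` arcs, `H` coincides with its forest. Hence `π` is constant
  -- on the connected components of `H`, which are its `k` trees.
  module Tight (tight : sum₂ (weight H) ≡ 2ℚ *ℚ (ℕ→ℚ n -ℚ ℕ→ℚ k)) where

    weight≡arcs : ∀ a b → weight H a b ≡ arc a b +ℚ arc b a
    weight≡arcs a b = x-y≡0⇒x≡y (sum₂≤0⇒≡0 arcs≤weight (ℚ.≤-reflexive (begin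
      sum₂ (λ a b → weight H a b -ℚ (arc a b +ℚ arc b a))    ≡⟨ sum₂-- (weight H) (λ a b → arc a b +ℚ arc b a) ⟩
      sum₂ (weight H) -ℚ sum₂ (λ a b → arc a b +ℚ arc b a)   ≡⟨ cong₂ _-ℚ_ tight sum-arcs-1 ⟩
      _                                                      ≡⟨ ℚ.+-inverseʳ (2ℚ *ℚ (ℕ→ℚ n -ℚ ℕ→ℚ k)) ⟩
      0ℚ                                                     ∎)) a b)
      where open ≡-Reasoning

    π-adj : ∀ {a b} → adj H a b ≡ true → π a ≡ π b
    π-adj {a} {b} e with arc-value a b | arc-value b a
    ... | inj₂ (_ , _ , refl) | _ = ≡-sym (π-parent a)
    ... | inj₁ _ | inj₂ (_ , _ , refl) = π-parent b
    ... | inj₁ (eq , _) | inj₁ (eq′ , _) = contradiction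
            (trans (≡-sym (cong b2ℚ e)) (trans (weight≡arcs a b) (cong₂ _+ℚ_ eq eq′))) ℚ.1≢0

    π-reach : ∀ {a b} → Reach H a b → π a ≡ π b
    π-reach here       = refl
    π-reach (step e r) = trans (π-adj e) (π-reach r)

    sum-weight : ∀ (f : Fin k → ℚ) → sum₂ (λ a b → f (π a) *ℚ weight H a b) ≡ 2ℚ *ℚ (sum (f ∘ π) -ℚ sum f)
    sum-weight f = trans (sum₂-cong λ a b → cong (f (π a) *ℚ_) (weight≡arcs a b)) (sum-arcs f)

-- Block decompositions

degree : ∀ {n} → Graph n → Fin n → ℚ
degree G u = sum (weight G u)

ℕ→ℚ-deg : ∀ {n} (G : Graph n) u → ℕ→ℚ (deg G u) ≡ degree G u
ℕ→ℚ-deg G u = trans (ℕ→ℚ-sumℕ λ v → b2ℕ (adj G u v)) (sum-cong-≗ λ v → ℕ→ℚ-b2ℕ (adj G u v))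

laplacian-difference : ∀ {n} (G : Graph n) x w →
  laplacianApply G x w ≡ sum λ v → weight G w v *ℚ (x w -ℚ x v)
laplacian-difference G x w = begin
  ℕ→ℚ (deg G w) *ℚ x w -ℚ sumℚ (λ v → if adj G w v then x v else 0ℚ)
    ≡⟨ cong₂ (λ d s → d *ℚ x w -ℚ s) (ℕ→ℚ-deg G w) (trans (sumℚ≡sum λ v → if adj G w v then x v else 0ℚ) (sum-cong-≗ λ v → if-weight (adj G w v) (x v))) ⟩
  degree G w *ℚ x w -ℚ sum (λ v → weight G w v *ℚ x v)
    ≡⟨ cong (_-ℚ sum (λ v → weight G w v *ℚ x v)) (trans (ℚ.*-comm (degree G w) (x w)) (*-distribˡ-sum (x w) (weight G w))) ⟩
  sum (λ v → x w *ℚ weight G w v) -ℚ sum (λ v → weight G w v *ℚ x v)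
    ≡⟨ sum-- (λ v → x w *ℚ weight G w v) (λ v → weight G w v *ℚ x v) ⟨
  sum (λ v → x w *ℚ weight G w v -ℚ weight G w v *ℚ x v)
    ≡⟨ sum-cong-≗ (λ v → factor (weight G w v) (x w) (x v)) ⟩
  sum (λ v → weight G w v *ℚ (x w -ℚ x v)) ∎
  where
  open ≡-Reasoning
  if-weight : ∀ b y → (if b then y else 0ℚ) ≡ b2ℚ b *ℚ y
  if-weight true  y = ≡-sym (ℚ.*-identityˡ y)
  if-weight false y = ≡-sym (ℚ.*-zeroˡ y)
  factor : ∀ a p q → p *ℚ a -ℚ a *ℚ q ≡ a *ℚ (p -ℚ q)
  factor = solve-∀ ℚ-ring

-- The weak form of Kirchhoff's equations: multiply the equation at `a` by `f a`, sum, and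
-- symmetrise over the two orientations of each edge. The latter accounts for the factor 2.
kirchhoff : ∀ {n} (G : Graph n) {u v x} → IsPotential G u v x → ∀ f →
  sum₂ (λ a b → weight G a b *ℚ ((x a -ℚ x b) *ℚ (f a -ℚ f b))) ≡ 2ℚ *ℚ (f u -ℚ f v)
kirchhoff {n} G {u} {v} {x} pot f = begin
  sum₂ (λ a b → weight G a b *ℚ ((x a -ℚ x b) *ℚ (f a -ℚ f b)))
    ≡⟨ sum₂-cong (λ a b → trans (split (weight G a b) (x a) (x b) (f a) (f b)) (cong (λ ω → flow a b +ℚ ω *ℚ (f b *ℚ (x b -ℚ x a))) (weight-sym G a b))) ⟩
  sum₂ (λ a b → flow a b +ℚ flow b a)           ≡⟨ sum₂-+ flow (λ a b → flow b a) ⟩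
  sum₂ flow +ℚ sum₂ (λ a b → flow b a)          ≡⟨ cong (sum₂ flow +ℚ_) (∑-comm λ a b → flow b a) ⟩
  sum₂ flow +ℚ sum₂ flow                        ≡⟨ 2x≡x+x (sum₂ flow) ⟨
  2ℚ *ℚ sum₂ flow                               ≡⟨ cong (2ℚ *ℚ_) sum-flow ⟩
  2ℚ *ℚ (f u -ℚ f v)                            ∎
  where
  open ≡-Reasoning
  flow : Fin n → Fin n → ℚ
  flow a b = weight G a b *ℚ (f a *ℚ (x a -ℚ x b))
  split : ∀ ω xa xb fa fb → ω *ℚ ((xa -ℚ xb) *ℚ (fa -ℚ fb)) ≡ ω *ℚ (fa *ℚ (xa -ℚ xb)) +ℚ ω *ℚ (fb *ℚ (xb -ℚ xa))
  split = solve-∀ ℚ-ring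
  rearr : ∀ ω y d → ω *ℚ (y *ℚ d) ≡ y *ℚ (ω *ℚ d)
  rearr = solve-∀ ℚ-ring
  distrib : ∀ y p q → y *ℚ (p -ℚ q) ≡ p *ℚ y -ℚ q *ℚ y
  distrib = solve-∀ ℚ-ring
  sum-flow : sum₂ flow ≡ f u -ℚ f v
  sum-flow = begin
    sum₂ flow                                              ≡⟨ sum-cong-≗ (λ a → trans (sum-cong-≗ λ b → rearr (weight G a b) (f a) (x a -ℚ x b))
                                                                (sum-* (f a) λ b → weight G a b *ℚ (x a -ℚ x b))) ⟩
    sum (λ a → f a *ℚ sum λ b → weight G a b *ℚ (x a -ℚ x b))  ≡⟨ sum-cong-≗ (λ a → cong (f a *ℚ_) (trans (≡-sym (laplacian-difference G x a)) (pot a))) ⟩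
    sum (λ a → f a *ℚ (δ u a -ℚ δ v a))                    ≡⟨ sum-cong-≗ (λ a → distrib (f a) (δ u a) (δ v a)) ⟩
    sum (λ a → δ u a *ℚ f a -ℚ δ v a *ℚ f a)               ≡⟨ sum-- (λ a → δ u a *ℚ f a) (λ a → δ v a *ℚ f a) ⟩
    sum (λ a → δ u a *ℚ f a) -ℚ sum (λ a → δ v a *ℚ f a)   ≡⟨ cong₂ _-ℚ_ (sum-δ u f) (sum-δ v f) ⟩
    f u -ℚ f v                                             ∎

-- Counts edges with multiplicity: 1 on the edges of a cycle of length at least 3, but 2 on the edge
-- of a 2-cycle, which the conductance ½ of a bridge compensates.
cycleWeight : ∀ {n k} → (Fin k → Fin n) → Fin n → Fin n → ℚ
cycleWeight c a b = sum λ i → δ (c i) a *ℚ δ (c (next i)) b +ℚ δ (c (next i)) a *ℚ δ (c i) b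

sum₂-cycleWeight : ∀ {n k} (c : Fin k → Fin n) (g : Fin n → Fin n → ℚ) →
  sum₂ (λ a b → cycleWeight c a b *ℚ g a b) ≡ sum (λ i → g (c i) (c (next i)) +ℚ g (c (next i)) (c i))
sum₂-cycleWeight c g = begin
  sum₂ (λ a b → cycleWeight c a b *ℚ g a b)
    ≡⟨ sum₂-cong (λ a b → trans (ℚ.*-comm (cycleWeight c a b) (g a b)) (*-distribˡ-sum (g a b) λ i → δ (c i) a *ℚ δ (c (next i)) b +ℚ δ (c (next i)) a *ℚ δ (c i) b)) ⟩
  sum₂ (λ a b → sum λ i → term i a b)
    ≡⟨ sum-cong-≗ (λ a → ∑-comm λ b i → term i a b) ⟩
  sum (λ a → sum λ i → sum λ b → term i a b)
    ≡⟨ ∑-comm (λ a i → sum λ b → term i a b) ⟩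
  sum (λ i → sum₂ (term i))
    ≡⟨ sum-cong-≗ (λ i → begin
         sum₂ (term i)
           ≡⟨ sum₂-cong (λ a b → distrib (g a b) (δ (c i) a *ℚ δ (c (next i)) b) (δ (c (next i)) a *ℚ δ (c i) b)) ⟩
         sum₂ (λ a b → (δ (c i) a *ℚ δ (c (next i)) b) *ℚ g a b +ℚ (δ (c (next i)) a *ℚ δ (c i) b) *ℚ g a b)
           ≡⟨ sum₂-+ (λ a b → (δ (c i) a *ℚ δ (c (next i)) b) *ℚ g a b) (λ a b → (δ (c (next i)) a *ℚ δ (c i) b) *ℚ g a b) ⟩
         _ ≡⟨ cong₂ _+ℚ_ (sum₂-δ (c i) (c (next i)) g) (sum₂-δ (c (next i)) (c i) g) ⟩
         g (c i) (c (next i)) +ℚ g (c (next i)) (c i) ∎) ⟩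
  sum (λ i → g (c i) (c (next i)) +ℚ g (c (next i)) (c i)) ∎
  where
  open ≡-Reasoning
  term : Fin _ → Fin _ → Fin _ → ℚ
  term i a b = g a b *ℚ (δ (c i) a *ℚ δ (c (next i)) b +ℚ δ (c (next i)) a *ℚ δ (c i) b)
  distrib : ∀ y p q → y *ℚ (p +ℚ q) ≡ p *ℚ y +ℚ q *ℚ y
  distrib = solve-∀ ℚ-ring

blockWeight : ∀ {n k} → ℚ → (Fin k → Fin n) → Fin n → Fin n → ℚ
blockWeight w c a b = w *ℚ cycleWeight c a b

-- A cycle of G (with w = 1), or a bridge of G, regarded as a 2-cycle whose two edges
-- have conductance w = 1/2. Deleting its edges from G leaves one component for each of
-- its vertices c i, and π maps a vertex to the index of its component. The map extra lists
-- one end vertex for each edge of a set outside of the block whose deletion leaves a tree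
-- when the block is contracted.
record IsBlock {n} (G : Graph n) {k e} (w : ℚ) (c : Fin k → Fin n) (extra : Fin e → Fin n) : Set where
  field
    w>0        : 0ℚ < w
    π          : Fin n → Fin k
    π-c        : ∀ i → π (c i) ≡ i
    split      : ∀ a b → (π a ≡ π b × blockWeight w c a b ≡ 0ℚ)
                       ⊎ (Image c a × Image c b × blockWeight w c a b ≡ 1ℚ × adj G a b ≡ true)
                       ⊎ (adj G a b ≡ false × blockWeight w c a b ≡ 0ℚ)
    degree-sum : ∀ f → sum (λ a → f (π a) *ℚ degree G a)
                     ≡ 2ℚ *ℚ (sum (f ∘ π) -ℚ sum f) +ℚ 2ℚ *ℚ (w *ℚ sum f +ℚ sum (f ∘ π ∘ extra))

record Block {n} (G : Graph n) : Set where
  field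
    {k e}   : ℕ
    w       : ℚ
    c       : Fin k → Fin n
    extra   : Fin e → Fin n
    isBlock : IsBlock G w c extra

  open IsBlock isBlock public

  open Retraction c π π-c public

  π-image : ∀ {a} → Image c a → c (π a) ≡ a
  π-image (i , refl) = cong c (π-c i)

  -- A test function on the block is extended to `G` as `f ∘ π`. It is constant on each component,
  -- so only the block edges survive in the weak form of Kirchhoff's equations.
  unitFlow : ∀ {u v x} → IsPotential G u v x → UnitFlow w (π u) (π v) (x ∘ c)
  unitFlow {u} {v} {x} pot f = 2x≡2y⇒x≡y (trans (≡-sym total) (kirchhoff G pot (f ∘ π)))
    where
    open ≡-Reasoning
    g : Fin n → Fin n → ℚ
    g a b = (x a -ℚ x b) *ℚ (f (π a) -ℚ f (π b))
    localise : ∀ a b → weight G a b *ℚ g a b ≡ blockWeight w c a b *ℚ g a b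
    localise a b with split a b
    ... | inj₁ (eq , _) = trans (≡0-*ʳ (weight G a b) g≡0) (≡-sym (≡0-*ʳ (blockWeight w c a b) g≡0))
      where
      g≡0 : g a b ≡ 0ℚ
      g≡0 = ≡0-*ʳ (x a -ℚ x b) (trans (cong (λ i → f (π a) -ℚ f i) (≡-sym eq)) (ℚ.+-inverseʳ (f (π a))))
    ... | inj₂ (inj₁ (_ , _ , eq , e)) = cong (_*ℚ g a b) (trans (cong b2ℚ e) (≡-sym eq))
    ... | inj₂ (inj₂ (e , eq))         = cong (_*ℚ g a b) (trans (cong b2ℚ e) (≡-sym eq))
    g-c : ∀ i → g (c i) (c (next i)) +ℚ g (c (next i)) (c i) ≡ 2ℚ *ℚ ((x (c i) -ℚ x (c (next i))) *ℚ (f i -ℚ f (next i)))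
    g-c i = trans (cong₂ (λ j j′ → (x (c i) -ℚ x (c (next i))) *ℚ (f j -ℚ f j′) +ℚ (x (c (next i)) -ℚ x (c i)) *ℚ (f j′ -ℚ f j))
                    (π-c i) (π-c (next i)))
                  (double (x (c i)) (x (c (next i))) (f i) (f (next i)))
      where
      double : ∀ p q r s → (p -ℚ q) *ℚ (r -ℚ s) +ℚ (q -ℚ p) *ℚ (s -ℚ r) ≡ (1ℚ +ℚ 1ℚ) *ℚ ((p -ℚ q) *ℚ (r -ℚ s))
      double = solve-∀ ℚ-ring
    rearr : ∀ p q r → p *ℚ (q *ℚ r) ≡ q *ℚ (p *ℚ r)
    rearr = solve-∀ ℚ-ring
    total : sum₂ (λ a b → weight G a b *ℚ g a b) ≡ 2ℚ *ℚ energy w (x ∘ c) f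
    total = begin
      sum₂ (λ a b → weight G a b *ℚ g a b)              ≡⟨ sum₂-cong (λ a b → trans (localise a b) (ℚ.*-assoc w (cycleWeight c a b) (g a b))) ⟩
      sum₂ (λ a b → w *ℚ (cycleWeight c a b *ℚ g a b))  ≡⟨ sum₂-* w (λ a b → cycleWeight c a b *ℚ g a b) ⟩
      w *ℚ sum₂ (λ a b → cycleWeight c a b *ℚ g a b)    ≡⟨ cong (w *ℚ_) (trans (sum₂-cycleWeight c g) (trans (sum-cong-≗ g-c)
                                                             (sum-* 2ℚ λ i → (x (c i) -ℚ x (c (next i))) *ℚ (f i -ℚ f (next i))))) ⟩
      w *ℚ (2ℚ *ℚ sum λ i → (x (c i) -ℚ x (c (next i))) *ℚ (f i -ℚ f (next i)))
                                                        ≡⟨ rearr w 2ℚ _ ⟩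
      2ℚ *ℚ energy w (x ∘ c) f                          ∎

  -- Projection to the block preserves the drop along a block edge and collapses every other edge to
  -- a single vertex.
  edge-difference : ∀ {a b} (x : Fin n → ℚ) → adj G a b ≡ true → x (c (π a)) -ℚ x (c (π b)) ≡ blockWeight w c a b *ℚ (x a -ℚ x b)
  edge-difference {a} {b} x e with split a b
  ... | inj₁ (eq , eq′) = trans (cong (λ i → x (c (π a)) -ℚ x (c i)) (≡-sym eq)) (trans (ℚ.+-inverseʳ (x (c (π a)))) (≡-sym (≡0-*ˡ (x a -ℚ x b) eq′)))
  ... | inj₂ (inj₁ (ia , ib , eq , _)) = trans (cong₂ (λ s t → x s -ℚ x t) (π-image ia) (π-image ib))
          (≡-sym (trans (cong (_*ℚ (x a -ℚ x b)) eq) (ℚ.*-identityˡ (x a -ℚ x b))))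
  ... | inj₂ (inj₂ (e′ , _)) with () ← trans (≡-sym e) e′

module BlockResistance {n} {G : Graph n} {φ} (pot : Potentials G φ) (B : Block G) (o : Fin n) where
  open Block B

  R : Fin k → Fin k → ℚ
  R i j = φ (c i) (c j) (c i) -ℚ φ (c i) (c j) (c j)

  isResistance : IsResistance w R
  isResistance i j = φ (c i) (c j) ∘ c , subst₂ (λ s t → UnitFlow w s t (φ (c i) (c j) ∘ c)) (π-c i) (π-c j) (unitFlow (pot (c i) (c j))) , refl

  block-drop : ∀ u v → φ u v (c (π u)) -ℚ φ u v (c (π v)) ≡ R (π u) (π v)
  block-drop u v = resistance-value w>0 isResistance {x = φ u v ∘ c} (unitFlow (pot u v))

  R-sym : ∀ i j → R i j ≡ R j i
  R-sym = resistance-sym w>0 isResistance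

  -- The common row sum of `R`, read off at the row of `o`.
  ρ : ℚ
  ρ = sum (R (π o))

  sum-R : ∀ i → sum (R i) ≡ ρ
  sum-R i = resistance-sum-constant w>0 isResistance i (π o)

  sum-R-π : ∀ i → sum (λ v → R i (π v)) ≡ ρ +ℚ sum λ v → ν v *ℚ R i (π v)
  sum-R-π i = trans (≡-sym (cancel (sum (λ v → R i (π v))) ρ)) (cong (ρ +ℚ_) (≡-sym (trans (sum-ν (R i)) (cong (sum (R i ∘ π) -ℚ_) (sum-R i)))))
    where
    cancel : ∀ x y → y +ℚ (x -ℚ y) ≡ x
    cancel = solve-∀ ℚ-ring

  contribution : ℚ
  contribution = sum₂ λ u v → degree G u *ℚ R (π u) (π v)

  -- The contribution if everything off the block hung at a single vertex of it.
  baseline : ℚ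
  baseline = 2ℚ *ℚ (((ℕ→ℚ n -ℚ ℕ→ℚ k) +ℚ w *ℚ ℕ→ℚ n +ℚ ℕ→ℚ e) *ℚ ρ)

  offBlock offExtra : ℚ
  offBlock = sum₂ λ u v → ν u *ℚ (ν v *ℚ R (π u) (π v))
  offExtra = sum₂ λ x v → ν v *ℚ R (π (extra x)) (π v)

  -- For fixed `v`, `degree-sum` with `f i = R i (π v)` turns degrees into one term per vertex off
  -- the block, a term `w ρ`, and one per extra edge. Summing over `v` by `sum-R-π`, the block
  -- vertices `v` give multiples of `ρ` and the others give the excess.
  contribution-eq : contribution ≡ baseline +ℚ 2ℚ *ℚ (offBlock +ℚ offExtra)
  contribution-eq = begin
    sum₂ (λ u v → degree G u *ℚ R (π u) (π v))   ≡⟨ ∑-comm (λ u v → degree G u *ℚ R (π u) (π v)) ⟩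
    sum₂ (λ v u → degree G u *ℚ R (π u) (π v))   ≡⟨ sum-cong-≗ column ⟩
    sum (λ v → 2ℚ *ℚ (inner v +ℚ (w *ℚ ρ +ℚ outer v)))  ≡⟨ sum-* 2ℚ (λ v → inner v +ℚ (w *ℚ ρ +ℚ outer v)) ⟩
    2ℚ *ℚ sum (λ v → inner v +ℚ (w *ℚ ρ +ℚ outer v))    ≡⟨ cong (2ℚ *ℚ_) (trans (∑-distrib-+ inner (λ v → w *ℚ ρ +ℚ outer v))
                                                              (cong (sum inner +ℚ_) (∑-distrib-+ (λ _ → w *ℚ ρ) outer))) ⟩
    2ℚ *ℚ (sum inner +ℚ (sum {n} (λ _ → w *ℚ ρ) +ℚ sum outer))
                                                 ≡⟨ cong (2ℚ *ℚ_) (cong₂ _+ℚ_ sum-inner (cong₂ _+ℚ_ (sum-const {n} (w *ℚ ρ)) sum-outer)) ⟩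
    2ℚ *ℚ ((ρ *ℚ (ℕ→ℚ n -ℚ ℕ→ℚ k) +ℚ offBlock) +ℚ ((w *ℚ ρ) *ℚ ℕ→ℚ n +ℚ (ρ *ℚ ℕ→ℚ e +ℚ offExtra)))
                                                 ≡⟨ collect 2ℚ ρ (ℕ→ℚ n) (ℕ→ℚ k) (ℕ→ℚ e) w offBlock offExtra ⟩
    baseline +ℚ 2ℚ *ℚ (offBlock +ℚ offExtra)     ∎
    where
    open ≡-Reasoning
    inner outer : Fin n → ℚ
    inner v = sum λ u → ν u *ℚ R (π u) (π v)
    outer v = sum λ x → R (π (extra x)) (π v)
    column : ∀ v → sum (λ u → degree G u *ℚ R (π u) (π v)) ≡ 2ℚ *ℚ (inner v +ℚ (w *ℚ ρ +ℚ outer v))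
    column v = begin
      sum (λ u → degree G u *ℚ R (π u) (π v))    ≡⟨ sum-cong-≗ (λ u → ℚ.*-comm (degree G u) (f (π u))) ⟩
      sum (λ u → f (π u) *ℚ degree G u)          ≡⟨ degree-sum f ⟩
      2ℚ *ℚ (sum (f ∘ π) -ℚ sum f) +ℚ 2ℚ *ℚ (w *ℚ sum f +ℚ outer v)
                                                 ≡⟨ cong₂ (λ s t → 2ℚ *ℚ s +ℚ 2ℚ *ℚ (w *ℚ t +ℚ outer v)) (≡-sym (sum-ν f))
                                                      (trans (sum-cong-≗ λ i → R-sym i (π v)) (sum-R (π v))) ⟩
      2ℚ *ℚ inner v +ℚ 2ℚ *ℚ (w *ℚ ρ +ℚ outer v) ≡⟨ ℚ.*-distribˡ-+ 2ℚ (inner v) (w *ℚ ρ +ℚ outer v) ⟨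
      2ℚ *ℚ (inner v +ℚ (w *ℚ ρ +ℚ outer v))     ∎
      where
      f : Fin k → ℚ
      f i = R i (π v)
    sum-inner : sum inner ≡ ρ *ℚ (ℕ→ℚ n -ℚ ℕ→ℚ k) +ℚ offBlock
    sum-inner = begin
      sum₂ (λ v u → ν u *ℚ R (π u) (π v))                     ≡⟨ ∑-comm (λ v u → ν u *ℚ R (π u) (π v)) ⟩
      sum₂ (λ u v → ν u *ℚ R (π u) (π v))                     ≡⟨ sum-cong-≗ (λ u → trans (sum-* (ν u) (λ v → R (π u) (π v))) (trans (cong (ν u *ℚ_) (sum-R-π (π u)))
                                                                   (trans (ℚ.*-distribˡ-+ (ν u) ρ _) (cong (ν u *ℚ ρ +ℚ_) (*-distribˡ-sum (ν u) λ v → ν v *ℚ R (π u) (π v)))))) ⟩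
      sum (λ u → ν u *ℚ ρ +ℚ sum λ v → ν u *ℚ (ν v *ℚ R (π u) (π v)))
                                                              ≡⟨ ∑-distrib-+ (λ u → ν u *ℚ ρ) (λ u → sum λ v → ν u *ℚ (ν v *ℚ R (π u) (π v))) ⟩
      sum (λ u → ν u *ℚ ρ) +ℚ offBlock                        ≡⟨ cong (_+ℚ offBlock) (trans (sum-ν (λ _ → ρ)) (trans
                                                                   (cong₂ _-ℚ_ (sum-const {n} ρ) (sum-const {k} ρ)) (factor ρ (ℕ→ℚ n) (ℕ→ℚ k)))) ⟩
      ρ *ℚ (ℕ→ℚ n -ℚ ℕ→ℚ k) +ℚ offBlock                       ∎
      where
      factor : ∀ r x y → r *ℚ x -ℚ r *ℚ y ≡ r *ℚ (x -ℚ y)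
      factor = solve-∀ ℚ-ring
    sum-outer : sum outer ≡ ρ *ℚ ℕ→ℚ e +ℚ offExtra
    sum-outer = begin
      sum₂ (λ v x → R (π (extra x)) (π v))    ≡⟨ ∑-comm (λ v x → R (π (extra x)) (π v)) ⟩
      sum₂ (λ x v → R (π (extra x)) (π v))    ≡⟨ sum-cong-≗ (λ x → sum-R-π (π (extra x))) ⟩
      sum (λ x → ρ +ℚ sum λ v → ν v *ℚ R (π (extra x)) (π v))  ≡⟨ ∑-distrib-+ (λ _ → ρ) (λ x → sum λ v → ν v *ℚ R (π (extra x)) (π v)) ⟩
      sum {e} (λ _ → ρ) +ℚ offExtra           ≡⟨ cong (_+ℚ offExtra) (sum-const {e} ρ) ⟩
      ρ *ℚ ℕ→ℚ e +ℚ offExtra                  ∎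
    collect : ∀ t r n k e w p q → t *ℚ ((r *ℚ (n -ℚ k) +ℚ p) +ℚ ((w *ℚ r) *ℚ n +ℚ (r *ℚ e +ℚ q)))
                                ≡ t *ℚ (((n -ℚ k) +ℚ w *ℚ n +ℚ e) *ℚ r) +ℚ t *ℚ (p +ℚ q)
    collect = solve-∀ ℚ-ring

  ν-≥0 : ∀ v → 0ℚ ≤ℚ ν v
  ν-≥0 v with image? c v
  ... | yes image  = ℚ.≤-reflexive (≡-sym (ν-image image))
  ... | no outside = ℚ.≤-trans (b2ℚ-≥0 true) (ℚ.≤-reflexive (≡-sym (ν-outside outside)))

  excess : ℚ
  excess = 2ℚ *ℚ (offBlock +ℚ offExtra)

  offBlock-≥0 : 0ℚ ≤ℚ offBlock
  offBlock-≥0 = sum-≥0 λ u → sum-≥0 λ v → 0≤-* (ν-≥0 u) (0≤-* (ν-≥0 v) (resistance-≥0 w>0 isResistance (π u) (π v)))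

  offExtra-terms-≥0 : ∀ x v → 0ℚ ≤ℚ ν v *ℚ R (π (extra x)) (π v)
  offExtra-terms-≥0 x v = 0≤-* (ν-≥0 v) (resistance-≥0 w>0 isResistance (π (extra x)) (π v))

  offExtra-≥0 : 0ℚ ≤ℚ offExtra
  offExtra-≥0 = sum-≥0 λ x → sum-≥0 (offExtra-terms-≥0 x)

  excess-≥0 : 0ℚ ≤ℚ excess
  excess-≥0 = 0≤-* (0≤-+ (b2ℚ-≥0 true) (b2ℚ-≥0 true)) (0≤-+ offBlock-≥0 offExtra-≥0)

  -- The nonnegative terms of `offExtra` vanish one by one, and vanishing resistance identifies
  -- block vertices.
  excess≡0⇒concentrated : excess ≡ 0ℚ → ∀ x {v} → ¬ Image c v → π v ≡ π (extra x)
  excess≡0⇒concentrated eq x {v} outside = ≡-sym (resistance≡0⇒≡ w>0 isResistance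
    (trans (≡-sym (trans (cong (_*ℚ R (π (extra x)) (π v)) (ν-outside outside)) (ℚ.*-identityˡ (R (π (extra x)) (π v)))))
      (sum₂≤0⇒≡0 offExtra-terms-≥0 (ℚ.≤-reflexive (+≤0⇒≡0ʳ offBlock-≥0 offExtra-≥0 (ℚ.≤-reflexive (*≡0 2ℚ _ (λ ()) eq)))) x v)))

  concentrated⇒excess≡0 : ∀ i → (∀ {v} → ¬ Image c v → π v ≡ i) → (∀ x → π (extra x) ≡ i) → excess ≡ 0ℚ
  concentrated⇒excess≡0 i outside extras = ≡0-*ʳ 2ℚ (trans (cong₂ _+ℚ_
      (sum-0 λ u → sum-0 λ v → vanish u v) (sum-0 λ x → sum-0 λ v → ν*R≡0 v (extras x))) (ℚ.+-identityˡ 0ℚ))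
    where
    ν*R≡0 : ∀ v {j} → j ≡ i → ν v *ℚ R j (π v) ≡ 0ℚ
    ν*R≡0 v {j} j≡i with image? c v
    ... | yes image  = ≡0-*ˡ (R j (π v)) (ν-image image)
    ... | no outside′ = ≡0-*ʳ (ν v) (trans (cong₂ R j≡i (outside outside′)) (resistance-refl w>0 isResistance i))
    vanish : ∀ u v → ν u *ℚ (ν v *ℚ R (π u) (π v)) ≡ 0ℚ
    vanish u v with image? c u
    ... | yes image   = ≡0-*ˡ (ν v *ℚ R (π u) (π v)) (ν-image image)
    ... | no outside′ = ≡0-*ʳ (ν u) (ν*R≡0 v (outside outside′))

<ᵇ-true : ∀ {m n} → m ℕ.< n → (m ℕ.<ᵇ n) ≡ true
<ᵇ-true m<n = Equivalence.to T-≡ (ℕ.<⇒<ᵇ m<n)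

<ᵇ-false : ∀ {m n} → n ≤ m → (m ℕ.<ᵇ n) ≡ false
<ᵇ-false {m} {n} n≤m with m ℕ.<ᵇ n in eq
... | false = refl
... | true  = contradiction (ℕ.<ᵇ⇒< m n (Equivalence.from T-≡ eq)) (ℕ.≤⇒≯ n≤m)

τ : ∀ {n} → Fin n → Fin n → ℚ
τ u v = b2ℚ (toℕ u ℕ.<ᵇ toℕ v)

τ-trichotomy : ∀ {n} (u v : Fin n) → u ≡ v ⊎ τ u v +ℚ τ v u ≡ 1ℚ
τ-trichotomy u v with ℕ.<-cmp (toℕ u) (toℕ v)
... | tri≈ _ eq _  = inj₁ (toℕ-injective eq)
... | tri< u<v _ _ = inj₂ (cong₂ (λ b b′ → b2ℚ b +ℚ b2ℚ b′) (<ᵇ-true u<v) (<ᵇ-false (ℕ.<⇒≤ u<v)))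
... | tri> _ _ v<u = inj₂ (cong₂ (λ b b′ → b2ℚ b +ℚ b2ℚ b′) (<ᵇ-false (ℕ.<⇒≤ v<u)) (<ᵇ-true v<u))

-- The `d v` half of the sum over u < v is reflected into a `d u` sum over v < u. Together the
-- halves run over all ordered pairs off the diagonal, on which `r` vanishes.
sum-over-pairs : ∀ {n} (d : Fin n → ℚ) (r : Fin n → Fin n → ℚ) → (∀ u v → r u v ≡ r v u) → (∀ u → r u u ≡ 0ℚ) →
  sum₂ (λ u v → τ u v *ℚ ((d u +ℚ d v) *ℚ r u v)) ≡ sum₂ (λ u v → d u *ℚ r u v)
sum-over-pairs d r r-sym r-refl = begin
  sum₂ (λ u v → τ u v *ℚ ((d u +ℚ d v) *ℚ r u v))
    ≡⟨ sum₂-cong (λ u v → trans (split (τ u v) (d u) (d v) (r u v)) (cong (λ s → half u v +ℚ τ u v *ℚ (d v *ℚ s)) (r-sym u v))) ⟩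
  sum₂ (λ u v → half u v +ℚ τ u v *ℚ (d v *ℚ r v u))
    ≡⟨ sum₂-+ half (λ u v → τ u v *ℚ (d v *ℚ r v u)) ⟩
  sum₂ half +ℚ sum₂ (λ u v → τ u v *ℚ (d v *ℚ r v u))
    ≡⟨ cong (sum₂ half +ℚ_) (∑-comm λ u v → τ u v *ℚ (d v *ℚ r v u)) ⟩
  sum₂ half +ℚ sum₂ (λ u v → τ v u *ℚ (d u *ℚ r u v))
    ≡⟨ sum₂-+ half (λ u v → τ v u *ℚ (d u *ℚ r u v)) ⟨
  sum₂ (λ u v → half u v +ℚ τ v u *ℚ (d u *ℚ r u v))
    ≡⟨ sum₂-cong (λ u v → trans (≡-sym (ℚ.*-distribʳ-+ (d u *ℚ r u v) (τ u v) (τ v u))) (merge u v)) ⟩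
  sum₂ (λ u v → d u *ℚ r u v) ∎
  where
  open ≡-Reasoning
  half : Fin _ → Fin _ → ℚ
  half u v = τ u v *ℚ (d u *ℚ r u v)
  split : ∀ t x y z → t *ℚ ((x +ℚ y) *ℚ z) ≡ t *ℚ (x *ℚ z) +ℚ t *ℚ (y *ℚ z)
  split = solve-∀ ℚ-ring
  merge : ∀ u v → (τ u v +ℚ τ v u) *ℚ (d u *ℚ r u v) ≡ d u *ℚ r u v
  merge u v with τ-trichotomy u v
  ... | inj₁ refl = trans (≡0-*ʳ (τ u v +ℚ τ v u) vanish) (≡-sym vanish)
    where
    vanish : d u *ℚ r u u ≡ 0ℚ
    vanish = ≡0-*ʳ (d u) (r-refl u)
  ... | inj₂ eq = trans (cong (_*ℚ (d u *ℚ r u v)) eq) (ℚ.*-identityˡ (d u *ℚ r u v))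

DR-pairs : ∀ {n} (G : Graph n) φ → DR G φ ≡ sum₂ (λ u v → τ u v *ℚ ((degree G u +ℚ degree G v) *ℚ resistance φ u v))
DR-pairs {n} G φ = trans (sumℚ≡sum (λ u → sumℚ (term u))) (sum-cong-≗ λ u → trans (sumℚ≡sum (term u)) (sum-cong-≗ λ v → term-eq u v))
  where
  term : Fin n → Fin n → ℚ
  term u v = if toℕ u ℕ.<ᵇ toℕ v then ℕ→ℚ (deg G u + deg G v) *ℚ resistance φ u v else 0ℚ
  term-eq : ∀ u v → term u v ≡ τ u v *ℚ ((degree G u +ℚ degree G v) *ℚ resistance φ u v)
  term-eq u v with toℕ u ℕ.<ᵇ toℕ v
  ... | true  = trans (cong (_*ℚ resistance φ u v) (trans (ℕ→ℚ-+ (deg G u) (deg G v)) (cong₂ _+ℚ_ (ℕ→ℚ-deg G u) (ℕ→ℚ-deg G v))))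
                      (≡-sym (ℚ.*-identityˡ _))
  ... | false = ≡-sym (ℚ.*-zeroˡ ((degree G u +ℚ degree G v) *ℚ resistance φ u v))

module Decomposition {n} {G : Graph n} (connected : Connected G) {m} (B : Fin m → Block G)
                     (cover : ∀ a b → sum (λ j → blockWeight (Block.w (B j)) (Block.c (B j)) a b) ≡ weight G a b) where
  open Block

  project : Fin m → Fin n → Fin n
  project j v = c (B j) (π (B j) v)

  -- The block weights of an edge add up to 1, so its drop is the sum of the drops of its
  -- projections; these are added along a walk. For potentials this is the series law; for the
  -- indicator of a vertex it will later detect equality and adjacency.
  telescope : ∀ (x : Fin n → ℚ) u v → x u -ℚ x v ≡ sum λ j → x (project j u) -ℚ x (project j v)
  telescope x u v = along (connected u v)
    where
    open ≡-Reasoning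
    chain : ∀ p q r → p -ℚ r ≡ (p -ℚ q) +ℚ (q -ℚ r)
    chain = solve-∀ ℚ-ring
    along : ∀ {u v} → Reach G u v → x u -ℚ x v ≡ sum λ j → x (project j u) -ℚ x (project j v)
    along {u} here = trans (ℚ.+-inverseʳ (x u)) (≡-sym (sum-0 λ j → ℚ.+-inverseʳ (x (project j u))))
    along (step {u} {s} {v} e r) = begin
      x u -ℚ x v                              ≡⟨ chain (x u) (x s) (x v) ⟩
      (x u -ℚ x s) +ℚ (x s -ℚ x v)            ≡⟨ cong₂ _+ℚ_ first (along r) ⟩
      sum (λ j → x (project j u) -ℚ x (project j s)) +ℚ sum (λ j → x (project j s) -ℚ x (project j v))
                                              ≡⟨ ∑-distrib-+ (λ j → x (project j u) -ℚ x (project j s)) (λ j → x (project j s) -ℚ x (project j v)) ⟨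
      _                                       ≡⟨ sum-cong-≗ (λ j → chain (x (project j u)) (x (project j s)) (x (project j v))) ⟨
      sum (λ j → x (project j u) -ℚ x (project j v)) ∎
      where
      first : x u -ℚ x s ≡ sum λ j → x (project j u) -ℚ x (project j s)
      first = begin
        x u -ℚ x s                                            ≡⟨ ℚ.*-identityʳ (x u -ℚ x s) ⟨
        (x u -ℚ x s) *ℚ 1ℚ                                    ≡⟨ cong ((x u -ℚ x s) *ℚ_) (trans (≡-sym (cong b2ℚ e)) (≡-sym (cover u s))) ⟩
        (x u -ℚ x s) *ℚ sum (λ j → blockWeight (w (B j)) (c (B j)) u s)     ≡⟨ *-distribˡ-sum (x u -ℚ x s) (λ j → blockWeight (w (B j)) (c (B j)) u s) ⟩
        sum (λ j → (x u -ℚ x s) *ℚ blockWeight (w (B j)) (c (B j)) u s)     ≡⟨ sum-cong-≗ (λ j → trans (ℚ.*-comm (x u -ℚ x s) (blockWeight (w (B j)) (c (B j)) u s)) (≡-sym (edge-difference (B j) x e))) ⟩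
        sum (λ j → x (project j u) -ℚ x (project j s))        ∎

  module _ {φ} (pot : Potentials G φ) (o : Fin n) where
    private module BR j = BlockResistance pot (B j) o

    resistance-blocks : ∀ u v → resistance φ u v ≡ sum λ j → BR.R j (π (B j) u) (π (B j) v)
    resistance-blocks u v = trans (telescope (φ u v) u v) (sum-cong-≗ λ j → BR.block-drop j u v)

    DR-blocks : DR G φ ≡ sum (BR.contribution)
    DR-blocks = begin
      DR G φ                                                     ≡⟨ DR-pairs G φ ⟩
      _                                                          ≡⟨ sum-over-pairs (degree G) (resistance φ) r-sym (λ u → ℚ.+-inverseʳ (φ u u u)) ⟩
      sum₂ (λ u v → degree G u *ℚ resistance φ u v)              ≡⟨ sum₂-cong (λ u v → trans (cong (degree G u *ℚ_) (resistance-blocks u v))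
                                                                      (*-distribˡ-sum (degree G u) λ j → BR.R j (π (B j) u) (π (B j) v))) ⟩
      sum (λ u → sum₂ (λ v j → term u v j))                      ≡⟨ sum-cong-≗ (λ u → ∑-comm (term u)) ⟩
      sum (λ u → sum₂ (λ j v → term u v j))                      ≡⟨ ∑-comm (λ u j → sum λ v → term u v j) ⟩
      sum (BR.contribution)                                      ∎
      where
      open ≡-Reasoning
      term : Fin n → Fin n → Fin m → ℚ
      term u v j = degree G u *ℚ BR.R j (π (B j) u) (π (B j) v)
      r-sym : ∀ u v → resistance φ u v ≡ resistance φ v u
      r-sym u v = trans (resistance-blocks u v) (trans (sum-cong-≗ λ j → BR.R-sym j (π (B j) u) (π (B j) v)) (≡-sym (resistance-blocks v u)))

    DR-excess : DR G φ ≡ sum BR.baseline +ℚ sum BR.excess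
    DR-excess = trans DR-blocks (trans (sum-cong-≗ BR.contribution-eq) (∑-distrib-+ BR.baseline BR.excess))

-- Edges and cycles as weight functions

next∘next≢ : ∀ {k} → 3 ≤ k → ∀ (i : Fin k) → next (next i) ≢ i
-- An index fixed by two steps would make all indices so, but two steps carry 0 to 2.
next∘next≢ {suc (suc (suc k))} (s≤s (s≤s (s≤s z≤n))) i eq with next-induction (λ i → next (next i) ≡ i) (λ _ → cong next) eq zero
... | eq₀ with () ← trans (≡-sym (trans (cong next (next-inject₁ zero)) (next-inject₁ (suc zero)))) eq₀

next≢ : ∀ {k} → 3 ≤ k → ∀ (i : Fin k) → next i ≢ i
next≢ 3≤k i eq = next∘next≢ 3≤k i (trans (cong next eq) eq)

δ*δ-≢ : ∀ {n} {s t a b : Fin n} → ¬ (s ≡ a × t ≡ b) → δ s a *ℚ δ t b ≡ 0ℚ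
δ*δ-≢ {s = s} {t} {a} {b} ¬eq with s ≟ a
... | yes s≡a = ≡0-*ʳ (δ s a) (δ-≢ λ t≡b → ¬eq (s≡a , t≡b))
... | no  s≢a = ≡0-*ˡ (δ t b) (δ-≢ s≢a)

char-edge : ∀ {n} {s t : Fin n} → s ≢ t → ∀ a b → char (edge s t) a b ≡ δ s a *ℚ δ t b +ℚ δ t a *ℚ δ s b
char-edge {s = s} {t} s≢t a b with mem? (edge s t) a b
... | yes m@(inj₁ (refl , refl)) = trans (char-∈ (edge s t) m)
        (≡-sym (cong₂ _+ℚ_ (cong₂ _*ℚ_ (δ-refl s) (δ-refl t)) (≡0-*ˡ (δ s t) (δ-≢ (s≢t ∘ ≡-sym)))))
... | yes m@(inj₂ (refl , refl)) = trans (char-∈ (edge s t) m)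
        (≡-sym (cong₂ _+ℚ_ (≡0-*ˡ (δ t s) (δ-≢ s≢t)) (cong₂ _*ℚ_ (δ-refl t) (δ-refl s))))
... | no ¬mem = trans (char-∉ (edge s t) ¬mem) (≡-sym (cong₂ _+ℚ_ (δ*δ-≢ (¬mem ∘ inj₁)) (δ*δ-≢ λ (t≡a , s≡b) → ¬mem (inj₂ (s≡b , t≡a)))))

sum₂-edge : ∀ {n} {s t : Fin n} → s ≢ t → ∀ g → sum₂ (λ a b → char (edge s t) a b *ℚ g a b) ≡ g s t +ℚ g t s
sum₂-edge {s = s} {t} s≢t g = begin
  sum₂ (λ a b → char (edge s t) a b *ℚ g a b)
    ≡⟨ sum₂-cong (λ a b → trans (cong (_*ℚ g a b) (char-edge s≢t a b)) (ℚ.*-distribʳ-+ (g a b) (δ s a *ℚ δ t b) (δ t a *ℚ δ s b))) ⟩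
  sum₂ (λ a b → (δ s a *ℚ δ t b) *ℚ g a b +ℚ (δ t a *ℚ δ s b) *ℚ g a b)
    ≡⟨ sum₂-+ (λ a b → (δ s a *ℚ δ t b) *ℚ g a b) (λ a b → (δ t a *ℚ δ s b) *ℚ g a b) ⟩
  _ ≡⟨ cong₂ _+ℚ_ (sum₂-δ s t g) (sum₂-δ t s g) ⟩
  g s t +ℚ g t s ∎
  where open ≡-Reasoning

sum₂-char : ∀ {n} {s t : Fin n} → s ≢ t → sum₂ (char (edge s t)) ≡ 2ℚ
sum₂-char {s = s} {t} s≢t = trans (sum₂-cong λ a b → ≡-sym (ℚ.*-identityʳ (char (edge s t) a b))) (sum₂-edge s≢t (λ _ _ → 1ℚ))

cycleWeight-sym : ∀ {n k} (c : Fin k → Fin n) a b → cycleWeight c a b ≡ cycleWeight c b a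
cycleWeight-sym c a b = sum-cong-≗ λ i → swap (δ (c i) a) (δ (c (next i)) b) (δ (c (next i)) a) (δ (c i) b)
  where
  swap : ∀ x y z w → x *ℚ y +ℚ z *ℚ w ≡ w *ℚ z +ℚ y *ℚ x
  swap = solve-∀ ℚ-ring

module _ {n k} {c : Fin k → Fin n} (3≤k : 3 ≤ k) (c-injective : Injective _≡_ _≡_ c) where

  -- Matching two cycle edges in opposite orientations would make two steps return to the start,
  -- impossible for length at least 3.
  cycle-edge-injective : ∀ i j → Mem (edge (c i) (c (next i))) (c j) (c (next j)) → i ≡ j
  cycle-edge-injective i j (inj₁ (eq , _))    = c-injective eq
  cycle-edge-injective i j (inj₂ (eq , eq′)) = contradiction
    (trans (cong next (≡-sym (c-injective eq))) (c-injective eq′)) (next∘next≢ 3≤k j)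

  cycleWeight-edge : ∀ i → cycleWeight c (c i) (c (next i)) ≡ 1ℚ
  cycleWeight-edge i = trans (sum-cong-≗ term) (sum-δ i (λ _ → 1ℚ))
    where
    term : ∀ j → δ (c j) (c i) *ℚ δ (c (next j)) (c (next i)) +ℚ δ (c (next j)) (c i) *ℚ δ (c j) (c (next i)) ≡ δ i j *ℚ 1ℚ
    term j with i ≟ j
    ... | yes refl = trans (cong₂ _+ℚ_ (cong₂ _*ℚ_ (δ-refl (c i)) (δ-refl (c (next i))))
                       (≡0-*ˡ (δ (c i) (c (next i))) (δ-≢ (next≢ 3≤k i ∘ c-injective)))) (≡-sym (cong (_*ℚ 1ℚ) (δ-refl i)))
    ... | no  i≢j  = trans (cong₂ _+ℚ_ (δ*δ-≢ {t = c (next j)} {b = c (next i)} λ (eq , _) → i≢j (≡-sym (c-injective eq)))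
                       (δ*δ-≢ λ (eq , eq′) → i≢j (cycle-edge-injective i j (inj₂ (≡-sym eq , ≡-sym eq′))))) (≡-sym (cong (_*ℚ 1ℚ) (δ-≢ i≢j)))

  char-cycleEdges : ∀ a b → char (cycleEdges c) a b ≡ cycleWeight c a b
  char-cycleEdges a b with mem? (cycleEdges c) a b
  ... | yes (i , inj₁ (refl , refl)) = ≡-sym (cycleWeight-edge i)
  ... | yes (i , inj₂ (refl , refl)) = ≡-sym (trans (cycleWeight-sym c (c (next i)) (c i)) (cycleWeight-edge i))
  ... | no ¬mem = ≡-sym (sum-0 λ i → trans (cong₂ _+ℚ_ (δ*δ-≢ λ eqs → ¬mem (i , inj₁ eqs))
                    (δ*δ-≢ λ (eq , eq′) → ¬mem (i , inj₂ (eq′ , eq)))) (ℚ.+-identityˡ 0ℚ))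

cycle-edge⇒image : ∀ {n k} (c : Fin k → Fin n) {a b} → Mem (cycleEdges c) a b → Image c a × Image c b
cycle-edge⇒image c (i , inj₁ (eq , eq′)) = (i , eq) , (next i , eq′)
cycle-edge⇒image c (i , inj₂ (eq , eq′)) = (next i , eq′) , (i , eq)

reach-around : ∀ {n k} {K : Graph n} (c : Fin k → Fin n) i → (∀ j → j ≢ i → adj K (c j) (c (next j)) ≡ true) →
               ∀ j → Reach K (c (next i)) (c j)
reach-around {K = K} c i adjacent j = next-induction (λ j → Reach K (c (next i)) (c j)) advance here j
  where
  advance : ∀ j → Reach K (c (next i)) (c j) → Reach K (c (next i)) (c (next j))
  advance j r with j ≟ i
  -- Crossing the missing edge would lead back to the start of the walk, so no step has to be taken.
  ... | yes refl = here
  ... | no  j≢i  = reach-trans r (step (adjacent j j≢i) here)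

cycle-detour : ∀ {n k} {G : Graph n} ((c , _) : Cycle G k) i → Reach (G ∖ edge (c i) (c (next i))) (c i) (c (next i))
cycle-detour {G = G} (c , 3≤k , c-injective , adjacent) i = reach-sym (reach-around c i (λ j j≢i →
  ∖-adj⁺ G (edge (c i) (c (next i))) (adjacent j) (λ mem → j≢i (≡-sym (cycle-edge-injective 3≤k c-injective i j mem)))) i)

cycle⊆ : ∀ {n k} (G : Graph n) ((c , _) : Cycle G k) {a b} → Mem (cycleEdges c) a b → adj G a b ≡ true
cycle⊆ G (_ , _ , _ , adjacent) (i , inj₁ (refl , refl)) = adjacent i
cycle⊆ G (_ , _ , _ , adjacent) (i , inj₂ (refl , refl)) = trans (Graph.sym G _ _) (adjacent i)

edge⊆ : ∀ {n} (G : Graph n) {s t} → adj G s t ≡ true → ∀ {a b} → Mem (edge s t) a b → adj G a b ≡ true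
edge⊆ G e (inj₁ (refl , refl)) = e
edge⊆ G e (inj₂ (refl , refl)) = trans (Graph.sym G _ _) e

-- `H` is `G` without the block edges `K` and the extra edges `s x`-`t x`. By `euler`, deleting them
-- from n+1 edges leaves n - k; as every vertex still reaches the block, `H` is a forest with one
-- tree per block vertex. `detour` places both ends of an extra edge in one tree. A cycle has
-- `w = 1` and one extra edge; a bridge has `k = 2`, `w = ½` and two.
module BlockFromForest
  {n} (G : Graph n) (size : sum₂ (weight G) ≡ 2ℚ *ℚ (1ℚ +ℚ ℕ→ℚ n))
  {k e} (w : ℚ) (w>0 : 0ℚ < w) (c : Fin k → Fin n) (c-injective : Injective _≡_ _≡_ c)
  (K : EdgeSet n) (K⊆G : ∀ {a b} → Mem K a b → adj G a b ≡ true)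
  (K-image : ∀ {a b} → Mem K a b → Image c a × Image c b)
  (char-K : ∀ a b → char K a b ≡ w *ℚ cycleWeight c a b)
  (s t : Fin e → Fin n) (s≢t : ∀ x → s x ≢ t x)
  (euler : 1ℚ +ℚ ℕ→ℚ k ≡ w *ℚ ℕ→ℚ k +ℚ ℕ→ℚ e)
  (H : Graph n) (weight-G : ∀ a b → weight G a b ≡ weight H a b +ℚ (char K a b +ℚ sum λ x → char (edge (s x) (t x)) a b))
  (reach : ∀ v → ∃ λ i → Reach H v (c i)) (detour : ∀ x → Reach H (s x) (t x))
  where

  open Forest H c c-injective reach using (π; π-c)

  rest : Fin n → Fin n → ℚ
  rest a b = char K a b +ℚ sum λ x → char (edge (s x) (t x)) a b

  sum₂-K : ∀ g → sum₂ (λ a b → g a b *ℚ char K a b) ≡ w *ℚ sum λ i → g (c i) (c (next i)) +ℚ g (c (next i)) (c i)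
  sum₂-K g = trans (sum₂-cong λ a b → trans (ℚ.*-comm (g a b) (char K a b)) (trans (cong (_*ℚ g a b) (char-K a b)) (ℚ.*-assoc w (cycleWeight c a b) (g a b))))
    (trans (sum₂-* w λ a b → cycleWeight c a b *ℚ g a b) (cong (w *ℚ_) (sum₂-cycleWeight c g)))

  sum₂-extra : ∀ g → sum₂ (λ a b → g a b *ℚ sum λ x → char (edge (s x) (t x)) a b) ≡ sum λ x → g (s x) (t x) +ℚ g (t x) (s x)
  sum₂-extra g = begin
    sum₂ (λ a b → g a b *ℚ sum λ x → char (edge (s x) (t x)) a b)
      ≡⟨ sum₂-cong (λ a b → trans (*-distribˡ-sum (g a b) λ x → char (edge (s x) (t x)) a b) (sum-cong-≗ λ x → ℚ.*-comm (g a b) (char (edge (s x) (t x)) a b))) ⟩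
    sum (λ a → sum₂ λ b x → char (edge (s x) (t x)) a b *ℚ g a b)
      ≡⟨ sum-cong-≗ (λ a → ∑-comm λ b x → char (edge (s x) (t x)) a b *ℚ g a b) ⟩
    sum (λ a → sum λ x → sum λ b → char (edge (s x) (t x)) a b *ℚ g a b)
      ≡⟨ ∑-comm (λ a x → sum λ b → char (edge (s x) (t x)) a b *ℚ g a b) ⟩
    sum (λ x → sum₂ λ a b → char (edge (s x) (t x)) a b *ℚ g a b)
      ≡⟨ sum-cong-≗ (λ x → sum₂-edge (s≢t x) g) ⟩
    sum (λ x → g (s x) (t x) +ℚ g (t x) (s x)) ∎
    where open ≡-Reasoning

  sum₂-G : ∀ g → sum₂ (λ a b → g a b *ℚ weight G a b) ≡
    sum₂ (λ a b → g a b *ℚ weight H a b) +ℚ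
      (w *ℚ (sum λ i → g (c i) (c (next i)) +ℚ g (c (next i)) (c i)) +ℚ sum λ x → g (s x) (t x) +ℚ g (t x) (s x))
  sum₂-G g = begin
    sum₂ (λ a b → g a b *ℚ weight G a b)
      ≡⟨ sum₂-cong (λ a b → trans (cong (g a b *ℚ_) (weight-G a b)) (distrib (g a b) (weight H a b) (char K a b) (X a b))) ⟩
    sum₂ (λ a b → g a b *ℚ weight H a b +ℚ (g a b *ℚ char K a b +ℚ g a b *ℚ X a b))
      ≡⟨ sum₂-+ (λ a b → g a b *ℚ weight H a b) (λ a b → g a b *ℚ char K a b +ℚ g a b *ℚ X a b) ⟩
    sum₂ (λ a b → g a b *ℚ weight H a b) +ℚ sum₂ (λ a b → g a b *ℚ char K a b +ℚ g a b *ℚ X a b)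
      ≡⟨ cong (sum₂ (λ a b → g a b *ℚ weight H a b) +ℚ_) (trans (sum₂-+ (λ a b → g a b *ℚ char K a b) (λ a b → g a b *ℚ X a b))
           (cong₂ _+ℚ_ (sum₂-K g) (sum₂-extra g))) ⟩
    _ ∎
    where
    open ≡-Reasoning
    X : Fin n → Fin n → ℚ
    X a b = sum λ x → char (edge (s x) (t x)) a b
    distrib : ∀ y p q r → y *ℚ (p +ℚ (q +ℚ r)) ≡ y *ℚ p +ℚ (y *ℚ q +ℚ y *ℚ r)
    distrib = solve-∀ ℚ-ring

  tight : sum₂ (weight H) ≡ 2ℚ *ℚ (ℕ→ℚ n -ℚ ℕ→ℚ k)
  tight = begin
    sum₂ (weight H)                              ≡⟨ sum₂-cong (λ a b → ≡-sym (ℚ.*-identityˡ (weight H a b))) ⟩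
    sum₂ (λ a b → 1ℚ *ℚ weight H a b)            ≡⟨ isolate _ _ ⟨
    (sum₂ (λ a b → 1ℚ *ℚ weight H a b) +ℚ (w *ℚ sum {k} (λ _ → 2ℚ) +ℚ sum {e} (λ _ → 2ℚ))) -ℚ (w *ℚ sum {k} (λ _ → 2ℚ) +ℚ sum {e} (λ _ → 2ℚ))
                                                 ≡⟨ cong₂ _-ℚ_ (trans (≡-sym (sum₂-G λ _ _ → 1ℚ)) (trans (sum₂-cong λ a b → ℚ.*-identityˡ (weight G a b)) size))
                                                      (cong₂ (λ x y → w *ℚ x +ℚ y) (sum-const {k} 2ℚ) (sum-const {e} 2ℚ)) ⟩
    2ℚ *ℚ (1ℚ +ℚ ℕ→ℚ n) -ℚ (w *ℚ (2ℚ *ℚ ℕ→ℚ k) +ℚ 2ℚ *ℚ ℕ→ℚ e)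
                                                 ≡⟨ collect 2ℚ (ℕ→ℚ n) (ℕ→ℚ k) (ℕ→ℚ e) w ⟩
    2ℚ *ℚ ((ℕ→ℚ n -ℚ ℕ→ℚ k) +ℚ ((1ℚ +ℚ ℕ→ℚ k) -ℚ (w *ℚ ℕ→ℚ k +ℚ ℕ→ℚ e)))
                                                 ≡⟨ cong (λ x → 2ℚ *ℚ ((ℕ→ℚ n -ℚ ℕ→ℚ k) +ℚ (x -ℚ (w *ℚ ℕ→ℚ k +ℚ ℕ→ℚ e)))) euler ⟩
    _                                            ≡⟨ cong (2ℚ *ℚ_) (cancel (ℕ→ℚ n -ℚ ℕ→ℚ k) (w *ℚ ℕ→ℚ k +ℚ ℕ→ℚ e)) ⟩
    2ℚ *ℚ (ℕ→ℚ n -ℚ ℕ→ℚ k)                       ∎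
    where
    open ≡-Reasoning
    isolate : ∀ x y → (x +ℚ y) -ℚ y ≡ x
    isolate = solve-∀ ℚ-ring
    cancel : ∀ x y → x +ℚ (y -ℚ y) ≡ x
    cancel = solve-∀ ℚ-ring
    collect : ∀ t n k e w → t *ℚ (1ℚ +ℚ n) -ℚ (w *ℚ (t *ℚ k) +ℚ t *ℚ e) ≡ t *ℚ ((n -ℚ k) +ℚ ((1ℚ +ℚ k) -ℚ (w *ℚ k +ℚ e)))
    collect = solve-∀ ℚ-ring

  open Forest.Tight H c c-injective reach tight using (π-adj; π-reach; sum-weight)

  π-detour : ∀ x {a b} → Mem (edge (s x) (t x)) a b → π a ≡ π b
  π-detour x (inj₁ (refl , refl)) = π-reach (detour x)
  π-detour x (inj₂ (refl , refl)) = ≡-sym (π-reach (detour x))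

  isBlock : IsBlock G w c s
  isBlock = record { w>0 = w>0 ; π = π ; π-c = π-c ; split = split ; degree-sum = degree-sum }
    where
    split : ∀ a b → (π a ≡ π b × w *ℚ cycleWeight c a b ≡ 0ℚ)
                  ⊎ (Image c a × Image c b × w *ℚ cycleWeight c a b ≡ 1ℚ × adj G a b ≡ true)
                  ⊎ (adj G a b ≡ false × w *ℚ cycleWeight c a b ≡ 0ℚ)
    split a b with mem? K a b
    ... | yes mem = inj₂ (inj₁ (proj₁ (K-image mem) , proj₂ (K-image mem) , trans (≡-sym (char-K a b)) (char-∈ K mem) , K⊆G mem))
    ... | no ¬mem with adj G a b in e | adj H a b in e′ | any? (λ x → mem? (edge (s x) (t x)) a b)
    ...   | false | _     | _            = inj₂ (inj₂ (refl , trans (≡-sym (char-K a b)) (char-∉ K ¬mem)))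
    ...   | true  | true  | _            = inj₁ (π-adj e′ , trans (≡-sym (char-K a b)) (char-∉ K ¬mem))
    ...   | true  | false | yes (x , m)  = inj₁ (π-detour x m , trans (≡-sym (char-K a b)) (char-∉ K ¬mem))
    ...   | true  | false | no ¬any      = contradiction (begin
            1ℚ                              ≡⟨ cong b2ℚ e ⟨
            weight G a b                    ≡⟨ weight-G a b ⟩
            weight H a b +ℚ rest a b        ≡⟨ cong₂ _+ℚ_ (cong b2ℚ e′) (cong₂ _+ℚ_ (char-∉ K ¬mem) (sum-0 λ x → char-∉ (edge (s x) (t x)) λ m → ¬any (x , m))) ⟩
            0ℚ                              ∎) ℚ.1≢0
      where open ≡-Reasoning
    -- The degrees are counted edge by edge: forest edges give the first term, block edges touch
    -- each block vertex twice with weight `w`, and an extra edge counts its one component twice.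
    degree-sum : ∀ f → sum (λ a → f (π a) *ℚ degree G a) ≡ 2ℚ *ℚ (sum (f ∘ π) -ℚ sum f) +ℚ 2ℚ *ℚ (w *ℚ sum f +ℚ sum (f ∘ π ∘ s))
    degree-sum f = begin
      sum (λ a → f (π a) *ℚ degree G a)
        ≡⟨ sum-cong-≗ (λ a → *-distribˡ-sum (f (π a)) (weight G a)) ⟩
      sum₂ (λ a b → f (π a) *ℚ weight G a b)
        ≡⟨ sum₂-G (λ a b → f (π a)) ⟩
      sum₂ (λ a b → f (π a) *ℚ weight H a b) +ℚ (w *ℚ (sum λ i → f (π (c i)) +ℚ f (π (c (next i)))) +ℚ sum λ x → f (π (s x)) +ℚ f (π (t x)))
        ≡⟨ cong₂ _+ℚ_ (sum-weight f) (cong₂ (λ x y → w *ℚ x +ℚ y) sum-c sum-s) ⟩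
      2ℚ *ℚ (sum (f ∘ π) -ℚ sum f) +ℚ (w *ℚ (2ℚ *ℚ sum f) +ℚ 2ℚ *ℚ sum (f ∘ π ∘ s))
        ≡⟨ cong (2ℚ *ℚ (sum (f ∘ π) -ℚ sum f) +ℚ_) (collect 2ℚ w (sum f) (sum (f ∘ π ∘ s))) ⟩
      2ℚ *ℚ (sum (f ∘ π) -ℚ sum f) +ℚ 2ℚ *ℚ (w *ℚ sum f +ℚ sum (f ∘ π ∘ s)) ∎
      where
      open ≡-Reasoning
      collect : ∀ t w x y → w *ℚ (t *ℚ x) +ℚ t *ℚ y ≡ t *ℚ (w *ℚ x +ℚ y)
      collect = solve-∀ ℚ-ring
      sum-c : (sum λ i → f (π (c i)) +ℚ f (π (c (next i)))) ≡ 2ℚ *ℚ sum f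
      sum-c = begin
        sum (λ i → f (π (c i)) +ℚ f (π (c (next i))))  ≡⟨ sum-cong-≗ (λ i → cong₂ (λ j j′ → f j +ℚ f j′) (π-c i) (π-c (next i))) ⟩
        sum (λ i → f i +ℚ f (next i))                  ≡⟨ ∑-distrib-+ f (f ∘ next) ⟩
        sum f +ℚ sum (f ∘ next)                        ≡⟨ cong (sum f +ℚ_) (sum-next f) ⟩
        sum f +ℚ sum f                                 ≡⟨ 2x≡x+x (sum f) ⟨
        2ℚ *ℚ sum f                                    ∎
      sum-s : (sum λ x → f (π (s x)) +ℚ f (π (t x))) ≡ 2ℚ *ℚ sum (f ∘ π ∘ s)
      sum-s = begin
        sum (λ x → f (π (s x)) +ℚ f (π (t x)))  ≡⟨ sum-cong-≗ (λ x → cong (λ i → f (π (s x)) +ℚ f i) (≡-sym (π-reach (detour x)))) ⟩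
        sum (λ x → f (π (s x)) +ℚ f (π (s x)))  ≡⟨ sum-cong-≗ (λ x → ≡-sym (2x≡x+x (f (π (s x))))) ⟩
        sum (λ x → 2ℚ *ℚ f (π (s x)))           ≡⟨ sum-* 2ℚ (f ∘ π ∘ s) ⟩
        2ℚ *ℚ sum (f ∘ π ∘ s)                   ∎

-- Enumeration of edges

listSum : ∀ {A : Set} → (A → ℚ) → List A → ℚ
listSum g []       = 0ℚ
listSum g (x ∷ xs) = g x +ℚ listSum g xs

module _ {A : Set} (g : A → ℚ) where

  sum-lookup : ∀ xs → sum (g ∘ lookup xs) ≡ listSum g xs
  sum-lookup []       = refl
  sum-lookup (x ∷ xs) = cong (g x +ℚ_) (sum-lookup xs)

  listSum-++ : ∀ xs ys → listSum g (xs ++ ys) ≡ listSum g xs +ℚ listSum g ys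
  listSum-++ []       ys = ≡-sym (ℚ.+-identityˡ (listSum g ys))
  listSum-++ (x ∷ xs) ys = trans (cong (g x +ℚ_) (listSum-++ xs ys)) (≡-sym (ℚ.+-assoc (g x) (listSum g xs) (listSum g ys)))

  listSum-filter : ∀ {P : A → Set} (P? : ∀ x → Dec (P x)) xs →
                   listSum g (filter P? xs) ≡ listSum (λ x → b2ℚ (does (P? x)) *ℚ g x) xs
  listSum-filter P? []       = refl
  listSum-filter P? (x ∷ xs) with does (P? x)
  ... | true  = cong₂ _+ℚ_ (≡-sym (ℚ.*-identityˡ (g x))) (listSum-filter P? xs)
  ... | false = trans (listSum-filter P? xs) (≡-sym (trans (cong (_+ℚ rest) (ℚ.*-zeroˡ (g x))) (ℚ.+-identityˡ rest)))
    where
    rest : ℚ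
    rest = listSum (λ x → b2ℚ (does (P? x)) *ℚ g x) xs

listSum-tabulate : ∀ {A : Set} (g : A → ℚ) {n} (f : Fin n → A) → listSum g (tabulate f) ≡ sum (g ∘ f)
listSum-tabulate g {zero}  f = refl
listSum-tabulate g {suc n} f = cong (g (f zero) +ℚ_) (listSum-tabulate g (f ∘ suc))

listSum-map : ∀ {A B : Set} (g : B → ℚ) (f : A → B) xs → listSum g (map f xs) ≡ listSum (g ∘ f) xs
listSum-map g f []       = refl
listSum-map g f (x ∷ xs) = cong (g (f x) +ℚ_) (listSum-map g f xs)

listSum-product : ∀ {A B : Set} (g : A × B → ℚ) xs ys →
                  listSum g (cartesianProduct xs ys) ≡ listSum (λ x → listSum (λ y → g (x , y)) ys) xs
listSum-product g []       ys = refl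
listSum-product g (x ∷ xs) ys = trans (listSum-++ g (map (x ,_) ys) (cartesianProduct xs ys))
  (cong₂ _+ℚ_ (listSum-map g (x ,_) ys) (listSum-product g xs ys))

listSum-allPairs : ∀ {n} (g : Fin n × Fin n → ℚ) → listSum g (cartesianProduct (allFin n) (allFin n)) ≡ sum₂ λ u v → g (u , v)
listSum-allPairs {n} g = trans (listSum-product g (allFin n) (allFin n)) (trans (listSum-tabulate _ {n} id)
  (sum-cong-≗ λ u → listSum-tabulate (λ v → g (u , v)) id))

δ-sym : ∀ {n} (i j : Fin n) → δ i j ≡ δ j i
δ-sym i j = go (i ≟ j)
  where
  go : Dec (i ≡ j) → δ i j ≡ δ j i
  go (yes refl) = refl
  go (no  i≢j)  = trans (δ-≢ i≢j) (≡-sym (δ-≢ (i≢j ∘ ≡-sym)))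

-- Summing over the bridges as blocks requires indexing them by a `Fin`. Each edge is listed once,
-- directed from its smaller to its larger end.
module EdgeList {n} (G : Graph n) where

  Forward : Fin n × Fin n → Set
  Forward (u , v) = toℕ u ℕ.< toℕ v × adj G u v ≡ true

  forward? : ∀ e → Dec (Forward e)
  forward? (u , v) = (toℕ u ℕ.<? toℕ v) ×-dec (adj G u v Bool.≟ true)

  abstract
    edges : List (Fin n × Fin n)
    edges = filter forward? (cartesianProduct (allFin n) (allFin n))

    edge-forward : ∀ j → Forward (lookup edges j)
    edge-forward j = All.lookup (All.all-filter forward? (cartesianProduct (allFin n) (allFin n))) (∈-lookup j)

    listSum-edges : ∀ g → listSum g edges ≡ sum₂ λ u v → b2ℚ (does (forward? (u , v))) *ℚ g (u , v)
    listSum-edges g = trans (listSum-filter g forward? (cartesianProduct (allFin n) (allFin n)))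
      (listSum-allPairs λ e → b2ℚ (does (forward? e)) *ℚ g e)

  source target : Fin (length edges) → Fin n
  source j = proj₁ (lookup edges j)
  target j = proj₂ (lookup edges j)

  edge-adj : ∀ j → adj G (source j) (target j) ≡ true
  edge-adj j = proj₂ (edge-forward j)

  source≢target : ∀ j → source j ≢ target j
  source≢target j = adj⇒≢ G (edge-adj j)

  forward-weight : ∀ u v → b2ℚ (does (forward? (u , v))) ≡ τ u v *ℚ weight G u v
  forward-weight u v with toℕ u ℕ.<ᵇ toℕ v | adj G u v
  ... | true  | true  = refl
  ... | true  | false = refl
  ... | false | true  = refl
  ... | false | false = refl

  weight-τ : ∀ a b → τ a b *ℚ weight G a b +ℚ τ b a *ℚ weight G b a ≡ weight G a b
  weight-τ a b = trans (cong (λ x → τ a b *ℚ weight G a b +ℚ τ b a *ℚ x) (weight-sym G b a))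
    (trans (≡-sym (ℚ.*-distribʳ-+ (weight G a b) (τ a b) (τ b a))) total)
    where
    total : (τ a b +ℚ τ b a) *ℚ weight G a b ≡ weight G a b
    total with τ-trichotomy a b
    ... | inj₂ eq   = trans (cong (_*ℚ weight G a b) eq) (ℚ.*-identityˡ (weight G a b))
    ... | inj₁ refl = trans (≡0-*ʳ (τ a a +ℚ τ a a) no-loop) (≡-sym no-loop)
      where
      no-loop : weight G a a ≡ 0ℚ
      no-loop = cong b2ℚ (irrefl G a)

  sum-edges : ∀ a b → sum (λ j → char (edge (source j) (target j)) a b) ≡ weight G a b
  sum-edges a b = begin
    sum (λ j → char (edge (source j) (target j)) a b)
      ≡⟨ sum-cong-≗ (λ j → char-edge (source≢target j) a b) ⟩
    sum (g ∘ lookup edges)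
      ≡⟨ trans (sum-lookup g edges) (listSum-edges g) ⟩
    sum₂ (λ u v → b2ℚ (does (forward? (u , v))) *ℚ g (u , v))
      ≡⟨ sum₂-cong (λ u v → trans (cong (_*ℚ g (u , v)) (forward-weight u v)) (trans (distrib (τ u v *ℚ weight G u v) (δ u a) (δ v b) (δ v a) (δ u b))
           (cong₂ _+ℚ_ (cong₂ (λ x y → (x *ℚ y) *ℚ ω u v) (δ-sym u a) (δ-sym v b)) (cong₂ (λ x y → (x *ℚ y) *ℚ ω u v) (δ-sym u b) (δ-sym v a))))) ⟩
    sum₂ (λ u v → (δ a u *ℚ δ b v) *ℚ ω u v +ℚ (δ b u *ℚ δ a v) *ℚ ω u v)
      ≡⟨ sum₂-+ (λ u v → (δ a u *ℚ δ b v) *ℚ ω u v) (λ u v → (δ b u *ℚ δ a v) *ℚ ω u v) ⟩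
    _ ≡⟨ cong₂ _+ℚ_ (sum₂-δ a b ω) (sum₂-δ b a ω) ⟩
    τ a b *ℚ weight G a b +ℚ τ b a *ℚ weight G b a
      ≡⟨ weight-τ a b ⟩
    weight G a b ∎
    where
    open ≡-Reasoning
    g : Fin n × Fin n → ℚ
    g (u , v) = δ u a *ℚ δ v b +ℚ δ v a *ℚ δ u b
    ω : Fin n → Fin n → ℚ
    ω u v = τ u v *ℚ weight G u v
    distrib : ∀ w p q r s → w *ℚ (p *ℚ q +ℚ r *ℚ s) ≡ (p *ℚ q) *ℚ w +ℚ (s *ℚ r) *ℚ w
    distrib = solve-∀ ℚ-ring

  sum₂-weight : sum₂ (weight G) ≡ 2ℚ *ℚ ℕ→ℚ (length edges)
  sum₂-weight = begin
    sum₂ (weight G)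
      ≡⟨ sum₂-cong (λ a b → trans (≡-sym (sum-edges a b)) (sum-cong-≗ λ j → ≡-sym (ℚ.*-identityʳ (char (edge (source j) (target j)) a b)))) ⟩
    sum (λ a → sum₂ λ b j → char (edge (source j) (target j)) a b *ℚ 1ℚ)
      ≡⟨ sum-cong-≗ (λ a → ∑-comm λ b j → char (edge (source j) (target j)) a b *ℚ 1ℚ) ⟩
    sum (λ a → sum λ j → sum λ b → char (edge (source j) (target j)) a b *ℚ 1ℚ)
      ≡⟨ ∑-comm (λ a j → sum λ b → char (edge (source j) (target j)) a b *ℚ 1ℚ) ⟩
    sum (λ j → sum₂ λ a b → char (edge (source j) (target j)) a b *ℚ 1ℚ)
      ≡⟨ sum-cong-≗ (λ j → sum₂-edge (source≢target j) (λ _ _ → 1ℚ)) ⟩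
    sum {length edges} (λ _ → 2ℚ)
      ≡⟨ sum-const {length edges} 2ℚ ⟩
    2ℚ *ℚ ℕ→ℚ (length edges) ∎
    where open ≡-Reasoning

-- Bicyclic graphs

pair : ∀ {n} → Fin n → Fin n → Fin 2 → Fin n
pair u v zero    = u
pair u v (suc _) = v

pair-injective : ∀ {n} {u v : Fin n} → u ≢ v → Injective _≡_ _≡_ (pair u v)
pair-injective u≢v {zero}     {zero}     eq = refl
pair-injective u≢v {zero}     {suc _}    eq = contradiction eq u≢v
pair-injective u≢v {suc _}    {zero}     eq = contradiction (≡-sym eq) u≢v
pair-injective u≢v {suc zero} {suc zero} eq = refl

char-edge-pair : ∀ {n} {u v : Fin n} → u ≢ v → ∀ a b → char (edge u v) a b ≡ ½ *ℚ cycleWeight (pair u v) a b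
char-edge-pair {u = u} {v} u≢v a b = trans (char-edge u≢v a b) (twice (δ u a) (δ v b) (δ v a) (δ u b))
  where
  twice : ∀ p q r s → p *ℚ q +ℚ r *ℚ s ≡ ½ *ℚ ((p *ℚ q +ℚ r *ℚ s) +ℚ ((r *ℚ s +ℚ p *ℚ q) +ℚ 0ℚ))
  twice = solve-∀ ℚ-ring

edge⇒image : ∀ {n} {u v a b : Fin n} → Mem (edge u v) a b → Image (pair u v) a × Image (pair u v) b
edge⇒image (inj₁ (eq , eq′)) = (zero , eq) , (suc zero , eq′)
edge⇒image (inj₂ (eq , eq′)) = (suc zero , eq′) , (zero , eq)

base : ∀ {k} → 3 ≤ k → Fin k
base 3≤k = fromℕ< (ℕ.≤-trans (s≤s z≤n) 3≤k)

toℕ-base : ∀ {k} (3≤k : 3 ≤ k) → toℕ (base 3≤k) ≡ 0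
toℕ-base 3≤k = toℕ-fromℕ< (ℕ.≤-trans (s≤s z≤n) 3≤k)

-- One edge is singled out on each cycle. Deleting the two anchors will leave a spanning tree, and
-- the anchors serve as the extra edges of the blocks.
module Anchor {n k} (G : Graph n) (C : Cycle G k) where
  cycle    = proj₁ C
  3≤k      = proj₁ (proj₂ C)
  cycle-injective = proj₁ (proj₂ (proj₂ C))
  adjacent = proj₂ (proj₂ (proj₂ C))
  i₀       = base 3≤k
  s        = cycle i₀
  t        = cycle (next i₀)
  anchor   = edge s t
  E        = cycleEdges cycle
  s≢t : s ≢ t
  s≢t = adj⇒≢ G (adjacent i₀)
  anchor⊆E : ∀ {a b} → Mem anchor a b → Mem E a b
  anchor⊆E m = i₀ , m
  detour : ∀ {H : Graph n} → (∀ {a b} → adj G a b ≡ true → Mem E a b → ¬ Mem anchor a b → adj H a b ≡ true) → Reach H s t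
  detour H-adj = reach-sym (reach-around cycle i₀ (λ j j≢i₀ → H-adj (adjacent j) (j , inj₁ (refl , refl))
    λ m → j≢i₀ (≡-sym (cycle-edge-injective 3≤k cycle-injective i₀ j m))) i₀)

-- Follow a walk of `T` towards `c i` and stop at the first edge not known to lie in `H`; that edge
-- starts in the image of `c`.
reach-image : ∀ {n k} {T H : Graph n} (c : Fin k → Fin n) (i : Fin k) → Connected T →
              (∀ {a b} → adj T a b ≡ true → Image c a ⊎ adj H a b ≡ true) → ∀ v → ∃ λ j → Reach H v (c j)
reach-image {T = T} {H} c i connected T⊆H v = along (connected v (c i))
  where
  along : ∀ {v} → Reach T v (c i) → ∃ λ j → Reach H v (c j)
  along here = i , here
  along (step e r) with T⊆H e
  ... | inj₁ (j , refl) = j , here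
  ... | inj₂ e′ with along r
  ...   | j , r′ = j , step e′ r′

module SpanningTree {n} (G : Graph n) (connected : Connected G) {p q} (C : Cycle G p) (D : Cycle G q)
                    (disjoint : ∀ {a b} → Mem (cycleEdges (proj₁ C)) a b → ¬ Mem (cycleEdges (proj₁ D)) a b) where

  private
    module C = Anchor G C
    module D = Anchor G D

  T : Graph n
  T = G ∖ C.anchor ∖ D.anchor

  -- Edge-disjointness keeps the second cycle intact when the first anchor is deleted, so each
  -- anchor has a detour at the time of its deletion.
  T-connected : Connected T
  T-connected u v = reach-∖-edge (D.detour λ e m ¬m → ∖-adj⁺ (G ∖ C.anchor) D.anchor (∖-adj⁺ G C.anchor e λ m′ → disjoint (C.anchor⊆E m′) m) ¬m)
    (reach-∖-edge (C.detour λ e m ¬m → ∖-adj⁺ G C.anchor e ¬m) (connected u v))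

  T-adj : ∀ {a b} → adj T a b ≡ true → adj G a b ≡ true × ¬ Mem C.anchor a b × ¬ Mem D.anchor a b
  T-adj e with ∖-adj⁻ (G ∖ C.anchor) D.anchor e
  ... | e′ , ¬m with ∖-adj⁻ G C.anchor e′
  ...   | e″ , ¬m′ = e″ , ¬m′ , ¬m

  weight-T : ∀ a b → weight G a b ≡ weight T a b +ℚ (char D.anchor a b +ℚ char C.anchor a b)
  weight-T a b = trans (∖-weight G C.anchor (edge⊆ G (C.adjacent C.i₀)) a b)
    (trans (cong (_+ℚ char C.anchor a b) (∖-weight (G ∖ C.anchor) D.anchor (λ m →
      ∖-adj⁺ G C.anchor (edge⊆ G (D.adjacent D.i₀) m) λ m′ → disjoint (C.anchor⊆E m′) (D.anchor⊆E m)) a b))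
    (ℚ.+-assoc (weight T a b) (char D.anchor a b) (char C.anchor a b)))

  -- The connected graph `T` has at least n-1 edges, to which the two anchors are added. This gives
  -- the lower half of the edge count of $S_n^{p,q}$.
  size-bound : Fin n → 2ℚ *ℚ (1ℚ +ℚ ℕ→ℚ n) ≤ℚ sum₂ (weight G)
  size-bound o = subst₂ _≤ℚ_ (grow (ℕ→ℚ n)) (≡-sym total)
    (ℚ.+-monoˡ-≤ (2ℚ +ℚ 2ℚ) (Forest.forest-bound T {1} (λ _ → o) (λ { {zero} {zero} _ → refl }) λ v → zero , T-connected v o))
    where
    grow : ∀ x → (1ℚ +ℚ 1ℚ) *ℚ (x -ℚ 1ℚ) +ℚ ((1ℚ +ℚ 1ℚ) +ℚ (1ℚ +ℚ 1ℚ)) ≡ (1ℚ +ℚ 1ℚ) *ℚ (1ℚ +ℚ x)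
    grow = solve-∀ ℚ-ring
    total : sum₂ (weight G) ≡ sum₂ (weight T) +ℚ (2ℚ +ℚ 2ℚ)
    total = trans (sum₂-cong weight-T) (trans (sum₂-+ (weight T) λ a b → char D.anchor a b +ℚ char C.anchor a b)
      (cong (sum₂ (weight T) +ℚ_) (trans (sum₂-+ (char D.anchor) (char C.anchor)) (cong₂ _+ℚ_ (sum₂-char D.s≢t) (sum₂-char C.s≢t)))))

module Bicyclic {n} (G : Graph n) (connected : Connected G) (size : sum₂ (weight G) ≡ 2ℚ *ℚ (1ℚ +ℚ ℕ→ℚ n))
                {p q} (C : Cycle G p) (D : Cycle G q)
                (disjoint : ∀ {a b} → Mem (cycleEdges (proj₁ C)) a b → ¬ Mem (cycleEdges (proj₁ D)) a b) where

  private
    module C = Anchor G C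
    module D = Anchor G D

  open SpanningTree G connected C D disjoint

  abstract
    -- Deleting the `p` edges of `C` and the anchor of `D` leaves n - p edges. The rest of `D`
    -- shares no edge with `C` and is the detour of its anchor.
    cycle-isBlock : IsBlock G 1ℚ C.cycle (λ (_ : Fin 1) → D.s)
    cycle-isBlock = BlockFromForest.isBlock G size 1ℚ (ℚ.positive⁻¹ 1ℚ) C.cycle C.cycle-injective C.E (cycle⊆ G C) (cycle-edge⇒image C.cycle)
      (λ a b → trans (char-cycleEdges C.3≤k C.cycle-injective a b) (≡-sym (ℚ.*-identityˡ (cycleWeight C.cycle a b))))
      (λ (_ : Fin 1) → D.s) (λ _ → D.t) (λ _ → D.s≢t) (euler (ℕ→ℚ p)) H weight-G
      (reach-image C.cycle C.i₀ T-connected T⊆H) (λ _ → D.detour D-step)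
      where
      H : Graph n
      H = G ∖ C.E ∖ D.anchor
      euler : ∀ x → 1ℚ +ℚ x ≡ 1ℚ *ℚ x +ℚ 1ℚ
      euler = solve-∀ ℚ-ring
      assoc : ∀ x y z → (x +ℚ y) +ℚ z ≡ x +ℚ (z +ℚ (y +ℚ 0ℚ))
      assoc = solve-∀ ℚ-ring
      weight-G : ∀ a b → weight G a b ≡ weight H a b +ℚ (char C.E a b +ℚ (char D.anchor a b +ℚ 0ℚ))
      weight-G a b = trans (∖-weight G C.E (cycle⊆ G C) a b)
        (trans (cong (_+ℚ char C.E a b) (∖-weight (G ∖ C.E) D.anchor (λ m →
          ∖-adj⁺ G C.E (edge⊆ G (D.adjacent D.i₀) m) λ m′ → disjoint m′ (D.anchor⊆E m)) a b))
        (assoc (weight H a b) (char D.anchor a b) (char C.E a b)))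
      T⊆H : ∀ {a b} → adj T a b ≡ true → Image C.cycle a ⊎ adj H a b ≡ true
      T⊆H {a} {b} e with toSum (mem? C.E a b)
      ... | inj₁ m  = inj₁ (proj₁ (cycle-edge⇒image C.cycle m))
      ... | inj₂ ¬m = inj₂ (∖-adj⁺ (G ∖ C.E) D.anchor (∖-adj⁺ G C.E (proj₁ (T-adj e)) ¬m) (proj₂ (proj₂ (T-adj e))))
      D-step : ∀ {a b} → adj G a b ≡ true → Mem D.E a b → ¬ Mem D.anchor a b → adj H a b ≡ true
      D-step e m ¬m = ∖-adj⁺ (G ∖ C.E) D.anchor (∖-adj⁺ G C.E e λ m′ → disjoint m′ m) ¬m

  Q : Graph n
  Q = G ∖ C.E ∖ D.E

  Q-adj : ∀ {a b} → adj Q a b ≡ true → adj G a b ≡ true × ¬ Mem C.E a b × ¬ Mem D.E a b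
  Q-adj e with ∖-adj⁻ (G ∖ C.E) D.E e
  ... | e′ , ¬m with ∖-adj⁻ G C.E e′
  ...   | e″ , ¬m′ = e″ , ¬m′ , ¬m

  weight-Q : ∀ a b → weight G a b ≡ char C.E a b +ℚ (char D.E a b +ℚ weight Q a b)
  weight-Q a b = trans (∖-weight G C.E (cycle⊆ G C) a b)
    (trans (cong (_+ℚ char C.E a b) (∖-weight (G ∖ C.E) D.E (λ m → ∖-adj⁺ G C.E (cycle⊆ G D m) λ m′ → disjoint m′ m) a b))
    (assoc (weight Q a b) (char D.E a b) (char C.E a b)))
    where
    assoc : ∀ x y z → (x +ℚ y) +ℚ z ≡ z +ℚ (y +ℚ x)
    assoc = solve-∀ ℚ-ring

  abstract
    -- An edge off both cycles is a bridge: without it and the two anchors n-2 edges remain, while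
    -- every vertex still reaches `u` or `v`. Hence there are exactly two trees.
    bridge-isBlock : ∀ {u v} → adj Q u v ≡ true → IsBlock G ½ (pair u v) (pair C.s D.s)
    bridge-isBlock {u} {v} Quv = BlockFromForest.isBlock G size ½ (ℚ.positive⁻¹ ½) (pair u v) (pair-injective u≢v) uv (edge⊆ G e) edge⇒image
      (char-edge-pair u≢v) (pair C.s D.s) (pair C.t D.t) (λ { zero → C.s≢t ; (suc zero) → D.s≢t }) refl H weight-G
      (reach-image (pair u v) zero T-connected T⊆H) (λ { zero → C.detour C-step ; (suc zero) → D.detour D-step })
      where
      e : adj G u v ≡ true
      e = proj₁ (Q-adj Quv)
      u≢v : u ≢ v
      u≢v = adj⇒≢ G e
      uv : EdgeSet n
      uv = edge u v
      H : Graph n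
      H = G ∖ uv ∖ C.anchor ∖ D.anchor
      transport : ∀ (E : EdgeSet n) {a b} → Mem uv a b → Mem E a b → Mem E u v
      transport E (inj₁ (refl , refl)) m = m
      transport E (inj₂ (refl , refl)) m = mem-sym E m
      ∉C : ∀ {a b} → Mem uv a b → ¬ Mem C.E a b
      ∉C m m′ = proj₁ (proj₂ (Q-adj Quv)) (transport C.E m m′)
      ∉D : ∀ {a b} → Mem uv a b → ¬ Mem D.E a b
      ∉D m m′ = proj₂ (proj₂ (Q-adj Quv)) (transport D.E m m′)
      H-adj⁺ : ∀ {a b} → adj G a b ≡ true → ¬ Mem uv a b → ¬ Mem C.anchor a b → ¬ Mem D.anchor a b → adj H a b ≡ true
      H-adj⁺ e ¬m ¬m′ ¬m″ = ∖-adj⁺ (G ∖ uv ∖ C.anchor) D.anchor (∖-adj⁺ (G ∖ uv) C.anchor (∖-adj⁺ G uv e ¬m) ¬m′) ¬m″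
      C-step : ∀ {a b} → adj G a b ≡ true → Mem C.E a b → ¬ Mem C.anchor a b → adj H a b ≡ true
      C-step e m ¬m = H-adj⁺ e (λ m′ → ∉C m′ m) ¬m (λ m′ → disjoint m (D.anchor⊆E m′))
      D-step : ∀ {a b} → adj G a b ≡ true → Mem D.E a b → ¬ Mem D.anchor a b → adj H a b ≡ true
      D-step e m ¬m = H-adj⁺ e (λ m′ → ∉D m′ m) (λ m′ → disjoint (C.anchor⊆E m′) m) ¬m
      T⊆H : ∀ {a b} → adj T a b ≡ true → Image (pair u v) a ⊎ adj H a b ≡ true
      T⊆H {a} {b} e with toSum (mem? uv a b)
      ... | inj₁ m  = inj₁ (proj₁ (edge⇒image m))
      ... | inj₂ ¬m = inj₂ (H-adj⁺ (proj₁ (T-adj e)) ¬m (proj₁ (proj₂ (T-adj e))) (proj₂ (proj₂ (T-adj e))))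
      assoc : ∀ x y z w → ((x +ℚ y) +ℚ z) +ℚ w ≡ x +ℚ (w +ℚ (z +ℚ (y +ℚ 0ℚ)))
      assoc = solve-∀ ℚ-ring
      weight-G : ∀ a b → weight G a b ≡ weight H a b +ℚ (char uv a b +ℚ (char C.anchor a b +ℚ (char D.anchor a b +ℚ 0ℚ)))
      weight-G a b = trans (∖-weight G uv (edge⊆ G e) a b) (trans (cong (_+ℚ char uv a b)
        (trans (∖-weight (G ∖ uv) C.anchor (λ m → ∖-adj⁺ G uv (edge⊆ G (C.adjacent C.i₀) m) λ m′ → ∉C m′ (C.anchor⊆E m)) a b)
          (cong (_+ℚ char C.anchor a b) (∖-weight (G ∖ uv ∖ C.anchor) D.anchor (λ m → ∖-adj⁺ (G ∖ uv) C.anchor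
            (∖-adj⁺ G uv (edge⊆ G (D.adjacent D.i₀) m) λ m′ → ∉D m′ (D.anchor⊆E m)) λ m′ → disjoint (C.anchor⊆E m′) (D.anchor⊆E m)) a b))))
        (assoc (weight H a b) (char D.anchor a b) (char C.anchor a b) (char uv a b)))

-- The common interface of `G` and $S_n^{p,q}$. Edge-disjointness and the edge count stand in for
-- having exactly two cycles.
record BicyclicGraph (n p q : ℕ) : Set where
  field
    graph     : Graph n
    connected : Connected graph
    size      : sum₂ (weight graph) ≡ 2ℚ *ℚ (1ℚ +ℚ ℕ→ℚ n)
    C         : Cycle graph p
    D         : Cycle graph q
    disjoint  : ∀ {a b} → Mem (cycleEdges (proj₁ C)) a b → ¬ Mem (cycleEdges (proj₁ D)) a b

  open Bicyclic graph connected size C D disjoint public using (cycle-isBlock; bridge-isBlock; Q; Q-adj; weight-Q)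
  open Bicyclic graph connected size D C (λ m m′ → disjoint m′ m) public using () renaming (cycle-isBlock to cycle-isBlock′)
  open EdgeList Q public using (edges; source; target; edge-adj; source≢target; sum-edges; sum₂-weight)

  c : Fin p → Fin n
  c = proj₁ C

  d : Fin q → Fin n
  d = proj₁ D

  blockCount : ℕ
  blockCount = suc (suc (length edges))

  blocks : Fin blockCount → Block graph
  blocks zero          = record { isBlock = cycle-isBlock }
  blocks (suc zero)    = record { isBlock = cycle-isBlock′ }
  blocks (suc (suc j)) = record { isBlock = bridge-isBlock (edge-adj j) }

  char-C : ∀ a b → char (cycleEdges c) a b ≡ cycleWeight c a b
  char-C = char-cycleEdges (proj₁ (proj₂ C)) (proj₁ (proj₂ (proj₂ C)))

  char-D : ∀ a b → char (cycleEdges d) a b ≡ cycleWeight d a b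
  char-D = char-cycleEdges (proj₁ (proj₂ D)) (proj₁ (proj₂ (proj₂ D)))

  cover : ∀ a b → sum (λ j → blockWeight (Block.w (blocks j)) (Block.c (blocks j)) a b) ≡ weight graph a b
  cover a b = trans (cong₂ _+ℚ_ (trans (ℚ.*-identityˡ (cycleWeight c a b)) (≡-sym (char-C a b)))
      (cong₂ _+ℚ_ (trans (ℚ.*-identityˡ (cycleWeight d a b)) (≡-sym (char-D a b)))
        (trans (sum-cong-≗ λ j → ≡-sym (char-edge-pair (source≢target j) a b)) (sum-edges a b))))
    (≡-sym (weight-Q a b))

  open Decomposition connected blocks cover public using (project; telescope; DR-excess)

  -- There are n+1-p-q bridges, whatever the graph, so both graphs have equally many bridge blocks.
  edge-count : 2ℚ *ℚ ℕ→ℚ (length edges) ≡ (2ℚ *ℚ (1ℚ +ℚ ℕ→ℚ n)) -ℚ (2ℚ *ℚ ℕ→ℚ p +ℚ 2ℚ *ℚ ℕ→ℚ q)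
  edge-count = begin
    2ℚ *ℚ ℕ→ℚ (length edges)      ≡⟨ sum₂-weight ⟨
    sum₂ (weight Q)               ≡⟨ isolate (2ℚ *ℚ ℕ→ℚ p) (2ℚ *ℚ ℕ→ℚ q) (sum₂ (weight Q)) ⟨
    (2ℚ *ℚ ℕ→ℚ p +ℚ (2ℚ *ℚ ℕ→ℚ q +ℚ sum₂ (weight Q))) -ℚ (2ℚ *ℚ ℕ→ℚ p +ℚ 2ℚ *ℚ ℕ→ℚ q)
                                  ≡⟨ cong (_-ℚ (2ℚ *ℚ ℕ→ℚ p +ℚ 2ℚ *ℚ ℕ→ℚ q)) total ⟩
    _                             ∎
    where
    open ≡-Reasoning
    isolate : ∀ x y z → (x +ℚ (y +ℚ z)) -ℚ (x +ℚ y) ≡ z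
    isolate = solve-∀ ℚ-ring
    sum₂-cycle : ∀ {k} (c : Fin k → Fin n) → sum₂ (cycleWeight c) ≡ 2ℚ *ℚ ℕ→ℚ k
    sum₂-cycle {k} c = trans (sum₂-cong λ a b → ≡-sym (ℚ.*-identityʳ (cycleWeight c a b)))
      (trans (sum₂-cycleWeight c (λ _ _ → 1ℚ)) (sum-const {k} 2ℚ))
    total : 2ℚ *ℚ ℕ→ℚ p +ℚ (2ℚ *ℚ ℕ→ℚ q +ℚ sum₂ (weight Q)) ≡ 2ℚ *ℚ (1ℚ +ℚ ℕ→ℚ n)
    total = begin
      2ℚ *ℚ ℕ→ℚ p +ℚ (2ℚ *ℚ ℕ→ℚ q +ℚ sum₂ (weight Q))
        ≡⟨ cong₂ (λ x y → x +ℚ (y +ℚ sum₂ (weight Q))) (sum₂-cycle c) (sum₂-cycle d) ⟨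
      sum₂ (cycleWeight c) +ℚ (sum₂ (cycleWeight d) +ℚ sum₂ (weight Q))
        ≡⟨ cong₂ (λ x y → x +ℚ (y +ℚ sum₂ (weight Q))) (sum₂-cong char-C) (sum₂-cong char-D) ⟨
      sum₂ (char (cycleEdges c)) +ℚ (sum₂ (char (cycleEdges d)) +ℚ sum₂ (weight Q))
        ≡⟨ cong (sum₂ (char (cycleEdges c)) +ℚ_) (sum₂-+ (char (cycleEdges d)) (weight Q)) ⟨
      sum₂ (char (cycleEdges c)) +ℚ sum₂ (λ a b → char (cycleEdges d) a b +ℚ weight Q a b)
        ≡⟨ sum₂-+ (char (cycleEdges c)) (λ a b → char (cycleEdges d) a b +ℚ weight Q a b) ⟨
      sum₂ (λ a b → char (cycleEdges c) a b +ℚ (char (cycleEdges d) a b +ℚ weight Q a b))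
        ≡⟨ sum₂-cong weight-Q ⟨
      sum₂ (weight graph)
        ≡⟨ size ⟩
      2ℚ *ℚ (1ℚ +ℚ ℕ→ℚ n) ∎

-- Comparison of baselines and excesses

resistance-sum-unique : ∀ {k w} → 0ℚ < w → {R R′ : Fin k → Fin k → ℚ} →
                        IsResistance w R → IsResistance w R′ → ∀ i j → sum (R i) ≡ sum (R′ j)
resistance-sum-unique w>0 isR isR′ i j = trans (resistance-sum-constant w>0 isR i j) (sum-cong-≗ (resistance-unique w>0 isR isR′ j))

-- Testing the flow against `δ zero` shows a unit drop across the bridge. With this constant the
-- bridges of two graphs can be compared by their number alone.
bridge-resistance-sum : {R : Fin 2 → Fin 2 → ℚ} → IsResistance ½ R → ∀ i → sum (R i) ≡ 1ℚ
bridge-resistance-sum {R} isR i with isR zero (suc zero)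
... | x , ux , eq = begin
  sum (R i)                                  ≡⟨ resistance-sum-constant ½>0 isR i zero ⟩
  R zero zero +ℚ (R zero (suc zero) +ℚ 0ℚ)   ≡⟨ cong₂ (λ a b → a +ℚ (b +ℚ 0ℚ)) (resistance-refl ½>0 isR zero) (trans eq (trans (flow (x zero) (x (suc zero))) (ux (δ zero)))) ⟩
  0ℚ +ℚ (1ℚ +ℚ 0ℚ)                           ≡⟨⟩
  1ℚ                                         ∎
  where
  open ≡-Reasoning
  ½>0 : 0ℚ < ½
  ½>0 = ℚ.positive⁻¹ ½
  flow : ∀ p q → p -ℚ q ≡ ½ *ℚ ((p -ℚ q) *ℚ (1ℚ -ℚ 0ℚ) +ℚ ((q -ℚ p) *ℚ (0ℚ -ℚ 1ℚ) +ℚ 0ℚ))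
  flow = solve-∀ ℚ-ring

module Baselines {n p q} (X : BicyclicGraph n p q) {φ} (pot : Potentials (BicyclicGraph.graph X) φ) (o : Fin n) where
  open BicyclicGraph X

  module BR j = BlockResistance pot (blocks j) o

  bridge-baseline : ℚ
  bridge-baseline = 2ℚ *ℚ (((ℕ→ℚ n -ℚ ℕ→ℚ 2) +ℚ ½ *ℚ ℕ→ℚ n +ℚ ℕ→ℚ 2) *ℚ 1ℚ)

  sum-baseline : sum BR.baseline ≡ BR.baseline zero +ℚ (BR.baseline (suc zero) +ℚ bridge-baseline *ℚ ℕ→ℚ (length edges))
  sum-baseline = cong (λ x → BR.baseline zero +ℚ (BR.baseline (suc zero) +ℚ x)) (trans (sum-cong-≗ each) (sum-const {length edges} bridge-baseline))
    where
    each : ∀ j → BR.baseline (suc (suc j)) ≡ bridge-baseline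
    each j = cong (λ r → 2ℚ *ℚ (((ℕ→ℚ n -ℚ ℕ→ℚ 2) +ℚ ½ *ℚ ℕ→ℚ n +ℚ ℕ→ℚ 2) *ℚ r))
      (bridge-resistance-sum (BR.isResistance (suc (suc j))) (Block.π (blocks (suc (suc j))) o))

module _ {n p q} (X Y : BicyclicGraph n p q) {φ ψ} (potX : Potentials (BicyclicGraph.graph X) φ)
         (potY : Potentials (BicyclicGraph.graph Y) ψ) (o : Fin n) where
  private
    module X = BicyclicGraph X
    module Y = BicyclicGraph Y
    module BX = Baselines X potX o
    module BY = Baselines Y potY o

  -- Cycle blocks of equal length have equal row sums by uniqueness of resistances, and the bridges
  -- contribute one constant times their common number.
  baselines-agree : sum BX.BR.baseline ≡ sum BY.BR.baseline
  baselines-agree = begin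
    sum BX.BR.baseline   ≡⟨ BX.sum-baseline ⟩
    _                    ≡⟨ cong₂ _+ℚ_ C-agree (cong₂ _+ℚ_ D-agree (cong (BX.bridge-baseline *ℚ_) (2x≡2y⇒x≡y (trans X.edge-count (≡-sym Y.edge-count))))) ⟩
    _                    ≡⟨ BY.sum-baseline ⟨
    sum BY.BR.baseline   ∎
    where
    open ≡-Reasoning
    C-agree : BX.BR.baseline zero ≡ BY.BR.baseline zero
    C-agree = cong (λ r → 2ℚ *ℚ (((ℕ→ℚ n -ℚ ℕ→ℚ p) +ℚ 1ℚ *ℚ ℕ→ℚ n +ℚ ℕ→ℚ 1) *ℚ r))
      (resistance-sum-unique (ℚ.positive⁻¹ 1ℚ) (BX.BR.isResistance zero) (BY.BR.isResistance zero) (Block.π (X.blocks zero) o) (Block.π (Y.blocks zero) o))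
    D-agree : BX.BR.baseline (suc zero) ≡ BY.BR.baseline (suc zero)
    D-agree = cong (λ r → 2ℚ *ℚ (((ℕ→ℚ n -ℚ ℕ→ℚ q) +ℚ 1ℚ *ℚ ℕ→ℚ n +ℚ ℕ→ℚ 1) *ℚ r))
      (resistance-sum-unique (ℚ.positive⁻¹ 1ℚ) (BX.BR.isResistance (suc zero)) (BY.BR.isResistance (suc zero)) (Block.π (X.blocks (suc zero)) o) (Block.π (Y.blocks (suc zero)) o))

  excess-vanishes : (∀ j → BY.BR.excess j ≡ 0ℚ) → DR X.graph φ ≤ℚ DR Y.graph ψ → ∀ j → BX.BR.excess j ≡ 0ℚ
  excess-vanishes Y-excess X≤Y = sum≤0⇒≡0 BX.BR.excess-≥0 (cancel {sum BX.BR.baseline} (subst₂ _≤ℚ_ (X.DR-excess potX o)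
      (trans (Y.DR-excess potY o) (cong₂ _+ℚ_ (≡-sym baselines-agree) (sum-0 Y-excess))) X≤Y))
    where
    cancel : ∀ {a x y} → a +ℚ x ≤ℚ a +ℚ y → x ≤ℚ y
    cancel {a} {x} {y} le = subst₂ _≤ℚ_ (drop a x) (drop a y) (ℚ.+-monoʳ-≤ (⊖ a) le)
      where
      drop : ∀ a x → (⊖ a) +ℚ (a +ℚ x) ≡ x
      drop = solve-∀ ℚ-ring

-- The hypotheses climb say that the tree path from a vertex off a block to o can enter the block only at o.
module HangingAtRoot {n p q} (X : BicyclicGraph n p q) where
  open BicyclicGraph X

  module _
    (o : Fin n) (parent : Fin n → Fin n) (parent-adj : ∀ {i} → i ≢ o → adj graph i (parent i) ≡ true)
    (tree-induction : (Pr : Fin n → Set) → Pr o → (∀ {i} → i ≢ o → Pr (parent i) → Pr i) → ∀ i → Pr i)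
    (c-base : ∀ 3≤p → c (base 3≤p) ≡ o) (d-base : ∀ 3≤q → d (base 3≤q) ≡ o)
    (climb-C : ∀ {i} → ¬ Image c i → Image c (parent i) → parent i ≡ o)
    (climb-D : ∀ {i} → ¬ Image d i → Image d (parent i) → parent i ≡ o)
    (climb-bridge : ∀ {u v i} → adj graph u v ≡ true → ¬ Mem (cycleEdges c) u v → ¬ Mem (cycleEdges d) u v →
                    Image (pair u v) (parent i) → parent i ≡ o)
    {φ} (pot : Potentials graph φ) where

    -- The invariant along tree paths from `o` is that a vertex is on the block or projects to the
    -- same block vertex as `o`. By `climb` the path can leave the block only at `o`, so vertices
    -- off the block satisfy the second alternative.
    block-excess : (B : Block graph) → (∀ {i} → ¬ Image (Block.c B) i → Image (Block.c B) (parent i) → parent i ≡ o) →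
                   (∀ x → Block.extra B x ≡ o) → BlockResistance.excess pot B o ≡ 0ℚ
    block-excess B climb extra≡o = BlockResistance.concentrated⇒excess≡0 pot B o (π o)
        (λ {v} ∉b → [ (λ ∈b → contradiction ∈b ∉b) , id ]′ (tree-induction (λ v → Image b v ⊎ π v ≡ π o) (inj₂ refl) ascend v))
        (λ x → cong π (extra≡o x))
      where
      open Block B using (π; split) renaming (c to b)
      ascend : ∀ {i} → i ≢ o → Image b (parent i) ⊎ π (parent i) ≡ π o → Image b i ⊎ π i ≡ π o
      ascend {i} i≢o hyp with toSum (image? b i) | split i (parent i)
      ... | inj₁ ∈b | _                    = inj₁ ∈b
      ... | inj₂ ∉b | inj₁ (eq , _)        = inj₂ (trans eq ([ (λ ∈b → cong π (climb ∉b ∈b)) , id ]′ hyp))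
      ... | inj₂ ∉b | inj₂ (inj₁ (∈b , _)) = contradiction ∈b ∉b
      ... | inj₂ ∉b | inj₂ (inj₂ (e , _)) with () ← trans (≡-sym e) (parent-adj i≢o)

    excess≡0 : ∀ j → BlockResistance.excess pot (blocks j) o ≡ 0ℚ
    excess≡0 zero          = block-excess (blocks zero) climb-C (λ _ → d-base (proj₁ (proj₂ D)))
    excess≡0 (suc zero)    = block-excess (blocks (suc zero)) climb-D (λ _ → c-base (proj₁ (proj₂ C)))
    excess≡0 (suc (suc j)) = block-excess (blocks (suc (suc j)))
      (λ _ → climb-bridge (proj₁ (Q-adj (edge-adj j))) (proj₁ (proj₂ (Q-adj (edge-adj j)))) (proj₂ (proj₂ (Q-adj (edge-adj j)))))
      (λ { zero → c-base (proj₁ (proj₂ C)) ; (suc zero) → d-base (proj₁ (proj₂ D)) })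

-- Edge-disjointness of the two cycles

sum₂-weight-numEdges : ∀ {n} (G : Graph n) → sum₂ (weight G) ≡ 2ℚ *ℚ ℕ→ℚ (numEdges G)
sum₂-weight-numEdges {n} G = begin
  sum₂ (weight G)                           ≡⟨ sum₂-cong (EdgeList.weight-τ G) ⟨
  sum₂ (λ a b → ω a b +ℚ ω b a)             ≡⟨ sum₂-+ ω (λ a b → ω b a) ⟩
  sum₂ ω +ℚ sum₂ (λ a b → ω b a)            ≡⟨ cong (sum₂ ω +ℚ_) (∑-comm λ a b → ω b a) ⟩
  sum₂ ω +ℚ sum₂ ω                          ≡⟨ 2x≡x+x (sum₂ ω) ⟨
  2ℚ *ℚ sum₂ ω                              ≡⟨ cong (2ℚ *ℚ_) count ⟨
  2ℚ *ℚ ℕ→ℚ (numEdges G)                    ∎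
  where
  open ≡-Reasoning
  ω : Fin n → Fin n → ℚ
  ω a b = τ a b *ℚ weight G a b
  b2ℚ-∧ : ∀ x y → b2ℚ (x ∧ y) ≡ b2ℚ x *ℚ b2ℚ y
  b2ℚ-∧ true  y = ≡-sym (ℚ.*-identityˡ (b2ℚ y))
  b2ℚ-∧ false y = ≡-sym (ℚ.*-zeroˡ (b2ℚ y))
  forward : Fin n → Fin n → Bool
  forward a b = (toℕ a ℕ.<ᵇ toℕ b) ∧ adj G a b
  count : ℕ→ℚ (numEdges G) ≡ sum₂ ω
  count = trans (ℕ→ℚ-sumℕ λ a → sumℕ λ b → b2ℕ (forward a b)) (sum-cong-≗ λ a →
    trans (ℕ→ℚ-sumℕ λ b → b2ℕ (forward a b)) (sum-cong-≗ λ b →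
    trans (ℕ→ℚ-b2ℕ (forward a b)) (b2ℚ-∧ (toℕ a ℕ.<ᵇ toℕ b) (adj G a b))))

const-injective : ∀ {n} {v : Fin n} → Injective _≡_ _≡_ (λ (_ : Fin 1) → v)
const-injective {x = zero} {zero} _ = refl

-- A shortest path from `u` to `v` avoiding the edge `u v` is closed by that edge. The breadth-first
-- forest with the single root `v` supplies the path as the ancestors of `u`, distinct because their
-- depths differ.
module CycleThroughEdge {n} (K : Graph n) {u v} (e : adj K u v ≡ true) (reach : ∀ w → Reach (K ∖ edge u v) w v) where

  private
    module P = Forest (K ∖ edge u v) {1} (λ _ → v) const-injective (λ w → zero , reach w)

  path-end : ∀ {ℓ} → P.depth u ≡ ℓ → P.ancestor ℓ u ≡ v
  path-end refl = ≡-sym (proj₂ (P.ancestor-root (P.depth u) ℕ.≤-refl))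

  2≤depth : ∀ ℓ → P.depth u ≡ ℓ → 2 ≤ ℓ
  2≤depth zero          eq = contradiction (path-end eq) (adj⇒≢ K e)
  -- A path of length 1 would be the deleted edge; so the cycle has at least 3 vertices.
  2≤depth (suc zero)    eq = contradiction (inj₁ (refl , ≡-sym (path-end eq)))
    (proj₂ (∖-adj⁻ K (edge u v) (P.ancestor-adj (ℕ.≤-reflexive (≡-sym eq)))))
  2≤depth (suc (suc _)) eq = s≤s (s≤s z≤n)

  cycle : ∃ λ k → Cycle K k
  cycle = suc ℓ , (λ i → P.ancestor (toℕ i) u) , s≤s (2≤depth ℓ refl)
        , (λ {i} {j} eq → toℕ-injective (P.ancestor-injective (ℕ.s≤s⁻¹ (toℕ<n i)) (ℕ.s≤s⁻¹ (toℕ<n j)) eq))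
        , adjacent
    where
    ℓ : ℕ
    ℓ = P.depth u
    adjacent : ∀ i → adj K (P.ancestor (toℕ i) u) (P.ancestor (toℕ (next i)) u) ≡ true
    adjacent i with view i
    ... | ‵fromℕ = subst₂ (λ a j → adj K a (P.ancestor (toℕ j) u) ≡ true)
            (≡-sym (trans (cong (λ t → P.ancestor t u) (toℕ-fromℕ ℓ)) (path-end refl))) (≡-sym (next-fromℕ ℓ))
            (trans (Graph.sym K v u) e)
    ... | ‵inject₁ j = subst₂ (λ t j → adj K (P.ancestor t u) (P.ancestor (toℕ j) u) ≡ true)
            (≡-sym (toℕ-inject₁ j)) (≡-sym (next-inject₁ j)) (proj₁ (∖-adj⁻ K (edge u v) (P.ancestor-adj (toℕ<n j))))

-- A breadth-first tree uses only n-1 of the n edges. An edge outside it can be deleted without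
-- breaking any tree path, hence lies on a cycle.
module Unicyclic {n} (K : Graph n) (connected : Connected K) (size : sum₂ (weight K) ≡ 2ℚ *ℚ ℕ→ℚ n) (o : Fin n) where

  private
    module F = Forest K {1} (λ _ → o) const-injective (λ w → zero , connected w o)

  nonTree : ∃₂ λ u v → weight K u v ≢ F.arc u v +ℚ F.arc v u
  nonTree = go (any? λ u → any? λ v → ¬? (weight K u v ℚ.≟ (F.arc u v +ℚ F.arc v u)))
    where
    open ≡-Reasoning
    isolate : ∀ t x → t *ℚ x -ℚ t *ℚ (x -ℚ 1ℚ) ≡ t
    isolate = solve-∀ ℚ-ring
    go : Dec (∃₂ λ u v → weight K u v ≢ F.arc u v +ℚ F.arc v u) → ∃₂ λ u v → weight K u v ≢ F.arc u v +ℚ F.arc v u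
    go (yes found) = found
    -- If every edge were a tree edge, the totals 2n and 2(n-1) would agree.
    go (no  all)   = contradiction (begin
      2ℚ                                                ≡⟨ isolate 2ℚ (ℕ→ℚ n) ⟨
      2ℚ *ℚ ℕ→ℚ n -ℚ 2ℚ *ℚ (ℕ→ℚ n -ℚ 1ℚ)                ≡⟨ cong₂ _-ℚ_ size F.sum-arcs-1 ⟨
      sum₂ (weight K) -ℚ sum₂ (λ a b → F.arc a b +ℚ F.arc b a)
                                                        ≡⟨ cong (_-ℚ sum₂ (λ a b → F.arc a b +ℚ F.arc b a)) (sum₂-cong λ a b →
                                                             decidable-stable (weight K a b ℚ.≟ (F.arc a b +ℚ F.arc b a)) λ ne → all (a , b , ne)) ⟩
      sum₂ (λ a b → F.arc a b +ℚ F.arc b a) -ℚ sum₂ (λ a b → F.arc a b +ℚ F.arc b a)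
                                                        ≡⟨ ℚ.+-inverseʳ (sum₂ (λ a b → F.arc a b +ℚ F.arc b a)) ⟩
      0ℚ                                                ∎) (λ ())

  module _ {u v} (u↛v : F.IsRoot u ⊎ F.parent u ≢ v) (v↛u : F.IsRoot v ⊎ F.parent v ≢ u) where

    parent-edge∉uv : ∀ {w} → ¬ F.IsRoot w → ¬ Mem (edge u v) w (F.parent w)
    parent-edge∉uv ¬root (inj₁ (refl , eq)) = [ ¬root , (λ ne → ne (≡-sym eq)) ]′ u↛v
    parent-edge∉uv ¬root (inj₂ (eq , refl)) = [ ¬root , (λ ne → ne (≡-sym eq)) ]′ v↛u

    up : ∀ w t → Reach (K ∖ edge u v) w (F.ancestor t w)
    up w zero    = here
    up w (suc t) with F.root? (F.ancestor t w)
    ... | inj₁ (_ , _ , eq)     = subst (Reach (K ∖ edge u v) w) (≡-sym eq) (up w t)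
    ... | inj₂ (¬root , e , _)  = reach-trans (up w t) (step (∖-adj⁺ K (edge u v) e (parent-edge∉uv ¬root)) here)

    reach-root : ∀ w → Reach (K ∖ edge u v) w o
    reach-root w = subst (Reach (K ∖ edge u v) w) (≡-sym (proj₂ (F.ancestor-root (F.depth w) ℕ.≤-refl))) (up w (F.depth w))

  cycle : ∃ λ k → Cycle K k
  cycle with nonTree
  ... | u , v , ne with F.tree-edge? u v
  ...   | inj₁ eq = contradiction eq ne
  ...   | inj₂ (e , (_ , u↛v) , (_ , v↛u)) = CycleThroughEdge.cycle K e
            (λ w → reach-trans (reach-root u↛v v↛u w) (reach-sym (reach-root u↛v v↛u v)))

module _ {n p q} (G : Graph n) (inB : InB G p q) where
  private
    connected = proj₁ inB
    C = proj₁ (proj₂ (proj₂ inB))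
    D = proj₁ (proj₂ (proj₂ (proj₂ inB)))
    only : ∀ k (E : Cycle G k) → SameCycle G E C ⊎ SameCycle G E D
    only = proj₂ (proj₂ (proj₂ (proj₂ (proj₂ inB))))

  inB-size : sum₂ (weight G) ≡ 2ℚ *ℚ (1ℚ +ℚ ℕ→ℚ n)
  inB-size = trans (sum₂-weight-numEdges G) (cong (2ℚ *ℚ_) (trans (cong ℕ→ℚ (proj₁ (proj₂ inB))) (ℕ→ℚ-suc n)))

  -- Deleting a common edge f of C and D would leave n edges, hence a cycle other than C and D.
  no-common-edge : ∀ i → ¬ Mem (cycleEdges (proj₁ D)) (proj₁ C i) (proj₁ C (next i))
  no-common-edge i m = absurd (Unicyclic.cycle (G ∖ f) (λ x y → reach-∖-edge (cycle-detour C i) (connected x y)) K-size a)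
    where
    open ≡-Reasoning
    a b : Fin n
    a = proj₁ C i
    b = proj₁ C (next i)
    e : adj G a b ≡ true
    e = proj₂ (proj₂ (proj₂ C)) i
    f : EdgeSet n
    f = edge a b
    K-size : sum₂ (weight (G ∖ f)) ≡ 2ℚ *ℚ ℕ→ℚ n
    K-size = begin
      sum₂ (weight (G ∖ f))                                      ≡⟨ isolate (sum₂ (weight (G ∖ f))) 2ℚ ⟨
      (sum₂ (weight (G ∖ f)) +ℚ 2ℚ) -ℚ 2ℚ                        ≡⟨ cong (λ x → (sum₂ (weight (G ∖ f)) +ℚ x) -ℚ 2ℚ) (sum₂-char (adj⇒≢ G e)) ⟨
      (sum₂ (weight (G ∖ f)) +ℚ sum₂ (char f)) -ℚ 2ℚ             ≡⟨ cong (_-ℚ 2ℚ) (trans (sum₂-cong (∖-weight G f (edge⊆ G e))) (sum₂-+ (weight (G ∖ f)) (char f))) ⟨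
      sum₂ (weight G) -ℚ 2ℚ                                      ≡⟨ cong (_-ℚ 2ℚ) inB-size ⟩
      2ℚ *ℚ (1ℚ +ℚ ℕ→ℚ n) -ℚ 2ℚ                                  ≡⟨ shrink 2ℚ (ℕ→ℚ n) ⟩
      2ℚ *ℚ ℕ→ℚ n                                                ∎
      where
      isolate : ∀ x y → (x +ℚ y) -ℚ y ≡ x
      isolate = solve-∀ ℚ-ring
      shrink : ∀ t x → t *ℚ (1ℚ +ℚ x) -ℚ t ≡ t *ℚ x
      shrink = solve-∀ ℚ-ring
    absurd : ∃ (λ k → Cycle (G ∖ f) k) → ⊥
    absurd (k , E@(cycle , 3≤k , cycle-injective , adjacent)) = avoid (only k E′)
      where
      E′ : Cycle G k
      E′ = cycle , 3≤k , cycle-injective , λ j → proj₁ (∖-adj⁻ G f (adjacent j))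
      missing : ¬ Mem (cycleEdges cycle) a b
      missing m′ = proj₂ (∖-adj⁻ G f (cycle⊆ (G ∖ f) E m′)) (inj₁ (refl , refl))
      avoid : SameCycle G E′ C ⊎ SameCycle G E′ D → ⊥
      avoid (inj₁ same) = missing (proj₂ (same a b) (i , inj₁ (refl , refl)))
      avoid (inj₂ same) = missing (proj₂ (same a b) m)

  inB-bicyclic : BicyclicGraph n p q
  inB-bicyclic = record
    { graph = G ; connected = connected ; size = inB-size ; C = C ; D = D
    ; disjoint = λ { (i , inj₁ (refl , refl)) m → no-common-edge i m
                   ; (i , inj₂ (refl , refl)) m → no-common-edge i (mem-sym (cycleEdges (proj₁ D)) m) }
    }

-- The graph S_n^{p,q}

-- p = P + 1 and q = Q + 1
module SGraph (P Q n : ℕ) (2≤P : 2 ≤ P) (2≤Q : 2 ≤ Q) (P+Q<n : P + Q ℕ.< n) where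

  -- One constructor per disjunct of `SEdgeℕ`. The last index on a cycle, p+q-2, is now `P + Q`.
  data SEdge (a b : ℕ) : Set where
    chain-C  : suc a ≡ b → b ≤ P → SEdge a b
    close-C  : a ≡ 0 → b ≡ P → SEdge a b
    start-D  : a ≡ 0 → b ≡ suc P → SEdge a b
    chain-D  : P ℕ.< a → suc a ≡ b → b ≤ P + Q → SEdge a b
    close-D  : a ≡ 0 → b ≡ P + Q → SEdge a b
    pendant  : a ≡ 0 → P + Q ℕ.< b → SEdge a b

  private
    ∧⁺ : ∀ {x y} → Bool.T x → Bool.T y → Bool.T (x ∧ y)
    ∧⁺ Tx Ty = Equivalence.from T-∧ (Tx , Ty)
    ∧⁻ : ∀ {x y} → Bool.T (x ∧ y) → Bool.T x × Bool.T y
    ∧⁻ = Equivalence.to T-∧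
    ∨⁺ˡ : ∀ {x y} → Bool.T x → Bool.T (x ∨ y)
    ∨⁺ˡ = Equivalence.from T-∨ ∘ inj₁
    ∨⁺ʳ : ∀ {x y} → Bool.T y → Bool.T (x ∨ y)
    ∨⁺ʳ {x} = Equivalence.from (T-∨ {x}) ∘ inj₂
    ∨⁻ : ∀ {x y} → Bool.T (x ∨ y) → Bool.T x ⊎ Bool.T y
    ∨⁻ = Equivalence.to T-∨

  sedge⁺ : ∀ {a b} → SEdge a b → Bool.T (SEdgeℕ (suc P) (suc Q) a b)
  -- The bounds p+q-2 and p+q-1 reduce to expressions in `P + Q` only after the successor is moved
  -- out of the second summand.
  sedge⁺ {a} {b} v rewrite ℕ.+-suc P Q = go v
    where
    go : SEdge a b → _
    go (chain-C eq le)    = ∨⁺ˡ (∧⁺ (ℕ.≡⇒≡ᵇ (suc a) b eq) (ℕ.≤⇒≤ᵇ le))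
    go (close-C eq eq′)   = ∨⁺ʳ {(suc a ℕ.≡ᵇ b) ∧ (b ℕ.≤ᵇ P)} (∨⁺ˡ (∧⁺ (ℕ.≡⇒≡ᵇ a 0 eq) (ℕ.≡⇒≡ᵇ b P eq′)))
    go (start-D eq eq′)   = ∨⁺ʳ {(suc a ℕ.≡ᵇ b) ∧ (b ℕ.≤ᵇ P)} (∨⁺ʳ {(a ℕ.≡ᵇ 0) ∧ (b ℕ.≡ᵇ P)} (∨⁺ˡ (∧⁺ (ℕ.≡⇒≡ᵇ a 0 eq) (ℕ.≡⇒≡ᵇ b (suc P) eq′))))
    go (chain-D lt eq le) = ∨⁺ʳ {(suc a ℕ.≡ᵇ b) ∧ (b ℕ.≤ᵇ P)} (∨⁺ʳ {(a ℕ.≡ᵇ 0) ∧ (b ℕ.≡ᵇ P)} (∨⁺ʳ {(a ℕ.≡ᵇ 0) ∧ (b ℕ.≡ᵇ suc P)}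
      (∨⁺ˡ (∧⁺ (ℕ.<⇒<ᵇ lt) (∧⁺ (ℕ.≡⇒≡ᵇ (suc a) b eq) (ℕ.≤⇒≤ᵇ le))))))
    go (close-D eq eq′)   = ∨⁺ʳ {(suc a ℕ.≡ᵇ b) ∧ (b ℕ.≤ᵇ P)} (∨⁺ʳ {(a ℕ.≡ᵇ 0) ∧ (b ℕ.≡ᵇ P)} (∨⁺ʳ {(a ℕ.≡ᵇ 0) ∧ (b ℕ.≡ᵇ suc P)}
      (∨⁺ʳ {(P ℕ.<ᵇ a) ∧ (suc a ℕ.≡ᵇ b) ∧ (b ℕ.≤ᵇ P + Q)} (∨⁺ˡ (∧⁺ (ℕ.≡⇒≡ᵇ a 0 eq) (ℕ.≡⇒≡ᵇ b (P + Q) eq′))))))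
    go (pendant eq lt)    = ∨⁺ʳ {(suc a ℕ.≡ᵇ b) ∧ (b ℕ.≤ᵇ P)} (∨⁺ʳ {(a ℕ.≡ᵇ 0) ∧ (b ℕ.≡ᵇ P)} (∨⁺ʳ {(a ℕ.≡ᵇ 0) ∧ (b ℕ.≡ᵇ suc P)}
      (∨⁺ʳ {(P ℕ.<ᵇ a) ∧ (suc a ℕ.≡ᵇ b) ∧ (b ℕ.≤ᵇ P + Q)} (∨⁺ʳ {(a ℕ.≡ᵇ 0) ∧ (b ℕ.≡ᵇ P + Q)} (∧⁺ (ℕ.≡⇒≡ᵇ a 0 eq) (ℕ.<⇒<ᵇ lt))))))

  sedge⁻ : ∀ {a b} → Bool.T (SEdgeℕ (suc P) (suc Q) a b) → SEdge a b
  sedge⁻ {a} {b} t rewrite ℕ.+-suc P Q with ∨⁻ t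
  ... | inj₁ t₁ = chain-C (ℕ.≡ᵇ⇒≡ (suc a) b (proj₁ (∧⁻ t₁))) (ℕ.≤ᵇ⇒≤ b P (proj₂ (∧⁻ {suc a ℕ.≡ᵇ b} t₁)))
  ... | inj₂ t₁ with ∨⁻ t₁
  ...   | inj₁ t₂ = close-C (ℕ.≡ᵇ⇒≡ a 0 (proj₁ (∧⁻ t₂))) (ℕ.≡ᵇ⇒≡ b P (proj₂ (∧⁻ {a ℕ.≡ᵇ 0} t₂)))
  ...   | inj₂ t₂ with ∨⁻ t₂
  ...     | inj₁ t₃ = start-D (ℕ.≡ᵇ⇒≡ a 0 (proj₁ (∧⁻ t₃))) (ℕ.≡ᵇ⇒≡ b (suc P) (proj₂ (∧⁻ {a ℕ.≡ᵇ 0} t₃)))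
  ...     | inj₂ t₃ with ∨⁻ t₃
  ...       | inj₁ t₄ = chain-D (ℕ.<ᵇ⇒< P a (proj₁ (∧⁻ t₄))) (ℕ.≡ᵇ⇒≡ (suc a) b (proj₁ (∧⁻ (proj₂ (∧⁻ {P ℕ.<ᵇ a} t₄)))))
                          (ℕ.≤ᵇ⇒≤ b (P + Q) (proj₂ (∧⁻ {suc a ℕ.≡ᵇ b} (proj₂ (∧⁻ {P ℕ.<ᵇ a} t₄)))))
  ...       | inj₂ t₄ with ∨⁻ t₄
  ...         | inj₁ t₅ = close-D (ℕ.≡ᵇ⇒≡ a 0 (proj₁ (∧⁻ t₅))) (ℕ.≡ᵇ⇒≡ b (P + Q) (proj₂ (∧⁻ {a ℕ.≡ᵇ 0} t₅)))
  ...         | inj₂ t₅ = pendant (ℕ.≡ᵇ⇒≡ a 0 (proj₁ (∧⁻ t₅))) (ℕ.<ᵇ⇒< (P + Q) b (proj₂ (∧⁻ {a ℕ.≡ᵇ 0} t₅)))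

  S₀ : Graph n
  S₀ = S n (suc P) (suc Q)

  S-adj⁺ : ∀ {i j} → toℕ i ℕ.< toℕ j → SEdge (toℕ i) (toℕ j) → adj S₀ i j ≡ true
  S-adj⁺ i<j v = Equivalence.to T-≡ (∨⁺ˡ (∧⁺ (ℕ.<⇒<ᵇ i<j) (sedge⁺ v)))

  S-adj⁻ : ∀ {i j} → adj S₀ i j ≡ true → (toℕ i ℕ.< toℕ j × SEdge (toℕ i) (toℕ j)) ⊎ (toℕ j ℕ.< toℕ i × SEdge (toℕ j) (toℕ i))
  S-adj⁻ {i} {j} e with ∨⁻ (Equivalence.from T-≡ e)
  ... | inj₁ t = inj₁ (ℕ.<ᵇ⇒< (toℕ i) (toℕ j) (proj₁ (∧⁻ t)) , sedge⁻ (proj₂ (∧⁻ {toℕ i ℕ.<ᵇ toℕ j} t)))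
  ... | inj₂ t = inj₂ (ℕ.<ᵇ⇒< (toℕ j) (toℕ i) (proj₁ (∧⁻ t)) , sedge⁻ (proj₂ (∧⁻ {toℕ j ℕ.<ᵇ toℕ i} t)))

  o : Fin n
  o = fromℕ< {0} (ℕ.≤-trans (s≤s z≤n) P+Q<n)

  toℕ-o : toℕ o ≡ 0
  toℕ-o = toℕ-fromℕ< _

  ≡o : ∀ {i} → toℕ i ≡ 0 → i ≡ o
  ≡o eq = toℕ-injective (trans eq (≡-sym toℕ-o))

  -- Parents in the spanning tree obtained by omitting the two closing edges and rooted at index 0.
  -- It consists of two paths and the pendant edges; as `pred 0` is 0, the root is its own parent.
  ParentSpec : ℕ → ℕ → Set
  ParentSpec b a = (b ≤ P × a ≡ ℕ.pred b) ⊎ (b ≡ suc P × a ≡ 0) ⊎ (suc P ℕ.< b × b ≤ P + Q × a ≡ ℕ.pred b) ⊎ (P + Q ℕ.< b × a ≡ 0)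

  abstract
    parentℕ-spec : ∀ b → ∃ (ParentSpec b)
    parentℕ-spec b with b ℕ.≤? P | b ℕ.≟ suc P | b ℕ.≤? P + Q
    ... | yes le | _      | _      = ℕ.pred b , inj₁ (le , refl)
    ... | no  _  | yes eq | _      = 0 , inj₂ (inj₁ (eq , refl))
    ... | no ¬le | no neq | yes le = ℕ.pred b , inj₂ (inj₂ (inj₁ (ℕ.≤∧≢⇒< (ℕ.≰⇒> ¬le) (neq ∘ ≡-sym) , le , refl)))
    ... | no _   | no  _  | no ¬le = 0 , inj₂ (inj₂ (inj₂ (ℕ.≰⇒> ¬le , refl)))

  parentℕ : ℕ → ℕ
  parentℕ b = proj₁ (parentℕ-spec b)

  parentℕ≤ : ∀ b → parentℕ b ≤ b
  parentℕ≤ b with parentℕ-spec b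
  ... | _ , inj₁ (_ , refl)                      = ℕ.pred[n]≤n
  ... | _ , inj₂ (inj₁ (_ , refl))               = z≤n
  ... | _ , inj₂ (inj₂ (inj₁ (_ , _ , refl)))    = ℕ.pred[n]≤n
  ... | _ , inj₂ (inj₂ (inj₂ (_ , refl)))        = z≤n

  parentℕ< : ∀ {b} → b ≢ 0 → parentℕ b ℕ.< b
  parentℕ< {zero}  b≢0 = contradiction refl b≢0
  parentℕ< {suc b} b≢0 with parentℕ-spec (suc b)
  ... | _ , inj₁ (_ , refl)                      = ℕ.n<1+n b
  ... | _ , inj₂ (inj₁ (_ , refl))               = s≤s z≤n
  ... | _ , inj₂ (inj₂ (inj₁ (_ , _ , refl)))    = ℕ.n<1+n b
  ... | _ , inj₂ (inj₂ (inj₂ (_ , refl)))        = s≤s z≤n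

  parentℕ-edge : ∀ {b} → b ≢ 0 → SEdge (parentℕ b) b
  parentℕ-edge {zero}  b≢0 = contradiction refl b≢0
  parentℕ-edge {suc b} b≢0 with parentℕ-spec (suc b)
  ... | _ , inj₁ (le , refl)                      = chain-C refl le
  ... | _ , inj₂ (inj₁ (eq , refl))               = start-D refl eq
  ... | _ , inj₂ (inj₂ (inj₁ (lt , le , refl)))   = chain-D (ℕ.s≤s⁻¹ lt) refl le
  ... | _ , inj₂ (inj₂ (inj₂ (lt , refl)))        = pendant refl lt

  sedge-parent : ∀ {a b} → SEdge a b → a ≡ parentℕ b ⊎ (a ≡ 0 × b ≡ P) ⊎ (a ≡ 0 × b ≡ P + Q)
  sedge-parent (close-C eq eq′) = inj₂ (inj₁ (eq , eq′))
  sedge-parent (close-D eq eq′) = inj₂ (inj₂ (eq , eq′))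
  sedge-parent {a} (chain-C refl le) with parentℕ-spec (suc a)
  ... | _ , inj₁ (_ , refl)                      = inj₁ refl
  ... | _ , inj₂ (inj₁ (refl , _))               = contradiction le ℕ.1+n≰n
  ... | _ , inj₂ (inj₂ (inj₁ (lt , _)))          = contradiction (ℕ.≤-trans (ℕ.<⇒≤ lt) le) ℕ.1+n≰n
  ... | _ , inj₂ (inj₂ (inj₂ (lt , _)))          = contradiction (ℕ.≤-trans (ℕ.≤-trans lt le) (ℕ.m≤m+n P Q)) ℕ.1+n≰n
  sedge-parent (start-D refl refl) with parentℕ-spec (suc P)
  ... | _ , inj₁ (le , _)                        = contradiction le ℕ.1+n≰n
  ... | _ , inj₂ (inj₁ (_ , refl))               = inj₁ refl
  ... | _ , inj₂ (inj₂ (inj₁ (lt , _)))          = contradiction lt ℕ.1+n≰n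
  ... | _ , inj₂ (inj₂ (inj₂ (_ , refl)))        = inj₁ refl
  sedge-parent {a} (chain-D lt refl le) with parentℕ-spec (suc a)
  ... | _ , inj₁ (_ , refl)                      = inj₁ refl
  ... | _ , inj₂ (inj₁ (eq , _))                 = contradiction (ℕ.≤-trans lt (ℕ.≤-reflexive (ℕ.suc-injective eq))) ℕ.1+n≰n
  ... | _ , inj₂ (inj₂ (inj₁ (_ , _ , refl)))    = inj₁ refl
  ... | _ , inj₂ (inj₂ (inj₂ (lt′ , _)))         = contradiction (ℕ.≤-trans lt′ le) ℕ.1+n≰n
  sedge-parent {b = b} (pendant refl lt) with parentℕ-spec b
  ... | _ , inj₁ (le , _)                        = contradiction (ℕ.≤-trans (ℕ.≤-trans lt le) (ℕ.m≤m+n P Q)) ℕ.1+n≰n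
  ... | _ , inj₂ (inj₁ (_ , refl))               = inj₁ refl
  ... | _ , inj₂ (inj₂ (inj₁ (_ , le , _)))      = contradiction (ℕ.≤-trans lt le) ℕ.1+n≰n
  ... | _ , inj₂ (inj₂ (inj₂ (_ , refl)))        = inj₁ refl

  parent : Fin n → Fin n
  parent i = fromℕ< (ℕ.≤-<-trans (parentℕ≤ (toℕ i)) (toℕ<n i))

  toℕ-parent : ∀ i → toℕ (parent i) ≡ parentℕ (toℕ i)
  toℕ-parent i = toℕ-fromℕ< _

  parent-adj : ∀ {i} → i ≢ o → adj S₀ i (parent i) ≡ true
  parent-adj {i} i≢o = trans (Graph.sym S₀ i (parent i)) (S-adj⁺
    (subst (ℕ._< toℕ i) (≡-sym (toℕ-parent i)) (parentℕ< (i≢o ∘ ≡o)))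
    (subst (λ a → SEdge a (toℕ i)) (≡-sym (toℕ-parent i)) (parentℕ-edge (i≢o ∘ ≡o))))

  -- Parents have smaller indices, so induction on the index applies.
  tree-induction : (Pr : Fin n → Set) → Pr o → (∀ {i} → i ≢ o → Pr (parent i) → Pr i) → ∀ i → Pr i
  tree-induction Pr Pr-o climb i = go (toℕ i) ℕ.≤-refl
    where
    go : ∀ m {i} → toℕ i ≤ m → Pr i
    go m {i} i≤m with toSum (i ≟ o)
    go m       {i} i≤m | inj₁ refl = Pr-o
    go zero    {i} i≤m | inj₂ i≢o  = contradiction (≡o (ℕ.n≤0⇒n≡0 i≤m)) i≢o
    go (suc m) {i} i≤m | inj₂ i≢o  = climb i≢o (go m (ℕ.s≤s⁻¹ (ℕ.≤-trans (subst (ℕ._< toℕ i) (≡-sym (toℕ-parent i)) (parentℕ< (i≢o ∘ ≡o))) i≤m)))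

  S-connected : Connected S₀
  S-connected i j = reach-trans (to-root i) (reach-sym (to-root j))
    where
    to-root : ∀ i → Reach S₀ i o
    to-root = tree-induction (λ i → Reach S₀ i o) here (λ i≢o r → step (parent-adj i≢o) r)

  P<n : P ℕ.< n
  P<n = ℕ.≤-<-trans (ℕ.m≤m+n P Q) P+Q<n

  c : Fin (suc P) → Fin n
  c i = fromℕ< (ℕ.<-≤-trans (toℕ<n i) P<n)

  toℕ-c : ∀ i → toℕ (c i) ≡ toℕ i
  toℕ-c i = toℕ-fromℕ< _

  dℕ : ℕ → ℕ
  dℕ zero    = 0
  dℕ (suc j) = suc (P + j)

  dℕ≤ : ∀ {j} → j ≤ Q → dℕ j ≤ P + Q
  dℕ≤ {zero}  _   = z≤n
  dℕ≤ {suc j} j<Q = subst (_≤ P + Q) (ℕ.+-suc P j) (ℕ.+-monoʳ-≤ P j<Q)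

  dℕ-injective : ∀ {i j} → dℕ i ≡ dℕ j → i ≡ j
  dℕ-injective {zero}  {zero}  _  = refl
  dℕ-injective {suc i} {suc j} eq = cong suc (ℕ.+-cancelˡ-≡ P i j (ℕ.suc-injective eq))

  d : Fin (suc Q) → Fin n
  d j = fromℕ< (ℕ.≤-<-trans (dℕ≤ (ℕ.s≤s⁻¹ (toℕ<n j))) P+Q<n)

  toℕ-d : ∀ j → toℕ (d j) ≡ dℕ (toℕ j)
  toℕ-d j = toℕ-fromℕ< _

  S-adj : ∀ {i j a b} → toℕ i ≡ a → toℕ j ≡ b → a ℕ.< b → SEdge a b → adj S₀ i j ≡ true
  S-adj refl refl = S-adj⁺

  C : Cycle S₀ (suc P)
  C = c , s≤s 2≤P , (λ {i} {j} eq → toℕ-injective (trans (≡-sym (toℕ-c i)) (trans (cong toℕ eq) (toℕ-c j)))) , adjacent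
    where
    adjacent : ∀ i → adj S₀ (c i) (c (next i)) ≡ true
    adjacent i with view i
    ... | ‵fromℕ = trans (Graph.sym S₀ (c (fromℕ P)) (c (next (fromℕ P)))) (S-adj
            (trans (toℕ-c (next (fromℕ P))) (cong toℕ (next-fromℕ P))) (trans (toℕ-c (fromℕ P)) (toℕ-fromℕ P))
            (ℕ.≤-trans (s≤s z≤n) 2≤P) (close-C refl refl))
    ... | ‵inject₁ j = S-adj (trans (toℕ-c (inject₁ j)) (toℕ-inject₁ j)) (trans (toℕ-c (next (inject₁ j))) (cong toℕ (next-inject₁ j)))
            (ℕ.n<1+n (toℕ j)) (chain-C refl (toℕ<n j))

  dℕ-chain : ∀ {j} → j ℕ.< Q → dℕ j ℕ.< dℕ (suc j) × SEdge (dℕ j) (dℕ (suc j))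
  dℕ-chain {zero}  j<Q = s≤s z≤n , start-D refl (cong suc (ℕ.+-identityʳ P))
  dℕ-chain {suc j} j<Q = s≤s (ℕ.≤-reflexive (≡-sym (ℕ.+-suc P j)))
                       , chain-D (s≤s (ℕ.m≤m+n P j)) (cong suc (≡-sym (ℕ.+-suc P j))) (dℕ≤ {suc (suc j)} j<Q)

  dℕ-last : ∀ {j} → j ≢ 0 → dℕ j ≡ P + j
  dℕ-last {zero}  j≢0 = contradiction refl j≢0
  dℕ-last {suc j} _   = ≡-sym (ℕ.+-suc P j)

  D : Cycle S₀ (suc Q)
  D = d , s≤s 2≤Q , (λ {i} {j} eq → toℕ-injective (dℕ-injective (trans (≡-sym (toℕ-d i)) (trans (cong toℕ eq) (toℕ-d j))))) , adjacent
    where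
    0<P+Q : 0 ℕ.< P + Q
    0<P+Q = ℕ.≤-trans (ℕ.≤-trans (s≤s z≤n) 2≤P) (ℕ.m≤m+n P Q)
    Q≢0 : Q ≢ 0
    Q≢0 eq = ℕ.n≮0 (subst (2 ≤_) eq 2≤Q)
    adjacent : ∀ j → adj S₀ (d j) (d (next j)) ≡ true
    adjacent j with view j
    ... | ‵fromℕ = trans (Graph.sym S₀ (d (fromℕ Q)) (d (next (fromℕ Q)))) (S-adj
            (trans (toℕ-d (next (fromℕ Q))) (cong (dℕ ∘ toℕ) (next-fromℕ Q))) (trans (toℕ-d (fromℕ Q)) (trans (cong dℕ (toℕ-fromℕ Q)) (dℕ-last Q≢0)))
            0<P+Q (close-D refl refl))
    ... | ‵inject₁ i = S-adj (trans (toℕ-d (inject₁ i)) (cong dℕ (toℕ-inject₁ i))) (trans (toℕ-d (next (inject₁ i))) (cong (dℕ ∘ toℕ) (next-inject₁ i)))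
            (proj₁ (dℕ-chain (toℕ<n i))) (proj₂ (dℕ-chain (toℕ<n i)))

  c-image : ∀ {v} → Image c v → toℕ v ≤ P
  c-image (i , refl) = subst (_≤ P) (≡-sym (toℕ-c i)) (ℕ.s≤s⁻¹ (toℕ<n i))

  c-image⁺ : ∀ {v} → toℕ v ≤ P → Image c v
  c-image⁺ v≤P = fromℕ< (s≤s v≤P) , toℕ-injective (trans (toℕ-c _) (toℕ-fromℕ< _))

  d-image : ∀ {v} → Image d v → v ≡ o ⊎ (P ℕ.< toℕ v × toℕ v ≤ P + Q)
  d-image (zero  , refl) = inj₁ (≡o (toℕ-d zero))
  d-image (suc j , refl) = inj₂ (subst (P ℕ.<_) (≡-sym (toℕ-d (suc j))) (s≤s (ℕ.m≤m+n P (toℕ j)))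
                                , subst (_≤ P + Q) (≡-sym (toℕ-d (suc j))) (dℕ≤ (ℕ.s≤s⁻¹ (toℕ<n (suc j)))))

  d-image⁺ : ∀ {v} → P ℕ.< toℕ v → toℕ v ≤ P + Q → Image d v
  d-image⁺ {v} P<v v≤P+Q = fromℕ< (s≤s j<Q) , toℕ-injective (trans (toℕ-d (fromℕ< (s≤s j<Q))) (trans (cong dℕ (toℕ-fromℕ< (s≤s j<Q))) value))
    where
    value : suc (P + (toℕ v ∸ suc P)) ≡ toℕ v
    value = ℕ.m+[n∸m]≡n P<v
    j<Q : suc (toℕ v ∸ suc P) ≤ Q
    j<Q = ℕ.+-cancelˡ-≤ P _ _ (subst (_≤ P + Q) (trans (≡-sym value) (≡-sym (ℕ.+-suc P (toℕ v ∸ suc P)))) v≤P+Q)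

  -- The cycles meet only in `o`, so a common edge would be a loop.
  S-disjoint : ∀ {a b} → Mem (cycleEdges c) a b → ¬ Mem (cycleEdges d) a b
  S-disjoint {a} {b} m m′ = adj⇒≢ S₀ (cycle⊆ S₀ C m) (trans (common (proj₁ (cycle-edge⇒image c m)) (proj₁ (cycle-edge⇒image d m′)))
                                                     (≡-sym (common (proj₂ (cycle-edge⇒image c m)) (proj₂ (cycle-edge⇒image d m′)))))
    where
    common : ∀ {v} → Image c v → Image d v → v ≡ o
    common ic id with d-image id
    ... | inj₁ eq        = eq
    ... | inj₂ (P<v , _) = contradiction (c-image ic) (ℕ.<⇒≱ P<v)

  treeArc : Fin n → Fin n → ℚ
  treeArc i j = (1ℚ -ℚ δ o i) *ℚ δ (parent i) j

  1-δ : ∀ i → (i ≡ o × 1ℚ -ℚ δ o i ≡ 0ℚ) ⊎ (i ≢ o × 1ℚ -ℚ δ o i ≡ 1ℚ)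
  1-δ i with toSum (i ≟ o)
  ... | inj₁ refl = inj₁ (refl , cong (1ℚ -ℚ_) (δ-refl o))
  ... | inj₂ i≢o  = inj₂ (i≢o , cong (1ℚ -ℚ_) (δ-≢ (i≢o ∘ ≡-sym)))

  treeArc-≥0 : ∀ i j → 0ℚ ≤ℚ treeArc i j
  treeArc-≥0 i j with 1-δ i
  ... | inj₁ (_ , eq) = ℚ.≤-reflexive (≡-sym (≡0-*ˡ (δ (parent i) j) eq))
  ... | inj₂ (_ , eq) = 0≤-* (subst (0ℚ ≤ℚ_) (≡-sym eq) (b2ℚ-≥0 true)) (δ-≥0 (parent i) j)

  treeArc-parent : ∀ {i j} → i ≢ o → parent i ≡ j → treeArc i j ≡ 1ℚ
  treeArc-parent {i} i≢o refl with 1-δ i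
  ... | inj₁ (i≡o , _) = contradiction i≡o i≢o
  ... | inj₂ (_ , eq)  = cong₂ _*ℚ_ eq (δ-refl (parent i))

  sum-treeArc : sum₂ treeArc ≡ ℕ→ℚ n -ℚ 1ℚ
  sum-treeArc = begin
    sum₂ treeArc                                  ≡⟨ sum-cong-≗ (λ i → trans (sum-* (1ℚ -ℚ δ o i) (δ (parent i))) (cong ((1ℚ -ℚ δ o i) *ℚ_) (sum-δ-1 (parent i)))) ⟩
    sum (λ i → (1ℚ -ℚ δ o i) *ℚ 1ℚ)               ≡⟨ sum-cong-≗ (λ i → ℚ.*-identityʳ (1ℚ -ℚ δ o i)) ⟩
    sum (λ i → 1ℚ -ℚ δ o i)                       ≡⟨ sum-- (λ _ → 1ℚ) (δ o) ⟩
    sum {n} (λ _ → 1ℚ) -ℚ sum (δ o)               ≡⟨ cong₂ _-ℚ_ (sum-1 n) (sum-δ-1 o) ⟩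
    ℕ→ℚ n -ℚ 1ℚ                                   ∎
    where
    open ≡-Reasoning
    sum-δ-1 : ∀ i → sum (δ i) ≡ 1ℚ
    sum-δ-1 i = trans (sum-cong-≗ λ j → ≡-sym (ℚ.*-identityʳ (δ i j))) (sum-δ i (λ _ → 1ℚ))

  eC eD : EdgeSet n
  eC = edge o (c (fromℕ P))
  eD = edge o (d (fromℕ Q))

  dQ : toℕ (d (fromℕ Q)) ≡ P + Q
  dQ = trans (toℕ-d (fromℕ Q)) (trans (cong dℕ (toℕ-fromℕ Q)) (dℕ-last λ eq → ℕ.n≮0 (subst (2 ≤_) eq 2≤Q)))

  cP : toℕ (c (fromℕ P)) ≡ P
  cP = trans (toℕ-c (fromℕ P)) (toℕ-fromℕ P)

  covered : ∀ {i j} → adj S₀ i j ≡ true → (i ≢ o × parent i ≡ j) ⊎ (j ≢ o × parent j ≡ i) ⊎ Mem eC i j ⊎ Mem eD i j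
  covered {i} {j} e = [ (λ (lt , v) → inj₂ (forward lt v)) , (λ (lt , v) → flip (forward lt v)) ]′ (S-adj⁻ {i} {j} e)
    where
    nonzero : ∀ {x y : Fin n} → toℕ x ℕ.< toℕ y → y ≢ o
    nonzero {x} lt refl = ℕ.n≮0 (subst (toℕ x ℕ.<_) toℕ-o lt)
    forward : ∀ {x y} → toℕ x ℕ.< toℕ y → SEdge (toℕ x) (toℕ y) → (y ≢ o × parent y ≡ x) ⊎ Mem eC x y ⊎ Mem eD x y
    forward {x} {y} lt v with sedge-parent v
    ... | inj₁ eq                = inj₁ (nonzero lt , toℕ-injective (trans (toℕ-parent y) (≡-sym eq)))
    ... | inj₂ (inj₁ (eq , eq′)) = inj₂ (inj₁ (inj₁ (≡-sym (≡o eq) , toℕ-injective (trans cP (≡-sym eq′)))))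
    ... | inj₂ (inj₂ (eq , eq′)) = inj₂ (inj₂ (inj₁ (≡-sym (≡o eq) , toℕ-injective (trans dQ (≡-sym eq′)))))
    flip : ∀ {x y} → (y ≢ o × parent y ≡ x) ⊎ Mem eC x y ⊎ Mem eD x y → (y ≢ o × parent y ≡ x) ⊎ (x ≢ o × parent x ≡ y) ⊎ Mem eC y x ⊎ Mem eD y x
    flip (inj₁ tree)        = inj₁ tree
    flip (inj₂ (inj₁ m))    = inj₂ (inj₂ (inj₁ (mem-sym eC m)))
    flip (inj₂ (inj₂ m))    = inj₂ (inj₂ (inj₂ (mem-sym eD m)))

  bound : Fin n → Fin n → ℚ
  bound i j = (treeArc i j +ℚ treeArc j i) +ℚ (char eC i j +ℚ char eD i j)

  weight≤bound : ∀ i j → weight S₀ i j ≤ℚ bound i j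
  weight≤bound i j = go (adj S₀ i j) refl
    where
    A B C′ D′ : ℚ
    A = treeArc i j
    B = treeArc j i
    C′ = char eC i j
    D′ = char eD i j
    0≤A = treeArc-≥0 i j
    0≤B = treeArc-≥0 j i
    0≤C = b2ℚ-≥0 (does (mem? eC i j))
    0≤D = b2ℚ-≥0 (does (mem? eD i j))
    ≤-+ˡ : ∀ {x y z} → x ≤ℚ y → 0ℚ ≤ℚ z → x ≤ℚ y +ℚ z
    ≤-+ˡ {x} x≤y 0≤z = ≤-respˡ (ℚ.+-identityʳ x) (ℚ.+-mono-≤ x≤y 0≤z)
    ≤-+ʳ : ∀ {x y z} → x ≤ℚ z → 0ℚ ≤ℚ y → x ≤ℚ y +ℚ z
    ≤-+ʳ {x} x≤z 0≤y = ≤-respˡ (ℚ.+-identityˡ x) (ℚ.+-mono-≤ 0≤y x≤z)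
    go : ∀ b → adj S₀ i j ≡ b → b2ℚ b ≤ℚ bound i j
    go false _ = ≤-+ˡ {z = C′ +ℚ D′} (≤-+ˡ {z = B} 0≤A 0≤B) (0≤-+ 0≤C 0≤D)
    go true  e with covered {i} {j} e
    ... | inj₁ (i≢o , eq)         = ≤-+ˡ {z = C′ +ℚ D′} (≤-+ˡ {z = B} (ℚ.≤-reflexive (≡-sym (treeArc-parent i≢o eq))) 0≤B) (0≤-+ 0≤C 0≤D)
    ... | inj₂ (inj₁ (j≢o , eq))  = ≤-+ˡ {z = C′ +ℚ D′} (≤-+ʳ {y = A} (ℚ.≤-reflexive (≡-sym (treeArc-parent j≢o eq))) 0≤A) (0≤-+ 0≤C 0≤D)
    ... | inj₂ (inj₂ (inj₁ m))    = ≤-+ʳ {y = A +ℚ B} (≤-+ˡ {z = D′} (ℚ.≤-reflexive (≡-sym (char-∈ eC m))) 0≤D) (0≤-+ 0≤A 0≤B)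
    ... | inj₂ (inj₂ (inj₂ m))    = ≤-+ʳ {y = A +ℚ B} (≤-+ʳ {y = C′} (ℚ.≤-reflexive (≡-sym (char-∈ eD m))) 0≤C) (0≤-+ 0≤A 0≤B)

  o≢ : ∀ {x} → 1 ≤ toℕ x → o ≢ x
  o≢ {x} 1≤x refl = ℕ.n≮0 (subst (1 ≤_) toℕ-o 1≤x)

  1≤P : 1 ≤ P
  1≤P = ℕ.≤-trans (s≤s z≤n) 2≤P

  sum-bound : sum₂ bound ≡ 2ℚ *ℚ (1ℚ +ℚ ℕ→ℚ n)
  sum-bound = begin
    sum₂ bound
      ≡⟨ sum₂-+ (λ i j → treeArc i j +ℚ treeArc j i) (λ i j → char eC i j +ℚ char eD i j) ⟩
    sum₂ (λ i j → treeArc i j +ℚ treeArc j i) +ℚ sum₂ (λ i j → char eC i j +ℚ char eD i j)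
      ≡⟨ cong₂ _+ℚ_ (sum₂-+ treeArc (λ i j → treeArc j i)) (sum₂-+ (char eC) (char eD)) ⟩
    (sum₂ treeArc +ℚ sum₂ (λ i j → treeArc j i)) +ℚ (sum₂ (char eC) +ℚ sum₂ (char eD))
      ≡⟨ cong₂ _+ℚ_ (cong₂ _+ℚ_ sum-treeArc (trans (∑-comm λ i j → treeArc j i) sum-treeArc))
           (cong₂ _+ℚ_ (sum₂-char (o≢ (subst (1 ≤_) (≡-sym cP) 1≤P)))
                       (sum₂-char (o≢ (subst (1 ≤_) (≡-sym dQ) (ℕ.≤-trans 1≤P (ℕ.m≤m+n P Q)))))) ⟩
    ((ℕ→ℚ n -ℚ 1ℚ) +ℚ (ℕ→ℚ n -ℚ 1ℚ)) +ℚ (2ℚ +ℚ 2ℚ)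
      ≡⟨ collect (ℕ→ℚ n) ⟩
    2ℚ *ℚ (1ℚ +ℚ ℕ→ℚ n) ∎
    where
    open ≡-Reasoning
    collect : ∀ x → ((x -ℚ 1ℚ) +ℚ (x -ℚ 1ℚ)) +ℚ ((1ℚ +ℚ 1ℚ) +ℚ (1ℚ +ℚ 1ℚ)) ≡ (1ℚ +ℚ 1ℚ) *ℚ (1ℚ +ℚ x)
    collect = solve-∀ ℚ-ring

  -- Every edge is a tree arc or a closing edge, so there are at most (n-1)+2. The two edge-disjoint
  -- cycles force at least that many, which spares a proof that the listed edges are distinct.
  S-size : sum₂ (weight S₀) ≡ 2ℚ *ℚ (1ℚ +ℚ ℕ→ℚ n)
  S-size = ℚ.≤-antisym (subst (sum₂ (weight S₀) ≤ℚ_) sum-bound (sum-mono λ i → sum-mono (weight≤bound i)))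
                       (SpanningTree.size-bound S₀ S-connected C D S-disjoint o)

  S-bicyclic : BicyclicGraph n (suc P) (suc Q)
  S-bicyclic = record { graph = S₀ ; connected = S-connected ; size = S-size ; C = C ; D = D ; disjoint = S-disjoint }

  parent-cases : ∀ i → parent i ≡ o ⊎ (toℕ i ≤ P × toℕ (parent i) ≤ P) ⊎ (P ℕ.< toℕ i × toℕ i ≤ P + Q × P ℕ.< toℕ (parent i) × toℕ (parent i) ≤ P + Q)
  parent-cases i = go (toℕ-parent i) (proj₂ (parentℕ-spec (toℕ i)))
    where
    go : ∀ {a} → toℕ (parent i) ≡ a → ParentSpec (toℕ i) a →
         parent i ≡ o ⊎ (toℕ i ≤ P × toℕ (parent i) ≤ P) ⊎ (P ℕ.< toℕ i × toℕ i ≤ P + Q × P ℕ.< toℕ (parent i) × toℕ (parent i) ≤ P + Q)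
    go eq (inj₁ (le , refl))                    = inj₂ (inj₁ (le , ℕ.≤-trans (ℕ.≤-reflexive eq) (ℕ.≤-trans ℕ.pred[n]≤n le)))
    go eq (inj₂ (inj₁ (_ , refl)))              = inj₁ (≡o eq)
    go eq (inj₂ (inj₂ (inj₁ (lt , le , refl)))) = inj₂ (inj₂ (ℕ.<⇒≤ lt , le , subst (P ℕ.<_) (≡-sym eq) (ℕ.pred-mono-≤ lt)
                                                    , ℕ.≤-trans (ℕ.≤-reflexive eq) (ℕ.≤-trans ℕ.pred[n]≤n le)))
    go eq (inj₂ (inj₂ (inj₂ (_ , refl))))       = inj₁ (≡o eq)

  pendant-edge : ∀ {u v} → adj S₀ u v ≡ true → ¬ Mem (cycleEdges c) u v → ¬ Mem (cycleEdges d) u v →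
                 (u ≡ o × P + Q ℕ.< toℕ v) ⊎ (v ≡ o × P + Q ℕ.< toℕ u)
  pendant-edge {u} {v} e ∉C ∉D = [ (λ (_ , s) → inj₁ (go s ∉C ∉D)) , (λ (_ , s) → inj₂ (go s (∉C ∘ mem-sym (cycleEdges c)) (∉D ∘ mem-sym (cycleEdges d)))) ]′ (S-adj⁻ {u} {v} e)
    where
    go : ∀ {x y} → SEdge (toℕ x) (toℕ y) → ¬ Mem (cycleEdges c) x y → ¬ Mem (cycleEdges d) x y → x ≡ o × P + Q ℕ.< toℕ y
    go (pendant eq lt) _ _ = ≡o eq , lt
    go {x} {y} (chain-C eq le) ∉C _ = contradiction (inject₁ i , inj₁ (c-x , c-y)) ∉C
      where
      i = fromℕ< (subst (_≤ P) (≡-sym eq) le)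
      c-x = toℕ-injective (trans (toℕ-c (inject₁ i)) (trans (toℕ-inject₁ i) (toℕ-fromℕ< _)))
      c-y = toℕ-injective (trans (toℕ-c (next (inject₁ i))) (trans (cong toℕ (next-inject₁ i)) (trans (cong suc (toℕ-fromℕ< _)) eq)))
    go {x} {y} (close-C eq eq′) ∉C _ = contradiction (fromℕ P , inj₂ (toℕ-injective (trans cP (≡-sym eq′))
        , toℕ-injective (trans (toℕ-c (next (fromℕ P))) (trans (cong toℕ (next-fromℕ P)) (≡-sym eq))))) ∉C
    go {x} {y} (start-D eq eq′) _ ∉D = contradiction (inject₁ i , inj₁ (d-x , d-y)) ∉D
      where
      i : Fin Q
      i = fromℕ< (ℕ.≤-trans (s≤s z≤n) 2≤Q)
      d-x = toℕ-injective (trans (toℕ-d (inject₁ i)) (trans (cong dℕ (trans (toℕ-inject₁ i) (toℕ-fromℕ< _))) (≡-sym eq)))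
      d-y = toℕ-injective (trans (toℕ-d (next (inject₁ i))) (trans (cong (dℕ ∘ toℕ) (next-inject₁ i))
              (trans (cong (λ t → suc (P + t)) (toℕ-fromℕ< _)) (trans (cong suc (ℕ.+-identityʳ P)) (≡-sym eq′)))))
    go {x} {y} (chain-D lt eq le) _ ∉D with d-image⁺ {x} lt (ℕ.≤-trans (ℕ.n≤1+n _) (subst (_≤ P + Q) (≡-sym eq) le))
    ... | j , refl with view j
    ...   | ‵fromℕ = contradiction (subst (_≤ P + Q) (≡-sym eq) le) (ℕ.<⇒≱ (ℕ.≤-reflexive (cong suc (≡-sym dQ))))
    ...   | ‵inject₁ i = contradiction (inject₁ i , inj₁ (refl , toℕ-injective (trans (toℕ-d (next (inject₁ i)))
              (trans (cong (dℕ ∘ toℕ) (next-inject₁ i)) (trans (advance (toℕ i) nonzero) (trans (cong suc (≡-sym value)) eq)))))) ∉D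
      where
      value : toℕ (d (inject₁ i)) ≡ dℕ (toℕ i)
      value = trans (toℕ-d (inject₁ i)) (cong dℕ (toℕ-inject₁ i))
      nonzero : dℕ (toℕ i) ≢ 0
      nonzero eq₀ = ℕ.n≮0 (subst (P ℕ.<_) (trans value eq₀) lt)
      advance : ∀ t → dℕ t ≢ 0 → dℕ (suc t) ≡ suc (dℕ t)
      advance zero    ne = contradiction refl ne
      advance (suc t) _  = cong suc (ℕ.+-suc P t)
    go {x} {y} (close-D eq eq′) _ ∉D = contradiction (fromℕ Q , inj₂ (toℕ-injective (trans dQ (≡-sym eq′))
        , toℕ-injective (trans (toℕ-d (next (fromℕ Q))) (trans (cong (dℕ ∘ toℕ) (next-fromℕ Q)) (≡-sym eq))))) ∉D

  c-base : ∀ 3≤p → c (base 3≤p) ≡ o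
  c-base 3≤p = ≡o (trans (toℕ-c (base 3≤p)) (toℕ-base 3≤p))

  d-base : ∀ 3≤q → d (base 3≤q) ≡ o
  d-base 3≤q = ≡o (trans (toℕ-d (base 3≤q)) (cong dℕ (toℕ-base 3≤q)))

  climb-C : ∀ {i} → ¬ Image c i → Image c (parent i) → parent i ≡ o
  climb-C {i} ∉c ∈c = [ id , [ (λ (le , _) → contradiction (c-image⁺ le) ∉c)
    , (λ (_ , _ , lt , _) → contradiction (c-image ∈c) (ℕ.<⇒≱ lt)) ]′ ]′ (parent-cases i)

  climb-D : ∀ {i} → ¬ Image d i → Image d (parent i) → parent i ≡ o
  climb-D {i} ∉d ∈d = [ id , [ (λ (_ , le) → [ id , (λ (lt , _) → contradiction le (ℕ.<⇒≱ lt)) ]′ (d-image ∈d))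
    , (λ (lt , le , _) → contradiction (d-image⁺ lt le) ∉d) ]′ ]′ (parent-cases i)

  -- A bridge joins `o` to a pendant vertex, and a pendant vertex is nobody's parent.
  climb-bridge : ∀ {u v i} → adj S₀ u v ≡ true → ¬ Mem (cycleEdges c) u v → ¬ Mem (cycleEdges d) u v → Image (pair u v) (parent i) → parent i ≡ o
  climb-bridge {u} {v} {i} e ∉C ∉D ∈uv = [ id , (λ lt → [ id
      , [ (λ (_ , le) → contradiction (ℕ.≤-trans le (ℕ.m≤m+n P Q)) (ℕ.<⇒≱ lt)) , (λ (_ , _ , _ , le) → contradiction le (ℕ.<⇒≱ lt)) ]′ ]′ (parent-cases i)) ]′
    (ends (pendant-edge e ∉C ∉D) ∈uv)
    where
    ends : ∀ {x} → (u ≡ o × P + Q ℕ.< toℕ v) ⊎ (v ≡ o × P + Q ℕ.< toℕ u) → Image (pair u v) x → x ≡ o ⊎ P + Q ℕ.< toℕ x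
    ends (inj₁ (eq , _)) (zero     , refl) = inj₁ eq
    ends (inj₁ (_ , lt)) (suc zero , refl) = inj₂ lt
    ends (inj₂ (_ , lt)) (zero     , refl) = inj₂ lt
    ends (inj₂ (eq , _)) (suc zero , refl) = inj₁ eq

  S-excess : ∀ {ψ} (pot : Potentials S₀ ψ) j → BlockResistance.excess pot (BicyclicGraph.blocks S-bicyclic j) o ≡ 0ℚ
  S-excess = HangingAtRoot.excess≡0 S-bicyclic o parent parent-adj tree-induction c-base d-base
    (λ {i} → climb-C {i}) (λ {i} → climb-D {i}) (λ {u} {v} {i} → climb-bridge {u} {v} {i})

-- Extremal graphs

outside-pair : ∀ {n k} {f : Fin k → Fin n} → 3 ≤ k → Injective _≡_ _≡_ f → ∀ u v → ∃ λ i → ¬ Image (pair u v) (f i)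
outside-pair {f = f} 3≤k f-injective u v = go (any? λ i → ¬? (image? (pair u v) (f i)))
  where
  go : Dec (∃ λ i → ¬ Image (pair u v) (f i)) → ∃ λ i → ¬ Image (pair u v) (f i)
  go (yes found) = found
  go (no  none)  = contradiction (ℕ.≤-trans 3≤k (Fin.injective⇒≤ {f = λ i → proj₁ (image i)} index-injective)) λ { (s≤s (s≤s ())) }
    where
    image : ∀ i → Image (pair u v) (f i)
    image i = decidable-stable (image? (pair u v) (f i)) λ ∉ → none (i , ∉)
    index-injective : Injective _≡_ _≡_ (λ i → proj₁ (image i))
    index-injective {i} {j} eq = f-injective (trans (≡-sym (proj₂ (image i))) (trans (cong (pair u v) eq) (proj₂ (image j))))

pair-adj : ∀ {n} (G : Graph n) {u v a b} → adj G u v ≡ true → Image (pair u v) a → Image (pair u v) b → a ≢ b → adj G a b ≡ true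
pair-adj G e (zero     , refl) (zero     , refl) a≢b = contradiction refl a≢b
pair-adj G e (zero     , refl) (suc zero , refl) a≢b = e
pair-adj G {u} {v} e (suc zero , refl) (zero , refl) a≢b = trans (Graph.sym G v u) e
pair-adj G e (suc zero , refl) (suc zero , refl) a≢b = contradiction refl a≢b

module Extremal {n p q} (X : BicyclicGraph n p q) where
  open BicyclicGraph X

  module _ (concentrated : ∀ j x {v} → ¬ Image (Block.c (blocks j)) v →
                           Block.π (blocks j) v ≡ Block.π (blocks j) (Block.extra (blocks j) x)) where

    private
      module B j = Block (blocks j)
      module C = Anchor graph C
      module D = Anchor graph D

    π-off : ∀ j {a b} → adj graph a b ≡ true → blockWeight (B.w j) (B.c j) a b ≡ 0ℚ → B.π j a ≡ B.π j b
    π-off j {a} {b} e w≡0 with B.split j a b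
    ... | inj₁ (eq , _)                  = eq
    ... | inj₂ (inj₁ (_ , _ , w≡1 , _))  = contradiction (trans (≡-sym w≡1) w≡0) ℚ.1≢0
    ... | inj₂ (inj₂ (e′ , _)) with () ← trans (≡-sym e) e′

    π-around : ∀ j {k} (E : Cycle graph k) → (∀ i → blockWeight (B.w j) (B.c j) (proj₁ E i) (proj₁ E (next i)) ≡ 0ℚ) →
               ∀ i i′ → B.π j (proj₁ E i) ≡ B.π j (proj₁ E i′)
    π-around j (f , _ , _ , adjacent) off i i′ = next-induction (λ i′ → B.π j (f i) ≡ B.π j (f i′))
      (λ l eq → trans eq (π-off j (adjacent l) (off l))) refl i′

    -- The vertex of `C` at which `D` hangs; `j₀` is its counterpart on `D`.
    i₀ : Fin p
    i₀ = B.π zero D.s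

    j₀ : Fin q
    j₀ = B.π (suc zero) C.s

    -- No edge of `D` is an edge of `C`, so `D` stays within one component when the edges of `C` are
    -- deleted.
    πC-D : ∀ j → B.π zero (d j) ≡ i₀
    πC-D j = π-around zero D (λ l → trans (ℚ.*-identityˡ (cycleWeight c (d l) (d (next l)))) (trans (≡-sym (char-C (d l) (d (next l))))
      (char-∉ C.E λ m → disjoint m (l , inj₁ (refl , refl))))) j D.i₀

    πD-C : ∀ i → B.π (suc zero) (c i) ≡ j₀
    πD-C i = π-around (suc zero) C (λ l → trans (ℚ.*-identityˡ (cycleWeight d (c l) (c (next l)))) (trans (≡-sym (char-D (c l) (c (next l))))
      (char-∉ D.E λ m → disjoint (l , inj₁ (refl , refl)) m))) i C.i₀

    πC-C : ∀ i → B.π zero (c i) ≡ i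
    πC-C = B.π-c zero

    πD-D : ∀ j → B.π (suc zero) (d j) ≡ j
    πD-D = B.π-c (suc zero)

    common-vertex : ∀ {i j} → c i ≡ d j → i ≡ i₀ × j ≡ j₀
    common-vertex {i} {j} eq = trans (≡-sym (πC-C i)) (trans (cong (B.π zero) eq) (πC-D j))
                             , trans (≡-sym (πD-D j)) (trans (cong (B.π (suc zero)) (≡-sym eq)) (πD-C i))

    module _ (e : Fin (length edges)) where
      private
        b : Fin blockCount
        b = suc (suc e)
        u v : Fin n
        u = source e
        v = target e
        uv : EdgeSet n
        uv = edge u v
        spec : adj graph u v ≡ true × ¬ Mem C.E u v × ¬ Mem D.E u v
        spec = Q-adj (edge-adj e)

      weight-uv : ∀ {x y} → ¬ Mem uv x y → blockWeight (B.w b) (B.c b) x y ≡ 0ℚ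
      weight-uv {x} {y} ∉uv = trans (≡-sym (char-edge-pair (source≢target e) x y)) (char-∉ uv ∉uv)

      transport : ∀ (E : EdgeSet n) {x y} → Mem E x y → Mem uv x y → Mem E u v
      transport E m (inj₁ (refl , refl)) = m
      transport E m (inj₂ (refl , refl)) = mem-sym E m

      πB-C : ∀ i i′ → B.π b (c i) ≡ B.π b (c i′)
      πB-C = π-around b C λ l → weight-uv λ m → proj₁ (proj₂ spec) (transport C.E (l , inj₁ (refl , refl)) m)

      πB-D : ∀ j j′ → B.π b (d j) ≡ B.π b (d j′)
      πB-D = π-around b D λ l → weight-uv λ m → proj₂ (proj₂ spec) (transport D.E (l , inj₁ (refl , refl)) m)

      -- Some vertex of `C` is not an end of the bridge, since `C` has three vertices. Concentration
      -- puts it on the side of both anchors' ends, hence no bridge separates the two cycles.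
      πB-C-D : ∀ i j → B.π b (c i) ≡ B.π b (d j)
      πB-C-D i j with outside-pair C.3≤k C.cycle-injective u v
      ... | l , ∉uv = trans (πB-C i C.i₀) (trans (≡-sym (concentrated b zero ∉uv)) (trans (concentrated b (suc zero) ∉uv) (πB-D D.i₀ j)))

      πB-outside : ∀ {x} i → ¬ Image (pair u v) x → B.π b x ≡ B.π b (c i)
      πB-outside i ∉uv = trans (concentrated b zero ∉uv) (πB-C C.i₀ i)

    hub : Fin n
    hub = c i₀

    same-projection : ∀ j → B.π j hub ≡ B.π j (d j₀)
    same-projection zero          = trans (πC-C i₀) (≡-sym (πC-D j₀))
    same-projection (suc zero)    = trans (πD-C i₀) (≡-sym (πD-D j₀))
    same-projection (suc (suc e)) = πB-C-D e i₀ j₀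

    -- No block separates the two vertices, so the indicator of `hub`, telescoped over the blocks,
    -- takes equal values at them. The path joining the cycles thus has length 0.
    hub≡ : hub ≡ d j₀
    hub≡ = δ≡1⇒≡ λ δ≡0 → ℚ.1≢0 (begin
      1ℚ                          ≡⟨ cong₂ _-ℚ_ (δ-refl hub) δ≡0 ⟨
      δ hub hub -ℚ δ hub (d j₀)   ≡⟨ telescope (δ hub) hub (d j₀) ⟩
      sum (λ j → δ hub (project j hub) -ℚ δ hub (project j (d j₀)))
                                  ≡⟨ sum-0 (λ j → trans (cong (λ i → δ hub (B.c j i) -ℚ δ hub (project j (d j₀))) (same-projection j)) (ℚ.+-inverseʳ (δ hub (project j (d j₀))))) ⟩
      0ℚ                          ∎)
      where open ≡-Reasoning

    module _ {w} (∉c : ¬ Image c w) (∉d : ¬ Image d w) where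

      w≢hub : w ≢ hub
      w≢hub eq = ∉c (i₀ , ≡-sym eq)

      no-drop : ∀ j → B.π j w ≡ B.π j hub → δ hub (project j w) -ℚ δ hub (project j hub) ≡ 0ℚ
      no-drop j eq = trans (cong (λ i → δ hub (B.c j i) -ℚ δ hub (project j hub)) eq) (ℚ.+-inverseʳ (δ hub (project j hub)))

      -- If `w` is not an end of the bridge, `w` and `hub` lie on the same side. If it is, `w`
      -- projects to itself, and so `hub` is not the projection of either vertex, unless the bridge
      -- joins `w` to `hub`.
      bridge-drop : adj graph w hub ≢ true → ∀ e → δ hub (project (suc (suc e)) w) -ℚ δ hub (project (suc (suc e)) hub) ≡ 0ℚ
      bridge-drop ¬adj e with toSum (image? (pair (source e) (target e)) w) | toSum (hub ≟ project (suc (suc e)) hub)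
      ... | inj₂ ∉uv | _       = no-drop (suc (suc e)) (πB-outside e i₀ ∉uv)
      ... | inj₁ ∈uv | inj₂ ne = cong₂ _-ℚ_ (δ-≢ λ eq → w≢hub (≡-sym (trans eq (B.π-image (suc (suc e)) ∈uv)))) (δ-≢ ne)
      ... | inj₁ ∈uv | inj₁ eq = contradiction (pair-adj graph (proj₁ (Q-adj (edge-adj e))) ∈uv (B.π (suc (suc e)) hub , ≡-sym eq) w≢hub) ¬adj

      -- The indicator of `hub` changes by -1 from `hub` to `w`, so some block must account for it;
      -- neither cycle does, and a bridge can do so only by joining the two.
      hub-adj : adj graph w hub ≡ true
      hub-adj = decidable-stable (adj graph w hub Bool.≟ true) λ ¬adj → 0≢-1 (begin
        0ℚ                       ≡⟨ sum-0 (drop ¬adj) ⟨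
        sum (λ j → δ hub (project j w) -ℚ δ hub (project j hub))
                                 ≡⟨ telescope (δ hub) w hub ⟨
        δ hub w -ℚ δ hub hub     ≡⟨ cong₂ _-ℚ_ (δ-≢ (w≢hub ∘ ≡-sym)) (δ-refl hub) ⟩
        0ℚ -ℚ 1ℚ                 ∎)
        where
        open ≡-Reasoning
        0≢-1 : 0ℚ ≢ 0ℚ -ℚ 1ℚ
        0≢-1 ()
        drop : adj graph w hub ≢ true → ∀ j → δ hub (project j w) -ℚ δ hub (project j hub) ≡ 0ℚ
        drop ¬adj zero          = no-drop zero (trans (concentrated zero zero ∉c) (≡-sym (πC-C i₀)))
        drop ¬adj (suc zero)    = no-drop (suc zero) (trans (concentrated (suc zero) zero ∉d) (≡-sym (πD-C i₀)))
        drop ¬adj (suc (suc e)) = bridge-drop ¬adj e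

-- Construction of the isomorphism

⟨$⟩ʳ-injective : ∀ {m n} (σ : Permutation m n) {i j} → σ ⟨$⟩ʳ i ≡ σ ⟨$⟩ʳ j → i ≡ j
⟨$⟩ʳ-injective σ {i} {j} eq = trans (≡-sym (Perm.inverseˡ σ)) (trans (cong (σ ⟨$⟩ˡ_) eq) (Perm.inverseˡ σ))

transpose-first : ∀ {n} (i j : Fin n) → PC.transpose i j i ≡ j
transpose-first i j rewrite dec-true (i ≟ i) refl = refl

transpose-other : ∀ {n} {i j k : Fin n} → k ≢ i → k ≢ j → PC.transpose i j k ≡ k
transpose-other {i = i} {j} {k} k≢i k≢j rewrite dec-false (k ≟ i) k≢i | dec-false (k ≟ j) k≢j = refl

-- By induction a permutation is right on all but the last point. A transposition corrects its value
-- there; the earlier values differ from both transposed points and stay fixed.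
extend-injection : ∀ {m n} (m≤n : m ≤ n) (g : Fin m → Fin n) → Injective _≡_ _≡_ g →
                   ∃ λ (σ : Permutation′ n) → ∀ i → σ ⟨$⟩ʳ inject≤ i m≤n ≡ g i
extend-injection {zero}  m≤n g g-injective = Perm.id , λ ()
extend-injection {suc m} {n} m<n g g-injective = τ′ , agree
  where
  m≤n : m ≤ n
  m≤n = ℕ.<⇒≤ m<n
  ih = extend-injection m≤n (g ∘ inject₁) (Fin.inject₁-injective ∘ g-injective)
  σ : Permutation′ n
  σ = proj₁ ih
  x y : Fin n
  x = σ ⟨$⟩ʳ inject≤ (fromℕ m) m<n
  y = g (fromℕ m)
  τ′ : Permutation′ n
  τ′ = σ Perm.∘ₚ Perm.transpose x y
  inject≤-inject₁ : ∀ i → inject≤ (inject₁ i) m<n ≡ inject≤ i m≤n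
  inject≤-inject₁ i = toℕ-injective (trans (Fin.toℕ-inject≤ (inject₁ i) m<n) (trans (toℕ-inject₁ i) (≡-sym (Fin.toℕ-inject≤ i m≤n))))
  agree : ∀ i → τ′ ⟨$⟩ʳ inject≤ i m<n ≡ g i
  agree i with view i
  ... | ‵fromℕ     = transpose-first x y
  ... | ‵inject₁ j = trans (cong (PC.transpose x y) image) (transpose-other ≢x ≢y)
    where
    image : σ ⟨$⟩ʳ inject≤ (inject₁ j) m<n ≡ g (inject₁ j)
    image = trans (cong (σ ⟨$⟩ʳ_) (inject≤-inject₁ j)) (proj₂ ih j)
    ≢x : g (inject₁ j) ≢ x
    ≢x eq = Fin.fromℕ≢inject₁ (≡-sym (toℕ-injective (begin
      toℕ (inject₁ j)                      ≡⟨ Fin.toℕ-inject≤ (inject₁ j) m<n ⟨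
      toℕ (inject≤ (inject₁ j) m<n)        ≡⟨ cong toℕ (⟨$⟩ʳ-injective σ (trans image eq)) ⟩
      toℕ (inject≤ (fromℕ m) m<n)          ≡⟨ Fin.toℕ-inject≤ (fromℕ m) m<n ⟩
      toℕ (fromℕ m)                        ∎)))
      where open ≡-Reasoning
    ≢y : g (inject₁ j) ≢ y
    ≢y eq = Fin.fromℕ≢inject₁ (≡-sym (g-injective eq))

weight-permute : ∀ {n} (G : Graph n) (σ : Permutation′ n) → sum₂ (λ i j → weight G (σ ⟨$⟩ʳ i) (σ ⟨$⟩ʳ j)) ≡ sum₂ (weight G)
weight-permute G σ = ≡-sym (trans (∑-permute (sum ∘ weight G) σ) (sum-cong-≗ λ i → ∑-permute (weight G (σ ⟨$⟩ʳ i)) σ))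

-- The permuted adjacency matrix of `G` dominates that of `H` and has the same total, so they agree.
-- As `σ` leads from `H` to `G`, the isomorphism is its inverse.
isomorphism-by-size : ∀ {n} (G H : Graph n) (σ : Permutation′ n) → sum₂ (weight H) ≡ sum₂ (weight G) →
                      (∀ {i j} → adj H i j ≡ true → adj G (σ ⟨$⟩ʳ i) (σ ⟨$⟩ʳ j) ≡ true) → G ≅ H
isomorphism-by-size {n} G H σ same-size preserves = Perm.flip σ , λ i j → trans (≡-sym (agree (σ ⟨$⟩ˡ i) (σ ⟨$⟩ˡ j)))
    (cong₂ (adj G) (Perm.inverseʳ σ) (Perm.inverseʳ σ))
  where
  Gσ : Fin n → Fin n → ℚ
  Gσ i j = weight G (σ ⟨$⟩ʳ i) (σ ⟨$⟩ʳ j)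
  weight≤ : ∀ i j → 0ℚ ≤ℚ Gσ i j -ℚ weight H i j
  weight≤ i j = ≤⇒0≤ (go (adj H i j) refl)
    where
    go : ∀ b → adj H i j ≡ b → b2ℚ b ≤ℚ Gσ i j
    go false _ = b2ℚ-≥0 (adj G (σ ⟨$⟩ʳ i) (σ ⟨$⟩ʳ j))
    go true  e = ℚ.≤-reflexive (≡-sym (cong b2ℚ (preserves e)))
  difference≡0 : sum₂ (λ i j → Gσ i j -ℚ weight H i j) ≡ 0ℚ
  difference≡0 = trans (sum₂-- Gσ (weight H)) (trans (cong₂ _-ℚ_ (weight-permute G σ) same-size) (ℚ.+-inverseʳ (sum₂ (weight G))))
  b2ℚ-injective : ∀ {x y} → b2ℚ x ≡ b2ℚ y → x ≡ y
  b2ℚ-injective {true}  {true}  _ = refl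
  b2ℚ-injective {false} {false} _ = refl
  agree : ∀ i j → adj G (σ ⟨$⟩ʳ i) (σ ⟨$⟩ʳ j) ≡ adj H i j
  agree i j = b2ℚ-injective (x-y≡0⇒x≡y (sum₂≤0⇒≡0 weight≤ (ℚ.≤-reflexive difference≡0) i j))

module Isomorphism (P Q n : ℕ) (2≤P : 2 ≤ P) (2≤Q : 2 ≤ Q) (P+Q<n : P + Q ℕ.< n) (X : BicyclicGraph n (suc P) (suc Q)) where

  private
    module X = BicyclicGraph X
    module C = Anchor X.graph X.C
    module D = Anchor X.graph X.D
    module S = SGraph P Q n 2≤P 2≤Q P+Q<n

  module _ (i₀ : Fin (suc P)) (j₀ : Fin (suc Q)) (common : X.c i₀ ≡ X.d j₀)
           (only-common : ∀ {i j} → X.c i ≡ X.d j → i ≡ i₀ × j ≡ j₀)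
           (hub-adj : ∀ {w} → ¬ Image X.c w → ¬ Image X.d w → adj X.graph w (X.c i₀) ≡ true) where

    private
      -- The cycles are rotated so that both start at the hub, as those of $S_n^{p,q}$ do.
      r s : ℕ
      r = proj₁ (rotate-transitive zero i₀)
      s = proj₁ (rotate-transitive zero j₀)

    c : Fin (suc P) → Fin n
    c = X.c ∘ rotate r

    d : Fin (suc Q) → Fin n
    d = X.d ∘ rotate s

    c-zero : c zero ≡ X.c i₀
    c-zero = cong X.c (proj₂ (rotate-transitive zero i₀))

    d-zero : d zero ≡ X.d j₀
    d-zero = cong X.d (proj₂ (rotate-transitive zero j₀))

    c-injective : Injective _≡_ _≡_ c
    c-injective eq = rotate-injective r (C.cycle-injective eq)

    d-injective : Injective _≡_ _≡_ d
    d-injective eq = rotate-injective s (D.cycle-injective eq)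

    c-adj : ∀ i → adj X.graph (c i) (c (next i)) ≡ true
    c-adj i = subst (λ j → adj X.graph (c i) (X.c j) ≡ true) (≡-sym (rotate-next r i)) (C.adjacent (rotate r i))

    d-adj : ∀ j → adj X.graph (d j) (d (next j)) ≡ true
    d-adj j = subst (λ i → adj X.graph (d j) (X.d i) ≡ true) (≡-sym (rotate-next s j)) (D.adjacent (rotate s j))

    c≢d : ∀ i j → c i ≢ d (suc j)
    c≢d i j eq = Fin.0≢1+n (rotate-injective s (trans (proj₂ (rotate-transitive zero j₀)) (≡-sym (proj₂ (only-common eq)))))

    g′ : Fin (suc P) ⊎ Fin Q → Fin n
    g′ = [ c , d ∘ suc ]′

    g′-injective : ∀ x y → g′ x ≡ g′ y → x ≡ y
    g′-injective (inj₁ i) (inj₁ i′) eq = cong inj₁ (c-injective eq)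
    g′-injective (inj₁ i) (inj₂ j)  eq = contradiction eq (c≢d i j)
    g′-injective (inj₂ j) (inj₁ i)  eq = contradiction (≡-sym eq) (c≢d i j)
    g′-injective (inj₂ j) (inj₂ j′) eq = cong inj₂ (suc-injective (d-injective eq))

    -- The numbering of the cycle vertices used in $S_n^{p,q}$: first `C`, then `D` without the
    -- shared hub. Its extension `σ` matches the other vertices arbitrarily, as each of them is
    -- adjacent to the hub.
    g : Fin (suc P + Q) → Fin n
    g k = g′ (splitAt (suc P) k)

    g-injective : Injective _≡_ _≡_ g
    g-injective {k} {l} eq = trans (≡-sym (Fin.join-splitAt (suc P) Q k)) (trans
      (cong (Fin.join (suc P) Q) (g′-injective (splitAt (suc P) k) (splitAt (suc P) l) eq)) (Fin.join-splitAt (suc P) Q l))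

    σ : Permutation′ n
    σ = proj₁ (extend-injection P+Q<n g g-injective)

    σ-g : ∀ k → σ ⟨$⟩ʳ inject≤ k P+Q<n ≡ g k
    σ-g = proj₂ (extend-injection P+Q<n g g-injective)

    σ-c : ∀ i → σ ⟨$⟩ʳ S.c i ≡ c i
    σ-c i = trans (cong (σ ⟨$⟩ʳ_) (toℕ-injective (trans (S.toℕ-c i)
        (≡-sym (trans (Fin.toℕ-inject≤ (i ↑ˡ Q) P+Q<n) (Fin.toℕ-↑ˡ i Q))))))
      (trans (σ-g (i ↑ˡ Q)) (cong g′ (Fin.splitAt-↑ˡ (suc P) i Q)))

    σ-o : σ ⟨$⟩ʳ S.o ≡ X.c i₀
    σ-o = trans (cong (σ ⟨$⟩ʳ_) (≡-sym (S.≡o (S.toℕ-c zero)))) (trans (σ-c zero) c-zero)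

    σ-d : ∀ j → σ ⟨$⟩ʳ S.d j ≡ d j
    σ-d zero    = trans (cong (σ ⟨$⟩ʳ_) (S.≡o (S.toℕ-d zero))) (trans σ-o (trans common (≡-sym d-zero)))
    σ-d (suc j) = trans (cong (σ ⟨$⟩ʳ_) (toℕ-injective (trans (S.toℕ-d (suc j))
        (≡-sym (trans (Fin.toℕ-inject≤ (suc P ↑ʳ j) P+Q<n) (Fin.toℕ-↑ʳ (suc P) j))))))
      (trans (σ-g (suc P ↑ʳ j)) (cong g′ (Fin.splitAt-↑ʳ (suc P) Q j)))

    off-cycles : ∀ {v} → P + Q ℕ.< toℕ v → ¬ Image X.c (σ ⟨$⟩ʳ v) × ¬ Image X.d (σ ⟨$⟩ʳ v)
    off-cycles {v} lt = ∉c , ∉d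
      where
      ∉c : ¬ Image X.c (σ ⟨$⟩ʳ v)
      ∉c (i , eq) = ℕ.<⇒≱ (ℕ.≤-<-trans (ℕ.m≤m+n P Q) lt) (S.c-image (l , ⟨$⟩ʳ-injective σ
          (trans (σ-c l) (trans (cong X.c (proj₂ (rotate-surjective r i))) eq))))
        where
        l : Fin (suc P)
        l = proj₁ (rotate-surjective r i)
      ∉d : ¬ Image X.d (σ ⟨$⟩ʳ v)
      ∉d (j , eq) = [ (λ v≡o → ℕ.n≮0 (subst (P + Q ℕ.<_) (trans (cong toℕ v≡o) S.toℕ-o) lt)) , (λ (_ , le) → ℕ.<⇒≱ lt le) ]′
          (S.d-image (l , ⟨$⟩ʳ-injective σ (trans (σ-d l) (trans (cong X.d (proj₂ (rotate-surjective s j))) eq))))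
        where
        l : Fin (suc Q)
        l = proj₁ (rotate-surjective s j)

    Gσ : Fin n → Fin n → Set
    Gσ x y = adj X.graph (σ ⟨$⟩ʳ x) (σ ⟨$⟩ʳ y) ≡ true

    Gσ-sym : ∀ {x y} → Gσ x y → Gσ y x
    Gσ-sym {x} {y} e = trans (Graph.sym X.graph (σ ⟨$⟩ʳ y) (σ ⟨$⟩ʳ x)) e

    Gσ-C : ∀ {x y} → Mem (cycleEdges S.c) x y → Gσ x y
    Gσ-C (i , inj₁ (refl , refl)) = subst₂ (λ a b → adj X.graph a b ≡ true) (≡-sym (σ-c i)) (≡-sym (σ-c (next i))) (c-adj i)
    Gσ-C (i , inj₂ (refl , refl)) = Gσ-sym (Gσ-C (i , inj₁ (refl , refl)))

    Gσ-D : ∀ {x y} → Mem (cycleEdges S.d) x y → Gσ x y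
    Gσ-D (j , inj₁ (refl , refl)) = subst₂ (λ a b → adj X.graph a b ≡ true) (≡-sym (σ-d j)) (≡-sym (σ-d (next j))) (d-adj j)
    Gσ-D (j , inj₂ (refl , refl)) = Gσ-sym (Gσ-D (j , inj₁ (refl , refl)))

    Gσ-pendant : ∀ {v} → P + Q ℕ.< toℕ v → Gσ v S.o
    Gσ-pendant {v} lt = subst (λ a → adj X.graph (σ ⟨$⟩ʳ v) a ≡ true) (≡-sym σ-o) (hub-adj (proj₁ (off-cycles lt)) (proj₂ (off-cycles lt)))

    preserves : ∀ {x y} → adj S.S₀ x y ≡ true → Gσ x y
    preserves {x} {y} e = [ Gσ-C , (λ ∉C → [ Gσ-D , (λ ∉D → pendant (S.pendant-edge e ∉C ∉D)) ]′ (toSum (mem? (cycleEdges S.d) x y))) ]′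
      (toSum (mem? (cycleEdges S.c) x y))
      where
      pendant : (x ≡ S.o × P + Q ℕ.< toℕ y) ⊎ (y ≡ S.o × P + Q ℕ.< toℕ x) → Gσ x y
      pendant (inj₁ (refl , lt)) = Gσ-sym (Gσ-pendant lt)
      pendant (inj₂ (refl , lt)) = Gσ-pendant lt

    ≅S : X.graph ≅ S.S₀
    ≅S = isomorphism-by-size X.graph S.S₀ σ (trans S.S-size (≡-sym X.size)) preserves

no-excess⇒≅S : ∀ {P Q n} (2≤P : 2 ≤ P) (2≤Q : 2 ≤ Q) (P+Q<n : P + Q ℕ.< n) (X : BicyclicGraph n (suc P) (suc Q)) {φ}
               (pot : Potentials (BicyclicGraph.graph X) φ) (o : Fin n) →
               (∀ j → BlockResistance.excess pot (BicyclicGraph.blocks X j) o ≡ 0ℚ) → BicyclicGraph.graph X ≅ S n (suc P) (suc Q)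
no-excess⇒≅S {P} {Q} {n} 2≤P 2≤Q P+Q<n X pot o excess≡0 = Isomorphism.≅S P Q n 2≤P 2≤Q P+Q<n X
    (E.i₀ concentrated) (E.j₀ concentrated) (E.hub≡ concentrated) (E.common-vertex concentrated) (E.hub-adj concentrated)
  where
  module E = Extremal X
  concentrated : ∀ j x {v} → ¬ Image (Block.c (BicyclicGraph.blocks X j)) v → _ ≡ _
  concentrated j = BlockResistance.excess≡0⇒concentrated pot (BicyclicGraph.blocks X j) o (excess≡0 j)

theorem3p1 : ∀ (p q n : ℕ) → 3 ≤ p → 3 ≤ q → p + q ∸ 1 ≤ n →
    (G : Graph n) → InB G p q → ¬ (G ≅ S n p q) →
    (φ ψ : Fin n → Fin n → Fin n → ℚ) →
    Potentials G φ → Potentials (S n p q) ψ →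
    DR (S n p q) ψ < DR G φ
theorem3p1 (suc P) (suc Q) n (s≤s 2≤P) (s≤s 2≤Q) p+q-1≤n G inB G≇S φ ψ potG potS =
  -- The order on ℚ is decidable, so the strict inequality may be refuted: its failure makes all
  -- excesses of `G` vanish and yields the excluded isomorphism.
  decidable-stable (DR (S n (suc P) (suc Q)) ψ ℚ.<? DR G φ) λ ≮ → G≇S
    (no-excess⇒≅S 2≤P 2≤Q P+Q<n X potG o (excess-vanishes X S-bicyclic potG potS o (S-excess potS) (ℚ.≮⇒≥ ≮)))
  where
  P+Q<n : P + Q ℕ.< n
  P+Q<n = subst (_≤ n) (ℕ.+-suc P Q) p+q-1≤n
  open SGraph P Q n 2≤P 2≤Q P+Q<n using (o; S-bicyclic; S-excess)
  X : BicyclicGraph n (suc P) (suc Q)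
  X = inB-bicyclic G inB
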